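{- There is a constant $\alpha > 0$ such that for all $n, m$ with $m \leq n/3$ there is a function $\mathsf{R}: \{0,1\}^n \to \{0,1\}^m$ with the following properties. Suppose $\mathcal{P}$ is an S-R randomized branching program on $\{0,1\}^n \times \{0,1\}^m$ that computes a function $f: \{0,1\}^n \to \{0,1\}$ with failure probability $\delta$, and suppose $T S m \leq \alpha n^2$, where $T = \mathrm{queries}(\mathcal{P})$ and $S = \lceil \log \mathrm{size}(\mathcal{P}) \rceil$. Then \[ \mathrm{density}\{x \in \{0,1\}^n : \mathcal{P}(x, \mathsf{R}(x)) \neq f(x)\} \leq 3\delta + m \cdot 2^{ -\alpha n/m}. \] Furthermore, given $x$ and $m$, $\mathsf{R}(x)$ can be computed in space $O(\log n)$.
   Context: A randomized branching program on $\{0,1\}^n \times \{0,1\}^m$ is a directed acyclic graph in which each nonterminal vertex $v$ is labeled with indices $i(v) \in [n]$, $j(v) \in [m]$ and has four outgoing edges labeled by the four two-bit strings; on input $x$ and random string $y$ one follows from $v$ the edge labeled $x_{i(v)} y_{j(v)}$. It is S-R if for every edge $(v,v')$ between nonterminal vertices, $|i(v) - i(v')| \leq 1$. If a start vertex $v_0$ is designated and every terminal vertex is labeled with an output bit, $\mathcal{P}(x,y)$ is the output bit labeling the terminal vertex reached from $v_0$; $\mathcal{P}$ computes $f$ with failure probability $\delta$ if $\Pr_{y}[\mathcal{P}(x,y) = f(x)] \geq 1 - \delta$ for every $x$, $y$ uniform on $\{0,1\}^m$. $\mathrm{size}(\mathcal{P}) = |V(\mathcal{P})|$. The query complexity $\mathrm{queries}(\mathcal{P})$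 is the maximum over all paths $v_1, \dots, v_T$ of nonterminal vertices of $1 + \#\{t \in \{2,\dots,T\} : i(v_t) \neq i(v_{t-1})\}$. $\mathrm{density}(X) = |X|/2^n$. -}

module Defs where

open import Data.Bool using (Bool; true; false; not; if_then_else_)
open import Data.Nat as ℕ using (ℕ; zero; suc; _≤_; ∣_-_∣)
open import Data.Nat.Properties using (m^n≢0)
open import Data.Nat.Logarithm using (⌈log₂_⌉)
open import Data.Fin using (Fin; toℕ)
open import Data.List using (List; []; _∷_; _++_; map; length; filter; replicate)
open import Data.Product using (Σ; ∃; ∃-syntax; _×_; _,_)
open import Data.Sum using (_⊎_)
open import Data.Unit using (⊤)
open import Data.Empty using (⊥)
open import Data.Integer using (+_)
open import Data.Rational as ℚ using (ℚ; _/_; 1ℚ; 0ℚ)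
open import Relation.Nullary using (¬_; Dec; yes; no)
open import Relation.Binary.PropositionalEquality using (_≡_; _≢_)
open import Function using (_∘_)

Bits : ℕ → Set
Bits k = Fin k → Bool

allBits : (k : ℕ) → List (Bits k)
allBits zero = (λ ()) ∷ []
allBits (suc k) = map (λ b → cons false b) (allBits k) ++ map (λ b → cons true b) (allBits k)
  where
  cons : Bool → Bits k → Bits (suc k)
  cons c b Fin.zero = c
  cons c b (Fin.suc i) = b i

count : (k : ℕ) → (Bits k → Bool) → ℕ
count k P = length (filter (λ b → Data.Bool._≟_ (P b) true) (allBits k))
  where import Data.Bool

fraction : (k : ℕ) → (Bits k → Bool) → ℚ
fraction k P = ((+ count k P) / (2 ℕ.^ k)) {{m^n≢0 2 k}}

bitEq : Bool → Bool → Bool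
bitEq true true = true
bitEq false false = true
bitEq _ _ = false

-- Randomized branching programs on {0,1}^n × {0,1}^m with N vertices
-- (vertex set Fin N, so size = N).

data Node (n m N : ℕ) : Set where
  terminal : Bool → Node n m N
  query : (i : Fin n) → (j : Fin m) → (succ : Bool → Bool → Fin N) → Node n m N

RBP : (n m N : ℕ) → Set
RBP n m N = Fin N → Node n m N

module _ {n m N : ℕ} (P : RBP n m N) where

  NonTerminal : Fin N → Set
  NonTerminal v with P v
  ... | terminal _ = ⊥
  ... | query _ _ _ = ⊤

  Edge : Fin N → Fin N → Set
  Edge v w with P v
  ... | terminal _ = ⊥
  ... | query i j s = ∃[ a ] ∃[ b ] (s a b ≡ w)

  data Reach⁺ : Fin N → Fin N → Set where
    one  : ∀ {v w} → Edge v w → Reach⁺ v w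
    more : ∀ {u v w} → Edge u v → Reach⁺ v w → Reach⁺ u w

  Acyclic : Set
  Acyclic = ∀ v → ¬ Reach⁺ v v

  SRNodes : Node n m N → Node n m N → Set
  SRNodes (query i _ _) (query i′ _ _) = ∣ toℕ i - toℕ i′ ∣ ≤ 1
  SRNodes _ _ = ⊤

  IsSR : Set
  IsSR = ∀ v w → Edge v w → SRNodes (P v) (P w)

  IsNTPath : List (Fin N) → Set
  IsNTPath [] = ⊥
  IsNTPath (v ∷ []) = NonTerminal v
  IsNTPath (v ∷ w ∷ rest) = NonTerminal v × Edge v w × IsNTPath (w ∷ rest)

  -- does the index i change between the two vertices (both nonterminal on paths)
  changes : Node n m N → Node n m N → ℕ
  changes (query i _ _) (query i′ _ _) with toℕ i ℕ.≟ toℕ i′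
  ... | yes _ = 0
  ... | no _ = 1
  changes _ _ = 0

  switches : List (Fin N) → ℕ
  switches [] = 0
  switches (v ∷ []) = 0
  switches (v ∷ w ∷ rest) = changes (P v) (P w) ℕ.+ switches (w ∷ rest)

  -- queries(P) ≤ T  (queries(P) is the maximum of 1 + switches over all
  -- paths of nonterminal vertices)
  QueriesAtMost : ℕ → Set
  QueriesAtMost T = ∀ (path : List (Fin N)) → IsNTPath path → 1 ℕ.+ switches path ≤ T

  step : Bits n → Bits m → Fin N → Fin N
  step x y v with P v
  ... | terminal _ = v
  ... | query i j s = s (x i) (y j)

  iter : ℕ → (Fin N → Fin N) → Fin N → Fin N
  iter zero g v = v
  iter (suc k) g v = iter k g (g v)

  -- P(x,y) from start vertex v₀: output bit of the terminal vertex reached.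
  -- In an acyclic program with N vertices, N steps always reach a terminal
  -- (terminals are fixed points of 'step'); the 'query' case never occurs.
  run : Fin N → Bits n → Bits m → Bool
  run v₀ x y with P (iter N (step x y) v₀)
  ... | terminal b = b
  ... | query _ _ _ = false

  ComputesWithFailure : Fin N → (Bits n → Bool) → ℚ → Set
  ComputesWithFailure v₀ f δ =
    ∀ x → (1ℚ ℚ.- δ) ℚ.≤ fraction m (λ y → bitEq (run v₀ x y) (f x))

  errorDensity : Fin N → (Bits n → Bool) → (Bits n → Bits m) → ℚ
  errorDensity v₀ f R = fraction n (λ x → not (bitEq (run v₀ x (R x)) (f x)))

ℕtoℚ : ℕ → ℚ
ℕtoℚ k = (+ k) / 1

_^ℚ_ : ℚ → ℕ → ℚ
r ^ℚ zero = 1ℚ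
r ^ℚ suc k = r ℚ.* (r ^ℚ k)

-- The real inequality   d ≤ 3δ + m · 2^{-(p/q) n / m}   written out over ℚ:
-- either d ≤ 3δ, or m ≥ 1 and e := (d - 3δ)/m > 0 satisfies
-- e ≤ 2^{-(p/q)n/m}, i.e. e^{q m} · 2^{p n} ≤ 1.
-- (For m = 0 the term m · 2^{-αn/m} is read as 0.)
DensityBound : (d δ : ℚ) (p q n m : ℕ) → Set
DensityBound d δ p q n zero = d ℚ.≤ ℕtoℚ 3 ℚ.* δ
DensityBound d δ p q n (suc k) =
  (d ℚ.≤ ℕtoℚ 3 ℚ.* δ) ⊎
  ((((d ℚ.- ℕtoℚ 3 ℚ.* δ) ℚ.* ((+ 1) / suc k)) ^ℚ (q ℕ.* suc k))
     ℚ.* ℕtoℚ (2 ℕ.^ (p ℕ.* n)) ℚ.≤ 1ℚ)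

-- Log-space computability.  Deterministic Turing machine with a read-only
-- input tape, one read/write work tape (cells indexed by ℕ, symbol 0 = blank),
-- and a write-only output tape (bits are appended).  Space used = the
-- largest work-tape head position reached.

data InSym : Set where
  i0 i1 isep iblank : InSym

data Move : Set where
  L S R : Move

open import Data.Maybe using (Maybe; just; nothing)

record TM : Set where
  field
    K       : ℕ
    W       : ℕ                     -- work alphabet Fin (suc W), 0 = blank
    start   : Fin K
    halting : Fin K → Bool
    -- (state, input symbol, work symbol) ↦
    -- (new state, written work symbol, input move, work move, output bit?)
    δ : Fin K → InSym → Fin (suc W) → Fin K × Fin (suc W) × Move × Move × Maybe Bool

record Config (M : TM) : Set where
  constructor config
  field
    state : Fin (TM.K M)
    ipos  : ℕ
    work  : ℕ → Fin (suc (TM.W M))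
    wpos  : ℕ
    out   : List Bool

move : Move → ℕ → ℕ
move L zero = zero
move L (suc k) = k
move S k = k
move R k = suc k

readIn : List InSym → ℕ → InSym
readIn [] _ = iblank
readIn (a ∷ _) zero = a
readIn (_ ∷ w) (suc k) = readIn w k

emit : Maybe Bool → List Bool → List Bool
emit nothing o = o
emit (just b) o = o ++ (b ∷ [])

stepTM : (M : TM) → List InSym → Config M → Config M
stepTM M w (config q ip wk wp o) with TM.halting M q
... | true = config q ip wk wp o
... | false with TM.δ M q (readIn w ip) (wk wp)
...   | (q′ , a , mi , mw , ob) =
          config q′ (move mi ip) (λ k → if ⌊ k ℕ.≟ wp ⌋ then a else wk k) (move mw wp) (emit ob o)
  where open import Relation.Nullary.Decidable using (⌊_⌋)

initConfig : (M : TM) → Config M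
initConfig M = config (TM.start M) 0 (λ _ → Fin.zero) 0 []

runTM : (M : TM) → List InSym → ℕ → Config M
runTM M w zero = initConfig M
runTM M w (suc t) = stepTM M w (runTM M w t)

bitsToList : (k : ℕ) → Bits k → List Bool
bitsToList zero b = []
bitsToList (suc k) b = b Fin.zero ∷ bitsToList k (b ∘ Fin.suc)

bitSym : Bool → InSym
bitSym false = i0
bitSym true = i1

encodeInput : (n m : ℕ) → Bits n → List InSym
encodeInput n m x = map bitSym (bitsToList n x) ++ (isep ∷ replicate m i1)

LogSpaceComputable : ((n m : ℕ) → Bits n → Bits m) → Set
LogSpaceComputable Rf =
  Σ TM λ M → Σ ℕ λ c → ∀ n m → 3 ℕ.* m ≤ n → ∀ (x : Bits n) →
    (∃[ t ] (TM.halting M (Config.state (runTM M (encodeInput n m x) t)) ≡ true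
             × Config.out (runTM M (encodeInput n m x) t) ≡ bitsToList m (Rf n m x)))
    × (∀ t → Config.wpos (runTM M (encodeInput n m x) t) ≤ c ℕ.* (⌈log₂ n ⌉ ℕ.+ 1))

{-# OPTIONS --safe #-}

-- The i-th output bit of R is an inner product of a segment of the right end of x
-- with a segment further to the left, at distance of order n. A program that moves its
-- input head by at most one position per query needs of order n queries to get from one
-- side to the other, so after fixing y it becomes a two-party protocol whose number of
-- rectangles is at most (size)^O(T/n) = 2^O(αn/m); by Lindsey's lemma no such protocol
-- correlates with the inner product of two segments of length of order n/m.
--
-- The failure event is not itself a protocol, because f is arbitrary. Instead compare
-- P(x, R(x)) with P(x, y) for an independent y: the event P(x, R(x)) ≠ P(x, y) is a
-- protocol, a hybrid argument over the m bits replaces R(x) by an independent y′, and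
-- Pr[P(x, y′) ≠ P(x, y)] ≤ 2δ. One more δ pays for P(x, y) ≠ f(x).
--
-- The segments are chosen by a Bresenham rule (emit a bit each time a counter, advanced
-- by m per position, wraps around), which is computable with three binary counters.
module Submission where

open import Defs
open import Data.Bool using (Bool; true; false; not; if_then_else_; _∧_; _xor_)
import Data.Bool
import Data.Bool.Properties as Boolₚ
open import Data.Empty using (⊥-elim)
open import Data.Fin as Fin using (Fin; zero; suc; toℕ; combine; remQuot; splitAt)
import Data.Fin.Properties as Finₚ
open import Data.Integer as ℤ using (ℤ; +_; -[1+_]; 0ℤ; 1ℤ; -1ℤ; ∣_∣)
import Data.Integer.Properties as ℤₚ
open import Data.Integer.Tactic.RingSolver using (solve-∀)
open import Data.List using (List; []; _∷_; _++_; map; length; filter; _ʳ++_; replicate)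
open import Data.Maybe using (Maybe; just; nothing)
open import Data.Nat as ℕ using (ℕ; zero; suc; _*_; _≤_; _<_; z≤n; s≤s; ∣_-_∣; _∸_; ⌈_/2⌉; ⌊_/2⌋)
open import Data.Nat.DivMod using (_/_; _%_; m/n*n≤m; m%n<n; m≡m%n+[m/n]*n; m/n<m)
open import Data.Nat.Induction using (<-rec)
open import Data.Nat.Logarithm using (⌈log₂_⌉; ⌈log₂⌉-mono-≤; ⌈log₂⌈n/2⌉⌉≡⌈log₂n⌉∸1; ⌈log₂2^n⌉≡n)
import Data.Nat.Properties as ℕₚ
import Data.Nat.Tactic.RingSolver as ℕR
open import Data.Product using (Σ; _×_; _,_; proj₁; proj₂)
open import Data.Rational as ℚ using (ℚ; 0ℚ; 1ℚ)
import Data.Rational.Properties as ℚₚ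
open import Data.Rational.Unnormalised as ℚᵘ using (mkℚᵘ; *≡*; *≤*)
import Data.Rational.Unnormalised.Properties as ℚᵘₚ
open import Data.Sum using (_⊎_; inj₁; inj₂; [_,_]′)
open import Data.Unit using (tt)
import Data.Vec as Vec
open import Function using (_∘_)
open import Relation.Binary.PropositionalEquality
open import Relation.Nullary using (¬_; yes; no; Dec; does)
open import Relation.Nullary.Decidable using (dec-true; dec-false; dec⇒maybe; ⌊_⌋)
import Tactic.RingSolver as RS
open import Tactic.RingSolver.Core.AlmostCommutativeRing using (AlmostCommutativeRing; fromCommutativeRing)

-- Sums over the Boolean cube and Lindsey's lemma

-- The positions between the two segments are known to both parties, so two handovers are at least
-- `U` index changes apart. Shifting x inside segment `j` leaves every output bit except the `j`-th
-- fixed. On such a fibre a hybrid string is therefore constant, and both runs in the tested product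
-- use fixed random strings. Multiplying two protocols squares the number of rectangles.
--
-- All averages are integer sums over the cube, with the denominators `2 ^ m`, `2 ^ n` and `2 ^ h`
-- moved to the other side. Outputs are signs: agreement of two runs is then a product, and the
-- average over two independent strings is a square. The length `U` is a power of two between
-- roughly n/8 and n/4, so that binary counters wrap exactly at `U` while three blocks of length `U`
-- still fit.
--
-- The term m 2^(-αn/m) has no constant in front, so every loss must be absorbed by the exponent.
-- That works only when n is large compared with m. Otherwise the trivial estimate d ≤ 1 ≤ m/2 is
-- used, and the cases m ≤ 1 and size 1 are treated directly.

infixr 5 _◂_
_◂_ : ∀ {k} → Bool → Bits k → Bits (suc k)
(c ◂ b) zero = c
(c ◂ b) (suc i) = b i

sumB : ∀ k → (Bits k → ℤ) → ℤ
sumB zero g = g (λ ())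
sumB (suc k) g = sumB k (λ b → g (false ◂ b)) ℤ.+ sumB k (λ b → g (true ◂ b))

sumB-cong : ∀ k {g h : Bits k → ℤ} → (∀ b → g b ≡ h b) → sumB k g ≡ sumB k h
sumB-cong zero e = e _
sumB-cong (suc k) e = cong₂ ℤ._+_ (sumB-cong k (λ b → e _)) (sumB-cong k (λ b → e _))

sumB-+ : ∀ k (g h : Bits k → ℤ) → sumB k (λ b → g b ℤ.+ h b) ≡ sumB k g ℤ.+ sumB k h
sumB-+ zero g h = refl
sumB-+ (suc k) g h
  rewrite sumB-+ k (λ b → g (false ◂ b)) (λ b → h (false ◂ b))
        | sumB-+ k (λ b → g (true ◂ b)) (λ b → h (true ◂ b)) =
  interchange (sumB k (λ b → g (false ◂ b))) (sumB k (λ b → h (false ◂ b)))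
              (sumB k (λ b → g (true ◂ b))) (sumB k (λ b → h (true ◂ b)))
  where
  interchange : ∀ a b c d → (a ℤ.+ b) ℤ.+ (c ℤ.+ d) ≡ (a ℤ.+ c) ℤ.+ (b ℤ.+ d)
  interchange = solve-∀

sumB-*ˡ : ∀ k (c : ℤ) (g : Bits k → ℤ) → sumB k (λ b → c ℤ.* g b) ≡ c ℤ.* sumB k g
sumB-*ˡ zero c g = refl
sumB-*ˡ (suc k) c g
  rewrite sumB-*ˡ k c (λ b → g (false ◂ b)) | sumB-*ˡ k c (λ b → g (true ◂ b)) =
  sym (ℤₚ.*-distribˡ-+ c _ _)

sumB-0 : ∀ k → sumB k (λ _ → 0ℤ) ≡ 0ℤ
sumB-0 zero = refl
sumB-0 (suc k) rewrite sumB-0 k = refl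

sumB-swap : ∀ k l (g : Bits k → Bits l → ℤ) →
  sumB k (λ a → sumB l (g a)) ≡ sumB l (λ b → sumB k (λ a → g a b))
sumB-swap zero l g = refl
sumB-swap (suc k) l g
  rewrite sumB-swap k l (λ a → g (false ◂ a)) | sumB-swap k l (λ a → g (true ◂ a)) =
  sym (sumB-+ l _ _)

2^suc : ∀ k → + (2 ℕ.^ k) ℤ.+ + (2 ℕ.^ k) ≡ + (2 ℕ.^ suc k)
2^suc k = cong (λ t → + (2 ℕ.^ k ℕ.+ t)) (sym (ℕₚ.+-identityʳ _))

sumB-const : ∀ k (c : ℤ) → sumB k (λ _ → c) ≡ + (2 ℕ.^ k) ℤ.* c
sumB-const zero c = sym (ℤₚ.*-identityˡ c)
sumB-const (suc k) c = begin
  sumB k (λ _ → c) ℤ.+ sumB k (λ _ → c)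
    ≡⟨ cong₂ ℤ._+_ (sumB-const k c) (sumB-const k c) ⟩
  + (2 ℕ.^ k) ℤ.* c ℤ.+ + (2 ℕ.^ k) ℤ.* c
    ≡⟨ ℤₚ.*-distribʳ-+ c (+ (2 ℕ.^ k)) (+ (2 ℕ.^ k)) ⟨
  (+ (2 ℕ.^ k) ℤ.+ + (2 ℕ.^ k)) ℤ.* c
    ≡⟨ cong (ℤ._* c) (2^suc k) ⟩
  + (2 ℕ.^ suc k) ℤ.* c ∎
  where open ≡-Reasoning

sumB-mono : ∀ k {g h : Bits k → ℤ} → (∀ b → g b ℤ.≤ h b) → sumB k g ℤ.≤ sumB k h
sumB-mono zero e = e _
sumB-mono (suc k) e = ℤₚ.+-mono-≤ (sumB-mono k (λ b → e _)) (sumB-mono k (λ b → e _))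

∣sumB∣≤ : ∀ k {g : Bits k → ℤ} {B : ℕ} → (∀ b → ∣ g b ∣ ≤ B) → ∣ sumB k g ∣ ≤ 2 ℕ.^ k ℕ.* B
∣sumB∣≤ zero e = ℕₚ.≤-trans (e _) (ℕₚ.≤-reflexive (sym (ℕₚ.+-identityʳ _)))
∣sumB∣≤ (suc k) {g} {B} e = begin
  ∣ sumB k (λ b → g (false ◂ b)) ℤ.+ sumB k (λ b → g (true ◂ b)) ∣
    ≤⟨ ℤₚ.∣i+j∣≤∣i∣+∣j∣ (sumB k (λ b → g (false ◂ b))) _ ⟩
  ∣ sumB k (λ b → g (false ◂ b)) ∣ ℕ.+ ∣ sumB k (λ b → g (true ◂ b)) ∣
    ≤⟨ ℕₚ.+-mono-≤ (∣sumB∣≤ k (λ b → e _)) (∣sumB∣≤ k (λ b → e _)) ⟩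
  2 ℕ.^ k ℕ.* B ℕ.+ 2 ℕ.^ k ℕ.* B
    ≡⟨ double (2 ℕ.^ k) B ⟩
  2 ℕ.^ suc k ℕ.* B ∎
  where
  open ℕₚ.≤-Reasoning
  double : ∀ t b → t ℕ.* b ℕ.+ t ℕ.* b ≡ (2 ℕ.* t) ℕ.* b
  double = ℕR.solve-∀

infixl 6 _⊕_
_⊕_ : ∀ {k} → Bits k → Bits k → Bits k
(x ⊕ s) i = x i xor s i

-- Points of the cube are functions, and points with equal coordinates need not be equal. Anything
-- that re-indexes a sum has to respect pointwise equality.
Ext : ∀ {k} {A : Set} → (Bits k → A) → Set
Ext g = ∀ {x y} → (∀ i → x i ≡ y i) → g x ≡ g y

sumB-shift : ∀ k (g : Bits k → ℤ) → Ext g → ∀ s → sumB k (λ x → g (x ⊕ s)) ≡ sumB k g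
sumB-shift zero g eg s = eg (λ ())
sumB-shift (suc k) g eg s = go (s zero) refl
  where
  tail : ∀ c c′ → c xor s zero ≡ c′ →
    sumB k (λ x → g ((c ◂ x) ⊕ s)) ≡ sumB k (λ x → g (c′ ◂ x))
  tail c c′ e = trans
    (sumB-cong k {h = λ x → g (c′ ◂ (x ⊕ (s ∘ suc)))} (λ x → eg λ { zero → e ; (suc i) → refl }))
    (sumB-shift k (λ x → g (c′ ◂ x)) (λ p → eg λ { zero → refl ; (suc i) → p i }) (s ∘ suc))
  go : ∀ t → s zero ≡ t → sumB (suc k) (λ x → g (x ⊕ s)) ≡ sumB (suc k) g
  go false e = cong₂ ℤ._+_ (tail false false e) (tail true true (cong not e))
  go true e = trans (cong₂ ℤ._+_ (tail false true e) (tail true false (cong not e)))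
                    (ℤₚ.+-comm (sumB k (λ x → g (true ◂ x))) _)

sg : Bool → ℤ
sg false = 1ℤ
sg true = -1ℤ

sg-xor : ∀ a b → sg (a xor b) ≡ sg a ℤ.* sg b
sg-xor false b = sym (ℤₚ.*-identityˡ _)
sg-xor true false = refl
sg-xor true true = refl

∣sg∣ : ∀ a → ∣ sg a ∣ ≡ 1
∣sg∣ false = refl
∣sg∣ true = refl

0≤i² : ∀ i → 0ℤ ℤ.≤ i ℤ.* i
0≤i² (+ zero) = ℤ.+≤+ z≤n
0≤i² (+ suc n) = ℤ.+≤+ z≤n
0≤i² -[1+ n ] = ℤ.+≤+ z≤n

∣i∣≤1⇒i²≤1 : ∀ i → ∣ i ∣ ≤ 1 → i ℤ.* i ℤ.≤ 1ℤ
∣i∣≤1⇒i²≤1 i p = subst (ℤ._≤ 1ℤ) (ℤₚ.0≤i⇒+∣i∣≡i (0≤i² i))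
  (ℤ.+≤+ (ℕₚ.≤-trans (ℕₚ.≤-reflexive (ℤₚ.abs-* i i)) (ℕₚ.*-mono-≤ p p)))

[i+j]²≤2i²+2j² : ∀ i j → (i ℤ.+ j) ℤ.* (i ℤ.+ j) ℤ.≤ + 2 ℤ.* (i ℤ.* i ℤ.+ j ℤ.* j)
[i+j]²≤2i²+2j² i j = ℤₚ.0≤i-j⇒j≤i (subst (0ℤ ℤ.≤_) (eq i j) (0≤i² (i ℤ.- j)))
  where
  eq : ∀ i j → (i ℤ.- j) ℤ.* (i ℤ.- j) ≡
    + 2 ℤ.* (i ℤ.* i ℤ.+ j ℤ.* j) ℤ.- (i ℤ.+ j) ℤ.* (i ℤ.+ j)
  eq = solve-∀

Bounded : ∀ {k} → (Bits k → ℤ) → Set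
Bounded X = ∀ a → ∣ X a ∣ ≤ 1

-- Each halving of the cube uses (s + t)² ≤ 2 (s² + t²). The k factors 2 make up `2 ^ k`, and the
-- bounded weight `X` disappears at the leaves.
cauchySchwarz : ∀ k (X Z : Bits k → ℤ) → Bounded X →
  sumB k (λ a → X a ℤ.* Z a) ℤ.* sumB k (λ a → X a ℤ.* Z a)
    ℤ.≤ + (2 ℕ.^ k) ℤ.* sumB k (λ a → Z a ℤ.* Z a)
cauchySchwarz zero X Z b = begin
  (x ℤ.* z) ℤ.* (x ℤ.* z) ≡⟨ eq x z ⟩
  (x ℤ.* x) ℤ.* (z ℤ.* z) ≤⟨ ℤₚ.*-monoʳ-≤-nonNeg (z ℤ.* z) {{ℤ.nonNegative (0≤i² z)}} (∣i∣≤1⇒i²≤1 x (b _)) ⟩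
  1ℤ ℤ.* (z ℤ.* z) ∎
  where
  open ℤₚ.≤-Reasoning
  x = X (λ ())
  z = Z (λ ())
  eq : ∀ x z → (x ℤ.* z) ℤ.* (x ℤ.* z) ≡ (x ℤ.* x) ℤ.* (z ℤ.* z)
  eq = solve-∀
cauchySchwarz (suc k) X Z b = begin
  (s ℤ.+ t) ℤ.* (s ℤ.+ t)
    ≤⟨ [i+j]²≤2i²+2j² s t ⟩
  + 2 ℤ.* (s ℤ.* s ℤ.+ t ℤ.* t)
    ≤⟨ ℤₚ.*-monoˡ-≤-nonNeg (+ 2) (ℤₚ.+-mono-≤ (cauchySchwarz k (λ a → X (false ◂ a)) (λ a → Z (false ◂ a)) (λ a → b (false ◂ a)))
                                              (cauchySchwarz k (λ a → X (true ◂ a)) (λ a → Z (true ◂ a)) (λ a → b (true ◂ a)))) ⟩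
  + 2 ℤ.* (+ (2 ℕ.^ k) ℤ.* zf ℤ.+ + (2 ℕ.^ k) ℤ.* zt)
    ≡⟨ eq (+ (2 ℕ.^ k)) zf zt ⟩
  (+ (2 ℕ.^ k) ℤ.+ + (2 ℕ.^ k)) ℤ.* (zf ℤ.+ zt)
    ≡⟨ cong (ℤ._* (zf ℤ.+ zt)) (2^suc k) ⟩
  + (2 ℕ.^ suc k) ℤ.* (zf ℤ.+ zt) ∎
  where
  open ℤₚ.≤-Reasoning
  s = sumB k (λ a → X (false ◂ a) ℤ.* Z (false ◂ a))
  t = sumB k (λ a → X (true ◂ a) ℤ.* Z (true ◂ a))
  zf = sumB k (λ a → Z (false ◂ a) ℤ.* Z (false ◂ a))
  zt = sumB k (λ a → Z (true ◂ a) ℤ.* Z (true ◂ a))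
  eq : ∀ p a b → + 2 ℤ.* (p ℤ.* a ℤ.+ p ℤ.* b) ≡ (p ℤ.+ p) ℤ.* (a ℤ.+ b)
  eq = solve-∀

-- As a matrix in (a, b), the sign of `maskedIP` is a tensor product of 2 × 2 matrices. The base
-- points `xa`, `xb` only permute rows and columns of the factors, so one bound serves every fibre.
maskedIP : ∀ {k} → (c xa xb a b : Bits k) → Bool
maskedIP {zero} c xa xb a b = false
maskedIP {suc k} c xa xb a b =
  (c zero ∧ ((xa zero xor a zero) ∧ (xb zero xor b zero)))
    xor maskedIP (c ∘ suc) (xa ∘ suc) (xb ∘ suc) (a ∘ suc) (b ∘ suc)

-- Squared operator norm of one tensor factor: a Hadamard matrix under the mask, the all-ones matrix
-- outside it.
normSq : Bool → ℕ
normSq true = 2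
normSq false = 4

normSqs : ∀ k → Bits k → ℕ
normSqs zero c = 1
normSqs (suc k) c = normSq (c zero) ℕ.* normSqs k (c ∘ suc)

-- For c = true the 2 × 2 sign matrix has orthogonal rows.
coordinate-bound : ∀ c p q (z₀ z₁ : ℤ) →
  let e = λ a b → sg (c ∧ ((p xor a) ∧ (q xor b)))
      r = λ a → e a false ℤ.* z₀ ℤ.+ e a true ℤ.* z₁
  in r false ℤ.* r false ℤ.+ r true ℤ.* r true ℤ.≤ + normSq c ℤ.* (z₀ ℤ.* z₀ ℤ.+ z₁ ℤ.* z₁)
coordinate-bound false p q z₀ z₁ =
  ℤₚ.0≤i-j⇒j≤i (subst (0ℤ ℤ.≤_) (eq z₀ z₁) (ℤₚ.+-mono-≤ (0≤i² (z₀ ℤ.- z₁)) (0≤i² (z₀ ℤ.- z₁))))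
  where
  eq : ∀ z₀ z₁ → (z₀ ℤ.- z₁) ℤ.* (z₀ ℤ.- z₁) ℤ.+ (z₀ ℤ.- z₁) ℤ.* (z₀ ℤ.- z₁) ≡
    + 4 ℤ.* (z₀ ℤ.* z₀ ℤ.+ z₁ ℤ.* z₁) ℤ.-
    ((1ℤ ℤ.* z₀ ℤ.+ 1ℤ ℤ.* z₁) ℤ.* (1ℤ ℤ.* z₀ ℤ.+ 1ℤ ℤ.* z₁) ℤ.+
     (1ℤ ℤ.* z₀ ℤ.+ 1ℤ ℤ.* z₁) ℤ.* (1ℤ ℤ.* z₀ ℤ.+ 1ℤ ℤ.* z₁))
  eq = solve-∀
coordinate-bound true p q z₀ z₁ = ℤₚ.≤-reflexive (go p q z₀ z₁)
  where
  go : ∀ p q (z₀ z₁ : ℤ) →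
    let e = λ a b → sg ((p xor a) ∧ (q xor b))
        r = λ a → e a false ℤ.* z₀ ℤ.+ e a true ℤ.* z₁
    in r false ℤ.* r false ℤ.+ r true ℤ.* r true ≡ + 2 ℤ.* (z₀ ℤ.* z₀ ℤ.+ z₁ ℤ.* z₁)
  go false false = eq
    where
    eq : ∀ z₀ z₁ → (1ℤ ℤ.* z₀ ℤ.+ 1ℤ ℤ.* z₁) ℤ.* (1ℤ ℤ.* z₀ ℤ.+ 1ℤ ℤ.* z₁) ℤ.+ (1ℤ ℤ.* z₀ ℤ.+ -1ℤ ℤ.* z₁) ℤ.* (1ℤ ℤ.* z₀ ℤ.+ -1ℤ ℤ.* z₁) ≡ + 2 ℤ.* (z₀ ℤ.* z₀ ℤ.+ z₁ ℤ.* z₁)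
    eq = solve-∀
  go false true = eq
    where
    eq : ∀ z₀ z₁ → (1ℤ ℤ.* z₀ ℤ.+ 1ℤ ℤ.* z₁) ℤ.* (1ℤ ℤ.* z₀ ℤ.+ 1ℤ ℤ.* z₁) ℤ.+ (-1ℤ ℤ.* z₀ ℤ.+ 1ℤ ℤ.* z₁) ℤ.* (-1ℤ ℤ.* z₀ ℤ.+ 1ℤ ℤ.* z₁) ≡ + 2 ℤ.* (z₀ ℤ.* z₀ ℤ.+ z₁ ℤ.* z₁)
    eq = solve-∀
  go true false = eq
    where
    eq : ∀ z₀ z₁ → (1ℤ ℤ.* z₀ ℤ.+ -1ℤ ℤ.* z₁) ℤ.* (1ℤ ℤ.* z₀ ℤ.+ -1ℤ ℤ.* z₁) ℤ.+ (1ℤ ℤ.* z₀ ℤ.+ 1ℤ ℤ.* z₁) ℤ.* (1ℤ ℤ.* z₀ ℤ.+ 1ℤ ℤ.* z₁) ≡ + 2 ℤ.* (z₀ ℤ.* z₀ ℤ.+ z₁ ℤ.* z₁)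
    eq = solve-∀
  go true true = eq
    where
    eq : ∀ z₀ z₁ → (-1ℤ ℤ.* z₀ ℤ.+ 1ℤ ℤ.* z₁) ℤ.* (-1ℤ ℤ.* z₀ ℤ.+ 1ℤ ℤ.* z₁) ℤ.+ (1ℤ ℤ.* z₀ ℤ.+ 1ℤ ℤ.* z₁) ℤ.* (1ℤ ℤ.* z₀ ℤ.+ 1ℤ ℤ.* z₁) ≡ + 2 ℤ.* (z₀ ℤ.* z₀ ℤ.+ z₁ ℤ.* z₁)
    eq = solve-∀

transform : ∀ {k} (c xa xb : Bits k) → (Bits k → ℤ) → Bits k → ℤ
transform {k} c xa xb Y a = sumB k (λ b → sg (maskedIP c xa xb a b) ℤ.* Y b)

-- Norms multiply under tensor products: `coordinate-bound` handles the first factor for each fixed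
-- remainder `a`, and the induction hypothesis applies to the two halves of `Y`.
transform-norm : ∀ k (c xa xb : Bits k) (Y : Bits k → ℤ) →
  sumB k (λ a → transform c xa xb Y a ℤ.* transform c xa xb Y a)
    ℤ.≤ + normSqs k c ℤ.* sumB k (λ b → Y b ℤ.* Y b)
transform-norm zero c xa xb Y = ℤₚ.≤-reflexive (eq (Y (λ ())))
  where
  eq : ∀ y → (1ℤ ℤ.* y) ℤ.* (1ℤ ℤ.* y) ≡ 1ℤ ℤ.* (y ℤ.* y)
  eq = solve-∀
transform-norm (suc k) c xa xb Y = begin
  sumB k (λ a → Tr (false ◂ a) ℤ.* Tr (false ◂ a)) ℤ.+ sumB k (λ a → Tr (true ◂ a) ℤ.* Tr (true ◂ a))
    ≡⟨ cong₂ ℤ._+_ (sumB-cong k (λ a → cong (λ t → t ℤ.* t) (split false a)))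
                   (sumB-cong k (λ a → cong (λ t → t ℤ.* t) (split true a))) ⟩
  sumB k (λ a → r false a ℤ.* r false a) ℤ.+ sumB k (λ a → r true a ℤ.* r true a)
    ≡⟨ sumB-+ k _ _ ⟨
  sumB k (λ a → r false a ℤ.* r false a ℤ.+ r true a ℤ.* r true a)
    ≤⟨ sumB-mono k (λ a → coordinate-bound (c zero) (xa zero) (xb zero) (Z false a) (Z true a)) ⟩
  sumB k (λ a → + normSq (c zero) ℤ.* (Z false a ℤ.* Z false a ℤ.+ Z true a ℤ.* Z true a))
    ≡⟨ trans (sumB-*ˡ k (+ normSq (c zero)) (λ a → Z false a ℤ.* Z false a ℤ.+ Z true a ℤ.* Z true a))
             (cong (+ normSq (c zero) ℤ.*_) (sumB-+ k (λ a → Z false a ℤ.* Z false a) (λ a → Z true a ℤ.* Z true a))) ⟩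
  + normSq (c zero) ℤ.* (sumB k (λ a → Z false a ℤ.* Z false a) ℤ.+ sumB k (λ a → Z true a ℤ.* Z true a))
    ≤⟨ ℤₚ.*-monoˡ-≤-nonNeg (+ normSq (c zero))
         (ℤₚ.+-mono-≤ (transform-norm k (c ∘ suc) (xa ∘ suc) (xb ∘ suc) (λ b → Y (false ◂ b)))
                      (transform-norm k (c ∘ suc) (xa ∘ suc) (xb ∘ suc) (λ b → Y (true ◂ b)))) ⟩
  + normSq (c zero) ℤ.* (+ M ℤ.* yf ℤ.+ + M ℤ.* yt)
    ≡⟨ eq (+ normSq (c zero)) (+ M) yf yt ⟩
  (+ normSq (c zero) ℤ.* + M) ℤ.* (yf ℤ.+ yt)
    ≡⟨ cong (ℤ._* (yf ℤ.+ yt)) (ℤₚ.pos-* (normSq (c zero)) M) ⟨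
  + normSqs (suc k) c ℤ.* (yf ℤ.+ yt) ∎
  where
  open ℤₚ.≤-Reasoning
  M = normSqs k (c ∘ suc)
  yf = sumB k (λ b → Y (false ◂ b) ℤ.* Y (false ◂ b))
  yt = sumB k (λ b → Y (true ◂ b) ℤ.* Y (true ◂ b))
  Tr : Bits (suc k) → ℤ
  Tr = transform c xa xb Y
  Z : Bool → Bits k → ℤ
  Z t = transform (c ∘ suc) (xa ∘ suc) (xb ∘ suc) (λ b → Y (t ◂ b))
  e : Bool → Bool → ℤ
  e s t = sg (c zero ∧ ((xa zero xor s) ∧ (xb zero xor t)))
  r : Bool → Bits k → ℤ
  r s a = e s false ℤ.* Z false a ℤ.+ e s true ℤ.* Z true a
  half : ∀ s t a →
    sumB k (λ b → sg (maskedIP c xa xb (s ◂ a) (t ◂ b)) ℤ.* Y (t ◂ b)) ≡ e s t ℤ.* Z t a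
  half s t a = trans
    (sumB-cong k (λ b → trans (cong (ℤ._* Y (t ◂ b)) (sg-xor (c zero ∧ ((xa zero xor s) ∧ (xb zero xor t))) _))
                              (ℤₚ.*-assoc (e s t) _ _)))
    (sumB-*ˡ k (e s t) _)
  split : ∀ s a → Tr (s ◂ a) ≡ r s a
  split s a = cong₂ ℤ._+_ (half s false a) (half s true a)
  eq : ∀ w m y z → w ℤ.* (m ℤ.* y ℤ.+ m ℤ.* z) ≡ (w ℤ.* m) ℤ.* (y ℤ.+ z)
  eq = solve-∀

popcount : ∀ k → Bits k → ℕ
popcount zero c = 0
popcount (suc k) c = (if c zero then 1 else 0) ℕ.+ popcount k (c ∘ suc)

normSqs-popcount : ∀ k c → normSqs k c ℕ.* 2 ℕ.^ popcount k c ≡ 2 ℕ.^ k ℕ.* 2 ℕ.^ k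
normSqs-popcount zero c = refl
normSqs-popcount (suc k) c = go (c zero)
  where
  M = normSqs k (c ∘ suc)
  p = popcount k (c ∘ suc)
  t = 2 ℕ.^ k
  eq₁ : ∀ M p → 2 ℕ.* M ℕ.* (2 ℕ.* p) ≡ 4 ℕ.* (M ℕ.* p)
  eq₁ = ℕR.solve-∀
  eq₂ : ∀ t → 4 ℕ.* (t ℕ.* t) ≡ 2 ℕ.* t ℕ.* (2 ℕ.* t)
  eq₂ = ℕR.solve-∀
  go : ∀ b → normSq b ℕ.* M ℕ.* 2 ℕ.^ ((if b then 1 else 0) ℕ.+ p) ≡ 2 ℕ.* t ℕ.* (2 ℕ.* t)
  go true = trans (eq₁ M (2 ℕ.^ p)) (trans (cong (4 ℕ.*_) (normSqs-popcount k (c ∘ suc))) (eq₂ t))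
  go false = trans (ℕₚ.*-assoc 4 M _) (trans (cong (4 ℕ.*_) (normSqs-popcount k (c ∘ suc))) (eq₂ t))

m²≤n²⇒m≤n : ∀ m n → m ℕ.* m ≤ n ℕ.* n → m ≤ n
m²≤n²⇒m≤n m n p with m ℕ.≤? n
... | yes q = q
... | no q = ⊥-elim (ℕₚ.<⇒≱ (ℕₚ.*-mono-< (ℕₚ.≰⇒> q) (ℕₚ.≰⇒> q)) p)

-- Cauchy-Schwarz and `transform-norm` bound the square of the sum by 2^(4k - popcount). Squares are
-- compared so that an odd popcount needs no root of 2; `h` is any integer up to half of it.
lindsey : ∀ k (c xa xb : Bits k) (X Y : Bits k → ℤ) → Bounded X → Bounded Y →
  ∀ h → h ℕ.+ h ≤ popcount k c →
  ∣ sumB k (λ a → sumB k (λ b → sg (maskedIP c xa xb a b) ℤ.* (X a ℤ.* Y b))) ∣ ℕ.* 2 ℕ.^ h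
    ≤ 2 ℕ.^ k ℕ.* 2 ℕ.^ k
lindsey k c xa xb X Y bX bY h hh = m²≤n²⇒m≤n _ _ (begin
  (d ℕ.* e) ℕ.* (d ℕ.* e)        ≡⟨ eq₁ d e ⟩
  (d ℕ.* d) ℕ.* (e ℕ.* e)        ≤⟨ ℕₚ.*-mono-≤ D²≤ e²≤ ⟩
  (t ℕ.* (M ℕ.* t)) ℕ.* w        ≡⟨ eq₂ t M w ⟩
  (M ℕ.* w) ℕ.* (t ℕ.* t)        ≡⟨ cong (ℕ._* (t ℕ.* t)) (normSqs-popcount k c) ⟩
  (t ℕ.* t) ℕ.* (t ℕ.* t) ∎)
  where
  open ℕₚ.≤-Reasoning
  D = sumB k (λ a → sumB k (λ b → sg (maskedIP c xa xb a b) ℤ.* (X a ℤ.* Y b)))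
  Z = transform c xa xb Y
  d = ∣ D ∣
  e = 2 ℕ.^ h
  t = 2 ℕ.^ k
  M = normSqs k c
  w = 2 ℕ.^ popcount k c
  eq₁ : ∀ d e → (d ℕ.* e) ℕ.* (d ℕ.* e) ≡ (d ℕ.* d) ℕ.* (e ℕ.* e)
  eq₁ = ℕR.solve-∀
  eq₂ : ∀ t M w → (t ℕ.* (M ℕ.* t)) ℕ.* w ≡ (M ℕ.* w) ℕ.* (t ℕ.* t)
  eq₂ = ℕR.solve-∀
  e²≤ : e ℕ.* e ≤ w
  e²≤ = ℕₚ.≤-trans (ℕₚ.≤-reflexive (sym (ℕₚ.^-distribˡ-+-* 2 h h))) (ℕₚ.^-monoʳ-≤ 2 hh)
  rot : ∀ s x y → s ℤ.* (x ℤ.* y) ≡ x ℤ.* (s ℤ.* y)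
  rot = solve-∀
  D≡ : D ≡ sumB k (λ a → X a ℤ.* Z a)
  D≡ = sumB-cong k (λ a → trans (sumB-cong k (λ b → rot (sg (maskedIP c xa xb a b)) (X a) (Y b)))
                                (sumB-*ˡ k (X a) (λ b → sg (maskedIP c xa xb a b) ℤ.* Y b)))
  Y²≤ : sumB k (λ b → Y b ℤ.* Y b) ℤ.≤ + t
  Y²≤ = ℤₚ.≤-trans (sumB-mono k (λ b → ∣i∣≤1⇒i²≤1 (Y b) (bY b)))
                   (ℤₚ.≤-reflexive (trans (sumB-const k 1ℤ) (ℤₚ.*-identityʳ _)))
  chain : D ℤ.* D ℤ.≤ + (t ℕ.* (M ℕ.* t))
  chain = ℤₚ.≤-trans (ℤₚ.≤-reflexive (cong (λ v → v ℤ.* v) D≡))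
    (ℤₚ.≤-trans (cauchySchwarz k X Z bX)
    (ℤₚ.≤-trans (ℤₚ.*-monoˡ-≤-nonNeg (+ t) (ℤₚ.≤-trans (transform-norm k c xa xb Y)
                                                (ℤₚ.*-monoˡ-≤-nonNeg (+ M) Y²≤)))
    (ℤₚ.≤-reflexive (trans (cong (+ t ℤ.*_) (sym (ℤₚ.pos-* M t))) (sym (ℤₚ.pos-* t (M ℕ.* t)))))))
  D²≤ : d ℕ.* d ≤ t ℕ.* (M ℕ.* t)
  D²≤ = ℤₚ.drop‿+≤+ (subst (ℤ._≤ + (t ℕ.* (M ℕ.* t)))
    (sym (trans (cong +_ (sym (ℤₚ.abs-* D D))) (ℤₚ.0≤i⇒+∣i∣≡i (0≤i² D)))) chain)

-- Discrepancy of two-party simulations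

sumF : ∀ N → (Fin N → ℤ) → ℤ
sumF zero g = 0ℤ
sumF (suc N) g = g zero ℤ.+ sumF N (g ∘ suc)

sumF-0 : ∀ N {g : Fin N → ℤ} → (∀ i → g i ≡ 0ℤ) → sumF N g ≡ 0ℤ
sumF-0 zero e = refl
sumF-0 (suc N) e = cong₂ ℤ._+_ (e zero) (sumF-0 N (e ∘ suc))

indicator : ∀ {A : Set} → Dec A → ℤ
indicator (yes _) = 1ℤ
indicator (no _) = 0ℤ

indicator-yes : ∀ {A : Set} (d : Dec A) → A → indicator d ≡ 1ℤ
indicator-yes (yes _) _ = refl
indicator-yes (no n) a = ⊥-elim (n a)

indicator-no : ∀ {A : Set} (d : Dec A) → ¬ A → indicator d ≡ 0ℤ
indicator-no (yes a) n = ⊥-elim (n a)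
indicator-no (no _) _ = refl

∣indicator∣≤1 : ∀ {A : Set} (d : Dec A) → ∣ indicator d ∣ ≤ 1
∣indicator∣≤1 (yes _) = s≤s z≤n
∣indicator∣≤1 (no _) = z≤n

sumF-single : ∀ N (g : Fin N → ℤ) j → (∀ i → i ≢ j → g i ≡ 0ℤ) → sumF N g ≡ g j
sumF-single (suc N) g zero e =
  trans (cong (λ v → g zero ℤ.+ v) (sumF-0 N (λ i → e (suc i) λ ()))) (ℤₚ.+-identityʳ _)
sumF-single (suc N) g (suc j) e =
  trans (cong₂ ℤ._+_ (e zero λ ()) (sumF-single N (g ∘ suc) j λ i i≢ → e (suc i) (i≢ ∘ Finₚ.suc-injective)))
        (ℤₚ.+-identityˡ _)

module Discrepancy {k : ℕ} (K : Bits k → Bits k → ℤ) (t s : ℕ)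
  (rectangle : ∀ X Y → Bounded X → Bounded Y →
     ∣ sumB k (λ a → sumB k (λ b → K a b ℤ.* (X a ℤ.* Y b))) ∣ ℕ.* t ≤ s) where

  corr : (X Y : Bits k → ℤ) → (Bits k → Bits k → ℤ) → ℤ
  corr X Y F = sumB k (λ a → sumB k (λ b → (K a b ℤ.* (X a ℤ.* Y b)) ℤ.* F a b))

  corr-cong : ∀ X Y {F G} → (∀ a b → F a b ≡ G a b) → corr X Y F ≡ corr X Y G
  corr-cong X Y e = sumB-cong k λ a → sumB-cong k λ b → cong ((K a b ℤ.* (X a ℤ.* Y b)) ℤ.*_) (e a b)

  corr-+ : ∀ X Y F G → corr X Y (λ a b → F a b ℤ.+ G a b) ≡ corr X Y F ℤ.+ corr X Y G
  corr-+ X Y F G = trans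
    (sumB-cong k λ a → trans (sumB-cong k λ b → ℤₚ.*-distribˡ-+ (K a b ℤ.* (X a ℤ.* Y b)) (F a b) (G a b))
                             (sumB-+ k (λ b → (K a b ℤ.* (X a ℤ.* Y b)) ℤ.* F a b) (λ b → (K a b ℤ.* (X a ℤ.* Y b)) ℤ.* G a b)))
    (sumB-+ k (λ a → sumB k (λ b → (K a b ℤ.* (X a ℤ.* Y b)) ℤ.* F a b))
              (λ a → sumB k (λ b → (K a b ℤ.* (X a ℤ.* Y b)) ℤ.* G a b)))

  -- `c` is the number of rectangles charged to `F`. Quantifying over all bounded weights, not just
  -- over indicator functions or constants, is what lets the bound survive a change of the party
  -- that speaks.
  Disc : ℕ → (Bits k → Bits k → ℤ) → Set
  Disc c F = ∀ X Y → Bounded X → Bounded Y → ∣ corr X Y F ∣ ℕ.* t ≤ c ℕ.* s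

  Disc-cong : ∀ {c F G} → (∀ a b → F a b ≡ G a b) → Disc c F → Disc c G
  Disc-cong {c} e d X Y bX bY =
    subst (λ v → ∣ v ∣ ℕ.* t ≤ c ℕ.* s) (corr-cong X Y e) (d X Y bX bY)

  Disc-1 : Disc 1 (λ _ _ → 1ℤ)
  Disc-1 X Y bX bY = ℕₚ.≤-trans
    (ℕₚ.≤-reflexive (cong (λ v → ∣ v ∣ ℕ.* t)
      (sumB-cong k λ a → sumB-cong k λ b → ℤₚ.*-identityʳ (K a b ℤ.* (X a ℤ.* Y b)))))
    (ℕₚ.≤-trans (rectangle X Y bX bY) (ℕₚ.≤-reflexive (sym (ℕₚ.+-identityʳ s))))

  Disc-+ : ∀ {c d F G} → Disc c F → Disc d G → Disc (c ℕ.+ d) (λ a b → F a b ℤ.+ G a b)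
  Disc-+ {c} {d} {F} {G} dF dG X Y bX bY = begin
    ∣ corr X Y (λ a b → F a b ℤ.+ G a b) ∣ ℕ.* t
      ≡⟨ cong (λ v → ∣ v ∣ ℕ.* t) (corr-+ X Y F G) ⟩
    ∣ corr X Y F ℤ.+ corr X Y G ∣ ℕ.* t
      ≤⟨ ℕₚ.*-monoˡ-≤ t (ℤₚ.∣i+j∣≤∣i∣+∣j∣ (corr X Y F) (corr X Y G)) ⟩
    (∣ corr X Y F ∣ ℕ.+ ∣ corr X Y G ∣) ℕ.* t
      ≡⟨ ℕₚ.*-distribʳ-+ t ∣ corr X Y F ∣ _ ⟩
    ∣ corr X Y F ∣ ℕ.* t ℕ.+ ∣ corr X Y G ∣ ℕ.* t
      ≤⟨ ℕₚ.+-mono-≤ (dF X Y bX bY) (dG X Y bX bY) ⟩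
    c ℕ.* s ℕ.+ d ℕ.* s
      ≡⟨ ℕₚ.*-distribʳ-+ s c d ⟨
    (c ℕ.+ d) ℕ.* s ∎
    where open ℕₚ.≤-Reasoning

  Disc-0 : Disc 0 (λ _ _ → 0ℤ)
  Disc-0 X Y bX bY = ℕₚ.≤-reflexive (cong (λ v → ∣ v ∣ ℕ.* t) (trans
    (sumB-cong k λ a → trans (sumB-cong k λ b → ℤₚ.*-zeroʳ (K a b ℤ.* (X a ℤ.* Y b))) (sumB-0 k)) (sumB-0 k)))

  Disc-sumF : ∀ {c} M {F : Fin M → Bits k → Bits k → ℤ} → (∀ i → Disc c (F i)) →
    Disc (M ℕ.* c) (λ a b → sumF M (λ i → F i a b))
  Disc-sumF zero d = Disc-0
  Disc-sumF {c} (suc M) {F} d = Disc-+ {c} {M ℕ.* c} {F zero} (d zero) (Disc-sumF M (d ∘ suc))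

  own : Bool → Bits k → Bits k → Bits k
  own true a b = a
  own false a b = b

  -- A factor that depends on one party's input is merged into that party's weight and costs
  -- nothing.
  Disc-weight : ∀ {c F} p (H : Bits k → ℤ) → Bounded H → Disc c F →
    Disc c (λ a b → H (own p a b) ℤ.* F a b)
  Disc-weight {c} {F} true H bH d X Y bX bY =
    subst (λ v → ∣ v ∣ ℕ.* t ≤ c ℕ.* s)
      (sumB-cong k λ a → sumB-cong k λ b → eq (K a b) (X a) (Y b) (H a) (F a b))
      (d (λ a → X a ℤ.* H a) Y (λ a → ℕₚ.≤-trans (ℕₚ.≤-reflexive (ℤₚ.abs-* (X a) (H a))) (ℕₚ.*-mono-≤ (bX a) (bH a))) bY)
    where
    eq : ∀ κ x y h f → κ ℤ.* ((x ℤ.* h) ℤ.* y) ℤ.* f ≡ κ ℤ.* (x ℤ.* y) ℤ.* (h ℤ.* f)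
    eq = solve-∀
  Disc-weight {c} {F} false H bH d X Y bX bY =
    subst (λ v → ∣ v ∣ ℕ.* t ≤ c ℕ.* s)
      (sumB-cong k λ a → sumB-cong k λ b → eq (K a b) (X a) (Y b) (H b) (F a b))
      (d X (λ b → Y b ℤ.* H b) bX (λ b → ℕₚ.≤-trans (ℕₚ.≤-reflexive (ℤₚ.abs-* (Y b) (H b))) (ℕₚ.*-mono-≤ (bY b) (bH b))))
    where
    eq : ∀ κ x y h f → κ ℤ.* (x ℤ.* (y ℤ.* h)) ℤ.* f ≡ κ ℤ.* (x ℤ.* y) ℤ.* (h ℤ.* f)
    eq = solve-∀

-- Two-party simulation of a branching program

data Outcome (N : ℕ) : Set where
  stop : Bool → Outcome N
  hand : ℕ → Fin N → Outcome N

-- A message is a vertex together with the remaining fuel, hence N * N messages per round.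
leaves : ℕ → ℕ → ℕ
leaves N zero = 1
leaves N (suc r) = suc (N ℕ.* (N ℕ.* leaves N r))

module Walk {n m N : ℕ} (P : RBP n m N) where

  nodeOut : Node n m N → Bool
  nodeOut (terminal b) = b
  nodeOut (query _ _ _) = false

  output : Bits n → Bits m → ℕ → Fin N → Bool
  output x y f v = nodeOut (P (iter P f (step P x y) v))

  run≡output : ∀ v x y → run P v x y ≡ output x y N v
  run≡output v x y with P (iter P N (step P x y) v)
  ... | terminal b = refl
  ... | query _ _ _ = refl

  step-terminal : ∀ x y v {b} → P v ≡ terminal b → step P x y v ≡ v
  step-terminal x y v e with P v
  step-terminal x y v refl | .(terminal _) = refl

  step-query : ∀ x y v {i j s} → P v ≡ query i j s → step P x y v ≡ s (x i) (y j)
  step-query x y v e with P v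
  step-query x y v refl | .(query _ _ _) = refl

  output-terminal : ∀ x y f v {b} → P v ≡ terminal b → output x y f v ≡ b
  output-terminal x y zero v e = cong nodeOut e
  output-terminal x y (suc f) v e =
    trans (cong (output x y f) (step-terminal x y v e)) (output-terminal x y f v e)

  step-cong : ∀ {x x′ y y′} → (∀ i → x i ≡ x′ i) → (∀ j → y j ≡ y′ j) → ∀ v → step P x y v ≡ step P x′ y′ v
  step-cong ex ey v with P v
  ... | terminal _ = refl
  ... | query i j s = cong₂ s (ex i) (ey j)

  output-cong : ∀ {x x′ y y′} → (∀ i → x i ≡ x′ i) → (∀ j → y j ≡ y′ j) → ∀ f v → output x y f v ≡ output x′ y′ f v
  output-cong ex ey zero v = refl
  output-cong {x} {x′} {y} {y′} ex ey (suc f) v =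
    trans (output-cong ex ey f (step P x y v)) (cong (output x′ y′ f) (step-cong ex ey v))

  run-cong : ∀ {x x′ y y′} → (∀ i → x i ≡ x′ i) → (∀ j → y j ≡ y′ j) → ∀ v → run P v x y ≡ run P v x′ y′
  run-cong {x} {x′} {y} {y′} ex ey v =
    trans (run≡output v x y) (trans (output-cong ex ey N v) (sym (run≡output v x′ y′)))

  edge : ∀ v {i j s} → P v ≡ query i j s → ∀ a b → Edge P v (s a b)
  edge v e a b with P v
  edge v refl a b | .(query _ _ _) = a , b , refl

  nonTerminal : ∀ v {i j s} → P v ≡ query i j s → NonTerminal P v
  nonTerminal v e with P v
  nonTerminal v refl | .(query _ _ _) = tt

  -- Counts the queries ahead rather than those already made, so that an edge lowers it by its own
  -- change. For a nonterminal `v` the one-vertex path already forces t ≥ 1.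
  Budget : Fin N → ℕ → Set
  Budget v t = ∀ rest → IsNTPath P (v ∷ rest) → switches P (v ∷ rest) < t

  budget-step : ∀ v {i j s t} → P v ≡ query i j s → ∀ a b → Budget v t →
    Budget (s a b) (t ℕ.∸ changes P (P v) (P (s a b)))
  budget-step v {s = s} {t} e a b B rest path =
    ℕₚ.m+n≤o⇒m≤o∸n _ (ℕₚ.≤-trans (ℕₚ.≤-reflexive (cong suc (ℕₚ.+-comm (switches P (s a b ∷ rest)) _)))
      (B (s a b ∷ rest) (nonTerminal v e , edge v e a b , path)))

  -- Each of two parties simulates the program as long as it stays where its
  -- potential is positive, then hands the vertex and the remaining fuel over.
  module Protocol (pot : Bool → Fin n → ℕ) (g : ℕ)
    (lipschitz : ∀ p i i′ → ∣ toℕ i - toℕ i′ ∣ ≤ 1 → pot p i ≤ suc (pot p i′))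
    (cross : ∀ p i → pot p i ≡ 0 → g ≤ pot (not p) i)
    (sr : IsSR P) where

    module _ (x : Bits n) (y : Bits m) (pt : Fin n → ℕ) where
      phase : ℕ → Fin N → Outcome N
      phaseAt : ℕ → Fin N → Node n m N → Outcome N
      phaseQuery : ℕ → Fin N → ℕ → Fin N → Outcome N
      phase zero v = stop (nodeOut (P v))
      phase (suc f) v = phaseAt f v (P v)
      phaseAt f v (terminal b) = stop b
      phaseAt f v (query i j s) = phaseQuery f v (pt i) (s (x i) (y j))
      -- The fuel at `v` is `suc f`, but `f` is recorded: it lies below the fuel with which the
      -- phase began, so at most `N` values occur. The receiver restarts with `suc f`.
      phaseQuery f v zero w = hand f v
      phaseQuery f v (suc _) w = phase f w

      FuelBelow : ℕ → Outcome N → Set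
      FuelBelow f o = ∀ f′ w → o ≡ hand f′ w → f′ < f

      phase-fuel : ∀ f v → FuelBelow f (phase f v)
      phaseAt-fuel : ∀ f v nd → FuelBelow (suc f) (phaseAt f v nd)
      phaseQuery-fuel : ∀ f v d w → FuelBelow (suc f) (phaseQuery f v d w)
      phase-fuel zero v f′ w ()
      phase-fuel (suc f) v = phaseAt-fuel f v (P v)
      phaseAt-fuel f v (terminal b) f′ w ()
      phaseAt-fuel f v (query i j s) = phaseQuery-fuel f v (pt i) (s (x i) (y j))
      phaseQuery-fuel f v zero w .f .v refl = ℕₚ.≤-refl
      phaseQuery-fuel f v (suc _) w f′ w′ e = ℕₚ.m≤n⇒m≤1+n (phase-fuel f w f′ w′ e)

    -- An edge that keeps the index keeps the potential. An edge that changes it moves by at most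
    -- one position, by the S-R condition, and is counted by `changes`.
    pot-step : ∀ p v {i j s i′ j′ s′} → P v ≡ query i j s → ∀ a b → P (s a b) ≡ query i′ j′ s′ →
      pot p i ≤ pot p i′ ℕ.+ changes P (P v) (P (s a b))
    pot-step p v {i} {j} {s} {i′} {j′} {s′} e a b e′ =
      subst₂ (λ A B → pot p i ≤ pot p i′ ℕ.+ changes P A B) (sym e) (sym e′) (go near)
      where
      near : ∣ toℕ i - toℕ i′ ∣ ≤ 1
      near = subst₂ (SRNodes P) e e′ (sr v (s a b) (edge v e a b))
      go : ∣ toℕ i - toℕ i′ ∣ ≤ 1 → pot p i ≤ pot p i′ ℕ.+ changes P (query i j s) (query i′ j′ s′)
      go d with toℕ i ℕ.≟ toℕ i′
      ... | yes q = ℕₚ.≤-reflexive (trans (cong (pot p) (Finₚ.toℕ-injective q)) (sym (ℕₚ.+-identityʳ _)))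
      ... | no _ = ℕₚ.≤-trans (lipschitz p i i′ d) (ℕₚ.≤-reflexive (sym (ℕₚ.+-comm _ 1)))

    module Approximation {k : ℕ} (K : Bits k → Bits k → ℤ) (t s : ℕ)
      (rectangle : ∀ X Y → Bounded X → Bounded Y →
         ∣ sumB k (λ a → sumB k (λ b → K a b ℤ.* (X a ℤ.* Y b))) ∣ ℕ.* t ≤ s)
      (z : Bits k → Bits k → Bits n) (part : Bool → Bits k → Bits n)
      (agree : ∀ p a b i → pot p i ≢ 0 →
         z a b i ≡ part p (Discrepancy.own K t s rectangle p a b) i)
      (y : Bits m) where

      open Discrepancy K t s rectangle

      -- `r` is the number of handovers still allowed; a handover beyond that yields 0 instead of a
      -- sign.
      approx : Bool → ℕ → ℕ → Fin N → Bits k → Bits k → ℤ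
      resolve : Bool → ℕ → Outcome N → Bits k → Bits k → ℤ
      approx p r f v a b = resolve p r (phase (part p (own p a b)) y (pot p) f v) a b
      resolve p r (stop c) a b = sg c
      resolve p zero (hand f w) a b = 0ℤ
      resolve p (suc r) (hand f w) a b = approx (not p) r (suc f) w a b

      -- The invariant of the simulation: the remaining budget is covered by the current party's
      -- potential plus `g` for each handover left. A move costs the potential no more than the
      -- budget, and a handover trades one `g` for the other party's potential.
      Sufficient : Bool → ℕ → Node n m N → ℕ → Set
      Sufficient p r nd τ = ∀ {i j s} → nd ≡ query i j s → τ ≤ pot p i ℕ.+ r ℕ.* g

      Correct : ℕ → Set
      Correct r = ∀ p f v τ → Budget v τ → Sufficient p r (P v) τ → ∀ a b →
        sg (output (z a b) y f v) ≡ approx p r f v a b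

      -- One phase, by induction on the fuel. The next phase enters only through `ih`, which keeps
      -- the recursion on handovers outside the recursion on fuel.
      correct-given : ∀ r → (∀ r′ → r ≡ suc r′ → Correct r′) → Correct r
      correct-given r ih p zero v τ B suff a b = refl
      correct-given r ih p (suc f) v τ B suff a b = atNode (P v) refl
        where
        x = part p (own p a b)
        atNode : ∀ nd → P v ≡ nd →
          sg (output (z a b) y (suc f) v) ≡ resolve p r (phaseAt x y (pot p) f v nd) a b
        atNode (terminal c) e = cong sg (output-terminal (z a b) y (suc f) v e)
        atNode (query i j s) e = atQuery (pot p i) refl
          where
          w = s (z a b i) (y j)
          move-on : ∀ d → pot p i ≡ suc d → sg (output (z a b) y (suc f) v) ≡
            resolve p r (phase x y (pot p) f (s (x i) (y j))) a b
          move-on d q = trans (cong (λ u → sg (output (z a b) y f u)) (step-query (z a b) y v e))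
            (trans (correct-given r ih p f w (τ ℕ.∸ changes P (P v) (P w)) (budget-step v e _ _ B) suff′ a b)
              (cong (λ c → approx p r f (s c (y j)) a b)
                (agree p a b i λ z → ℕₚ.0≢1+n (trans (sym z) q))))
            where
            suff′ : Sufficient p r (P w) (τ ℕ.∸ changes P (P v) (P w))
            suff′ {i′} e′ = ℕₚ.m≤n+o⇒m∸n≤o τ ch (begin
              τ                             ≤⟨ suff e ⟩
              pot p i ℕ.+ r ℕ.* g           ≤⟨ ℕₚ.+-monoˡ-≤ (r ℕ.* g) (pot-step p v e _ _ e′) ⟩
              pot p i′ ℕ.+ ch ℕ.+ r ℕ.* g   ≡⟨ rearr (pot p i′) ch (r ℕ.* g) ⟩
              ch ℕ.+ (pot p i′ ℕ.+ r ℕ.* g) ∎)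
              where
              open ℕₚ.≤-Reasoning
              ch = changes P (P v) (P w)
              rearr : ∀ a b c → a ℕ.+ b ℕ.+ c ≡ b ℕ.+ (a ℕ.+ c)
              rearr = ℕR.solve-∀
          hand-over : ∀ r′ → r ≡ r′ → pot p i ≡ 0 → sg (output (z a b) y (suc f) v) ≡ resolve p r′ (hand f v) a b
          -- With neither potential nor handovers left the budget would be 0, which is impossible at
          -- a nonterminal vertex.
          hand-over zero r≡ q = ⊥-elim (ℕₚ.n≮0 (ℕₚ.<-≤-trans (B [] (nonTerminal v e))
            (ℕₚ.≤-trans (suff e) (ℕₚ.≤-reflexive (cong₂ (λ a b → a ℕ.+ b ℕ.* g) q r≡)))))
          hand-over (suc r′) r≡ q = ih r′ r≡ (not p) (suc f) v τ B suff′ a b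
            where
            suff′ : Sufficient (not p) r′ (P v) τ
            suff′ {i′} e′ with trans (sym e) e′
            ... | refl = ℕₚ.≤-trans (suff e) (ℕₚ.≤-trans
              (ℕₚ.≤-reflexive (cong₂ (λ a b → a ℕ.+ b ℕ.* g) q r≡))
              (ℕₚ.+-monoˡ-≤ (r′ ℕ.* g) (cross p i q)))
          atQuery : ∀ d → pot p i ≡ d → sg (output (z a b) y (suc f) v) ≡
            resolve p r (phaseQuery x y (pot p) f v d (s (x i) (y j))) a b
          atQuery zero q = hand-over r refl q
          atQuery (suc d) q = move-on d q

      approx-correct : ∀ r → Correct r
      approx-correct zero = correct-given zero λ _ ()
      approx-correct (suc r) = correct-given (suc r) λ { _ refl → approx-correct r }

      stopWeight : Outcome N → ℤ
      stopWeight (stop c) = sg c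
      stopWeight (hand _ _) = 0ℤ

      handWeight : Fin N → Fin N → Outcome N → ℤ
      handWeight f w (stop _) = 0ℤ
      handWeight f w (hand f′ w′) = indicator (toℕ f ℕ.≟ f′) ℤ.* indicator (w Fin.≟ w′)

      ∣stopWeight∣≤1 : ∀ o → ∣ stopWeight o ∣ ≤ 1
      ∣stopWeight∣≤1 (stop c) = ℕₚ.≤-reflexive (∣sg∣ c)
      ∣stopWeight∣≤1 (hand _ _) = z≤n

      ∣handWeight∣≤1 : ∀ f w o → ∣ handWeight f w o ∣ ≤ 1
      ∣handWeight∣≤1 f w (stop c) = z≤n
      ∣handWeight∣≤1 f w (hand f′ w′) = ℕₚ.≤-trans
        (ℕₚ.≤-reflexive (ℤₚ.abs-* (indicator (toℕ f ℕ.≟ f′)) (indicator (w Fin.≟ w′))))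
        (ℕₚ.*-mono-≤ (∣indicator∣≤1 (toℕ f ℕ.≟ f′)) (∣indicator∣≤1 (w Fin.≟ w′)))

      sum-handWeight-stop : ∀ o (h : ℕ → Fin N → ℤ) →
        sumF N (λ f → sumF N (λ w → handWeight f w (stop o) ℤ.* h (toℕ f) w)) ≡ 0ℤ
      sum-handWeight-stop o h = sumF-0 N λ f → sumF-0 N λ w → refl

      sum-handWeight-hand : ∀ f w (h : ℕ → Fin N → ℤ) → f < N →
        sumF N (λ f′ → sumF N (λ w′ → handWeight f′ w′ (hand f w) ℤ.* h (toℕ f′) w′)) ≡ h f w
      sum-handWeight-hand f w h f<N = trans
        (sumF-single N _ f̂ λ f′ ne → sumF-0 N λ w′ →
          cong (λ c → c ℤ.* indicator (w′ Fin.≟ w) ℤ.* h (toℕ f′) w′)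
            (indicator-no (toℕ f′ ℕ.≟ f) λ q → ne (Finₚ.toℕ-injective (trans q (sym f̂≡)))))
        (trans (sumF-single N _ w λ w′ ne → cong (ℤ._* h (toℕ f̂) w′)
            (trans (cong (indicator (toℕ f̂ ℕ.≟ f) ℤ.*_) (indicator-no (w′ Fin.≟ w) ne)) (ℤₚ.*-zeroʳ (indicator (toℕ f̂ ℕ.≟ f)))))
          (trans (cong₂ (λ c d → c ℤ.* d ℤ.* h (toℕ f̂) w) (indicator-yes (toℕ f̂ ℕ.≟ f) f̂≡) (indicator-yes (w Fin.≟ w) refl))
            (trans (ℤₚ.*-identityˡ _) (cong (λ c → h c w) f̂≡))))
        where
        f̂ = Fin.fromℕ< f<N
        f̂≡ = Finₚ.toℕ-fromℕ< f<N

      -- Exactly one of the N * N possible messages matches a handover, so the sum over messages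
      -- recovers its continuation. In this form all weights depend on `o`, that is, on one party's
      -- input.
      resolve-split : ∀ p r o a b G → (∀ f w → o ≡ hand f w → f < N) →
        stopWeight o ℤ.* G ℤ.+
          sumF N (λ f → sumF N (λ w → handWeight f w o ℤ.* (approx (not p) r (suc (toℕ f)) w a b ℤ.* G)))
        ≡ resolve p (suc r) o a b ℤ.* G
      resolve-split p r (stop c) a b G below =
        trans (cong (λ v → sg c ℤ.* G ℤ.+ v) (sum-handWeight-stop c (λ f w → approx (not p) r (suc f) w a b ℤ.* G)))
              (ℤₚ.+-identityʳ _)
      resolve-split p r (hand f w) a b G below =
        trans (ℤₚ.+-identityˡ _)
          (sum-handWeight-hand f w (λ f w → approx (not p) r (suc f) w a b ℤ.* G) (below f w refl))

      -- A phase contributes one stopping term and one term per message, which is the recursion of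
      -- `leaves`. The factor `G` is carried along so that a product of two protocols is bounded by
      -- applying the lemma twice.
      Disc-approx : ∀ {c G} → Disc c G → ∀ p r f v → f ≤ N →
        Disc (leaves N r ℕ.* c) (λ a b → approx p r f v a b ℤ.* G a b)
      Disc-approx {c} {G} dG p zero f v f≤N =
        subst (λ l → Disc l _) (sym (ℕₚ.+-identityʳ c))
          (Disc-cong {c} (λ a b → cong (ℤ._* G a b) (stop-only (o (own p a b)) a b))
            (Disc-weight {c} p (stopWeight ∘ o) (∣stopWeight∣≤1 ∘ o) dG))
        where
        o : Bits k → Outcome N
        o d = phase (part p d) y (pot p) f v
        stop-only : ∀ o a b → stopWeight o ≡ resolve p zero o a b
        stop-only (stop _) a b = refl
        stop-only (hand _ _) a b = refl
      Disc-approx {c} {G} dG p (suc r) f v f≤N =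
        subst (λ l → Disc l (λ a b → approx p (suc r) f v a b ℤ.* G a b)) (cong (c ℕ.+_) (assoc N (leaves N r) c))
          (Disc-cong {c ℕ.+ N ℕ.* (N ℕ.* (leaves N r ℕ.* c))}
            (λ a b → resolve-split p r (o (own p a b)) a b (G a b)
              λ f′ w e → ℕₚ.<-≤-trans (phase-fuel (part p (own p a b)) y (pot p) f v f′ w e) f≤N)
            (Disc-+ {c} {N ℕ.* (N ℕ.* (leaves N r ℕ.* c))}
              {λ a b → stopWeight (o (own p a b)) ℤ.* G a b}
              (Disc-weight {c} {G} p (stopWeight ∘ o) (∣stopWeight∣≤1 ∘ o) dG)
              (Disc-sumF N λ f′ → Disc-sumF N λ w →
                Disc-weight {leaves N r ℕ.* c} p (handWeight f′ w ∘ o) (∣handWeight∣≤1 f′ w ∘ o)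
                  (Disc-approx {c} dG (not p) r (suc (toℕ f′)) w (Finₚ.toℕ<n f′)))))
        where
        o : Bits k → Outcome N
        o d = phase (part p d) y (pot p) f v
        assoc : ∀ N l c → N ℕ.* (N ℕ.* (l ℕ.* c)) ≡ N ℕ.* (N ℕ.* l) ℕ.* c
        assoc = ℕR.solve-∀

-- The extractor

-- Past the end the value is false. The machine agrees there: the separator behind the input is not
-- a one.
at : ∀ {n} → Bits n → ℕ → Bool
at {zero} x p = false
at {suc n} x zero = x zero
at {suc n} x (suc p) = at (x ∘ suc) p

at-cong : ∀ {n} {x y : Bits n} → (∀ i → x i ≡ y i) → ∀ p → at x p ≡ at y p
at-cong {zero} e p = refl
at-cong {suc n} e zero = e zero
at-cong {suc n} e (suc p) = at-cong (e ∘ suc) p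

at-⊕ : ∀ {n} (x y : Bits n) p → at (x ⊕ y) p ≡ at x p xor at y p
at-⊕ {zero} x y p = refl
at-⊕ {suc n} x y zero = refl
at-⊕ {suc n} x y (suc p) = at-⊕ (x ∘ suc) (y ∘ suc) p

at-≥ : ∀ {n} (x : Bits n) p → n ≤ p → at x p ≡ false
at-≥ {zero} x p _ = refl
at-≥ {suc n} x (suc p) (s≤s q) = at-≥ (x ∘ suc) p q

at-toℕ : ∀ {n} (x : Bits n) i → at x (toℕ i) ≡ x i
at-toℕ {suc n} x zero = refl
at-toℕ {suc n} x (suc i) = at-toℕ (x ∘ suc) i

at-tabulate : ∀ {n} (F : ℕ → Bool) p → p < n → at {n} (F ∘ toℕ) p ≡ F p
at-tabulate {n} F p p<n = trans (cong (at {n} (F ∘ toℕ)) (sym (Finₚ.toℕ-fromℕ< p<n)))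
  (trans (at-toℕ {n} (F ∘ toℕ) (Fin.fromℕ< p<n)) (cong F (Finₚ.toℕ-fromℕ< p<n)))

xorSum : (ℕ → Bool) → ℕ → Bool
xorSum F zero = false
xorSum F (suc u) = xorSum F u xor F u

xorSum-cong : ∀ {F G : ℕ → Bool} U → (∀ u → u < U → F u ≡ G u) → xorSum F U ≡ xorSum G U
xorSum-cong zero e = refl
xorSum-cong (suc U) e = cong₂ _xor_ (xorSum-cong U λ u q → e u (ℕₚ.m≤n⇒m≤1+n q)) (e U ℕₚ.≤-refl)

xorSum-first : ∀ F U → xorSum F (suc U) ≡ F 0 xor xorSum (F ∘ suc) U
xorSum-first F zero = sym (Boolₚ.xor-identityʳ (F 0))
xorSum-first F (suc U) = trans (cong (_xor F (suc U)) (xorSum-first F U))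
  (Boolₚ.xor-assoc (F 0) _ _)

xorSum≡maskedIP : ∀ U (F : ℕ → Bool) (c xa xb a b : Bits U) →
  (∀ i → F (toℕ i) ≡ c i ∧ ((xa i xor a i) ∧ (xb i xor b i))) →
  xorSum F U ≡ maskedIP c xa xb a b
xorSum≡maskedIP zero F c xa xb a b e = refl
xorSum≡maskedIP (suc U) F c xa xb a b e = trans (xorSum-first F U)
  (cong₂ _xor_ (e zero) (xorSum≡maskedIP U (F ∘ suc) _ _ _ _ _ (e ∘ suc)))

-- Binary counting with an implicit leading one: s + 1 = 2^w + v with v < 2^w.
grow : ℕ → ℕ × ℕ
grow zero = 0 , 0
grow (suc s) with grow s
... | w , v with suc v ℕ.≟ 2 ℕ.^ w
...   | yes _ = suc w , 0
...   | no _ = w , suc v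

grow-spec : ∀ s → let (w , v) = grow s in (v < 2 ℕ.^ w) × (2 ℕ.^ w ℕ.+ v ≡ suc s)
grow-spec zero = s≤s z≤n , refl
grow-spec (suc s) with grow s | grow-spec s
... | w , v | v< , eq with suc v ℕ.≟ 2 ℕ.^ w
...   | yes q = ℕₚ.m^n>0 2 (suc w) , trans (double (2 ℕ.^ w)) (trans (cong (2 ℕ.^ w ℕ.+_) (sym q)) (trans (ℕₚ.+-suc _ v) (cong suc eq)))
  where
  double : ∀ t → 2 ℕ.* t ℕ.+ 0 ≡ t ℕ.+ t
  double = ℕR.solve-∀
...   | no q = ℕₚ.≤∧≢⇒< v< q , trans (ℕₚ.+-suc _ v) (cong suc eq)

width : ℕ → ℕ
width n = proj₁ (grow (n / 4))

-- u belongs to segment j when ⌊u m / U⌋ = j.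
inSeg : (U m j u : ℕ) → Bool
inSeg U m j u = does (j ℕ.* U ℕ.≤? u ℕ.* m) ∧ does (u ℕ.* m ℕ.<? suc j ℕ.* U)

-- For 3 U ≤ n these are n ∸ U + u and n ∸ 3 U + u; otherwise the subtractions truncate,
-- exactly as the head of the machine stops at the left end of the input.
rightPos leftPos : (n U u : ℕ) → ℕ
rightPos n U u = n ∸ (U ∸ u)
leftPos n U u = rightPos n U u ∸ 2 ℕ.* U

summand : ∀ {n} (U m : ℕ) → Bits n → ℕ → ℕ → Bool
summand {n} U m x j u = inSeg U m j u ∧ (at x (rightPos n U u) ∧ at x (leftPos n U u))

extract : ∀ {n} (U m : ℕ) → Bits n → ℕ → Bool
extract U m x j = xorSum (summand U m x j) U

inSeg-true : ∀ U m j u → j ℕ.* U ≤ u ℕ.* m → u ℕ.* m < suc j ℕ.* U → inSeg U m j u ≡ true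
inSeg-true U m j u p q = cong₂ _∧_ (dec-true (j ℕ.* U ℕ.≤? u ℕ.* m) p) (dec-true (u ℕ.* m ℕ.<? suc j ℕ.* U) q)

inSeg-sound : ∀ U m j u → inSeg U m j u ≡ true → (j ℕ.* U ≤ u ℕ.* m) × (u ℕ.* m < suc j ℕ.* U)
inSeg-sound U m j u e with j ℕ.* U ℕ.≤? u ℕ.* m
... | no p rewrite dec-false (j ℕ.* U ℕ.≤? u ℕ.* m) p with () ← e
... | yes p rewrite dec-true (j ℕ.* U ℕ.≤? u ℕ.* m) p with u ℕ.* m ℕ.<? suc j ℕ.* U
...   | yes q = p , q
...   | no q rewrite dec-false (u ℕ.* m ℕ.<? suc j ℕ.* U) q with () ← e

inSeg-unique : ∀ U m j j′ u → inSeg U m j u ≡ true → inSeg U m j′ u ≡ true → j ≡ j′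
inSeg-unique U m j j′ u e e′ =
  ℕₚ.≤-antisym (below (proj₁ s) (proj₂ s′)) (below (proj₁ s′) (proj₂ s))
  where
  s = inSeg-sound U m j u e
  s′ = inSeg-sound U m j′ u e′
  below : ∀ {i k} → i ℕ.* U ≤ u ℕ.* m → u ℕ.* m < suc k ℕ.* U → i ≤ k
  below {i} {k} p q = ℕₚ.≤-pred (ℕₚ.*-cancelʳ-< U i (suc k) (ℕₚ.≤-<-trans p q))

popcount-interval : ∀ U (c : ℕ → Bool) s l → s ℕ.+ l ≤ U → (∀ u → s ≤ u → u < s ℕ.+ l → c u ≡ true) →
  l ≤ popcount U (c ∘ toℕ)
popcount-interval U c s zero _ _ = z≤n
popcount-interval zero c s (suc l) p _ = ⊥-elim (ℕₚ.n≮0 (ℕₚ.≤-trans (ℕₚ.≤-reflexive (sym (ℕₚ.+-suc s l))) p))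
popcount-interval (suc U) c zero (suc l) (s≤s p) e =
  ℕₚ.+-mono-≤ (ℕₚ.≤-reflexive (cong (λ t → if t then 1 else 0) (sym (e 0 z≤n (s≤s z≤n)))))
    (popcount-interval U (c ∘ suc) zero l p λ u _ q → e (suc u) z≤n (s≤s q))
popcount-interval (suc U) c (suc s) l@(suc _) (s≤s p) e =
  ℕₚ.≤-trans (popcount-interval U (c ∘ suc) s l p λ u q q′ → e (suc u) (s≤s q) (s≤s q′)) (ℕₚ.m≤n+m _ _)

segment-size : ∀ U m j → j < m → .{{_ : ℕ.NonZero m}} → U / m ≤ popcount U (inSeg U m j ∘ toℕ)
segment-size U m@(suc _) j j<m = popcount-interval U (inSeg U m j) s l fits inside
  where
  open ℕₚ.≤-Reasoning
  l = U / m
  -- the least s with j U ≤ s m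
  s = (j ℕ.* U ℕ.+ (m ∸ 1)) / m
  lower : j ℕ.* U ≤ s ℕ.* m
  lower = ℕₚ.+-cancelʳ-≤ (m ∸ 1) (j ℕ.* U) (s ℕ.* m) (begin
    j ℕ.* U ℕ.+ (m ∸ 1)  ≡⟨ m≡m%n+[m/n]*n (j ℕ.* U ℕ.+ (m ∸ 1)) m ⟩
    (j ℕ.* U ℕ.+ (m ∸ 1)) % m ℕ.+ s ℕ.* m ≤⟨ ℕₚ.+-monoˡ-≤ (s ℕ.* m) (ℕₚ.≤-pred (m%n<n (j ℕ.* U ℕ.+ (m ∸ 1)) m)) ⟩
    (m ∸ 1) ℕ.+ s ℕ.* m ≡⟨ ℕₚ.+-comm (m ∸ 1) _ ⟩
    s ℕ.* m ℕ.+ (m ∸ 1) ∎)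
  upper : (s ℕ.+ l) ℕ.* m < suc j ℕ.* U ℕ.+ m
  upper = begin-strict
    (s ℕ.+ l) ℕ.* m                ≡⟨ ℕₚ.*-distribʳ-+ m s l ⟩
    s ℕ.* m ℕ.+ l ℕ.* m            ≤⟨ ℕₚ.+-mono-≤ (m/n*n≤m (j ℕ.* U ℕ.+ (m ∸ 1)) m) (m/n*n≤m U m) ⟩
    j ℕ.* U ℕ.+ (m ∸ 1) ℕ.+ U      <⟨ ℕₚ.≤-reflexive (eq (j ℕ.* U) (m ∸ 1) U) ⟩
    suc j ℕ.* U ℕ.+ m ∎
    where
    eq : ∀ a b c → suc (a ℕ.+ b ℕ.+ c) ≡ c ℕ.+ a ℕ.+ suc b
    eq = ℕR.solve-∀
  -- By `upper`, (s + l) m exceeds (j + 1) U by less than m, so even the last of the `l` positions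
  -- satisfies u m < (j + 1) U.
  inside : ∀ u → s ≤ u → u < s ℕ.+ l → inSeg U m j u ≡ true
  inside u p q = inSeg-true U m j u (ℕₚ.≤-trans lower (ℕₚ.*-monoˡ-≤ m p))
    (ℕₚ.+-cancelˡ-< m (u ℕ.* m) (suc j ℕ.* U) (begin-strict
      suc u ℕ.* m ≤⟨ ℕₚ.*-monoˡ-≤ m q ⟩
      (s ℕ.+ l) ℕ.* m <⟨ upper ⟩
      suc j ℕ.* U ℕ.+ m ≡⟨ ℕₚ.+-comm (suc j ℕ.* U) m ⟩
      m ℕ.+ suc j ℕ.* U ∎))
  fits : s ℕ.+ l ≤ U
  fits = ℕₚ.≤-pred (ℕₚ.*-cancelʳ-< m (s ℕ.+ l) (suc U) (begin-strict
    (s ℕ.+ l) ℕ.* m <⟨ upper ⟩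
    suc j ℕ.* U ℕ.+ m ≤⟨ ℕₚ.+-monoˡ-≤ m (ℕₚ.*-monoˡ-≤ U j<m) ⟩
    m ℕ.* U ℕ.+ m ≡⟨ trans (ℕₚ.+-comm _ m) (cong (m ℕ.+_) (ℕₚ.*-comm m U)) ⟩
    suc U ℕ.* m ∎))

extract-cong : ∀ {n} U m {x y : Bits n} → (∀ i → x i ≡ y i) → ∀ j → extract U m x j ≡ extract U m y j
extract-cong {n} U m e j = xorSum-cong U λ u _ →
  cong (inSeg U m j u ∧_) (cong₂ _∧_ (at-cong e (rightPos n U u)) (at-cong e (leftPos n U u)))

-- The hybrid string for bit `j`: fresh bits up to and including `j`, seed bits above it. It does
-- not read bit `j` of the seed, which thus enters a test only through its sign.
splice : ∀ {m} → Fin m → Bits m → Bits m → Bits m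
splice j z r i = if does (toℕ i ℕ.≤? toℕ j) then z i else r i

splice-cong : ∀ {m} (j : Fin m) z {r r′ : Bits m} → (∀ i → i ≢ j → r i ≡ r′ i) →
  ∀ i → splice j z r i ≡ splice j z r′ i
splice-cong j z e i with toℕ i ℕ.≤? toℕ j
... | yes q rewrite dec-true (toℕ i ℕ.≤? toℕ j) q = refl
... | no q rewrite dec-false (toℕ i ℕ.≤? toℕ j) q = e i λ { refl → q ℕₚ.≤-refl }

-- Blocks of the input and the regions known to the parties

embed : ∀ {n U} (base : ℕ) (c : ℕ → Bool) → Bits U → Bits n
embed base c a i = if does (base ℕ.≤? toℕ i) then c (toℕ i ∸ base) ∧ at a (toℕ i ∸ base) else false

module Geometry (n U m : ℕ) (3U≤n : 3 ℕ.* U ≤ n) where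

  U≤n : U ≤ n
  U≤n = ℕₚ.≤-trans (ℕₚ.m≤n*m U 3) 3U≤n

  -- The right block is [`rb`, n), the gap [`lo`, `rb`), the left block [`lb`, `lo`), each of length
  -- `U`. Shifts act on the outer two blocks only; the gap is common knowledge.
  rb lb lo : ℕ
  rb = n ∸ U
  lo = n ∸ 2 ℕ.* U
  lb = n ∸ 3 ℕ.* U

  rb+U : rb ℕ.+ U ≡ n
  rb+U = ℕₚ.m∸n+n≡m U≤n

  lo+U : lo ℕ.+ U ≡ rb
  lo+U = ℕₚ.+-cancelʳ-≡ U (lo ℕ.+ U) rb (trans (eq lo U)
    (trans (ℕₚ.m∸n+n≡m (ℕₚ.≤-trans (ℕₚ.*-monoˡ-≤ U {2} {3} (s≤s (s≤s z≤n))) 3U≤n)) (sym rb+U)))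
    where
    eq : ∀ a b → a ℕ.+ b ℕ.+ b ≡ a ℕ.+ 2 ℕ.* b
    eq = ℕR.solve-∀

  lb+U : lb ℕ.+ U ≡ lo
  lb+U = ℕₚ.+-cancelʳ-≡ U (lb ℕ.+ U) lo (ℕₚ.+-cancelʳ-≡ U (lb ℕ.+ U ℕ.+ U) (lo ℕ.+ U) (trans (eq lb U)
    (trans (ℕₚ.m∸n+n≡m 3U≤n) (trans (sym rb+U) (cong (ℕ._+ U) (sym lo+U))))))
    where
    eq : ∀ a b → a ℕ.+ b ℕ.+ b ℕ.+ b ≡ a ℕ.+ 3 ℕ.* b
    eq = ℕR.solve-∀

  rightPos≡ : ∀ u → u < U → rightPos n U u ≡ rb ℕ.+ u
  rightPos≡ u u<U = trans (cong (_∸ (U ∸ u)) (trans (sym rb+U) (trans (cong (rb ℕ.+_) (sym (ℕₚ.m+[n∸m]≡n (ℕₚ.<⇒≤ u<U)))) (sym (ℕₚ.+-assoc rb u _)))))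
    (ℕₚ.m+n∸n≡m (rb ℕ.+ u) (U ∸ u))

  leftPos≡ : ∀ u → u < U → leftPos n U u ≡ lb ℕ.+ u
  leftPos≡ u u<U = trans (cong (_∸ 2 ℕ.* U) (trans (rightPos≡ u u<U) (trans (cong (ℕ._+ u) (trans (sym lo+U) (cong (ℕ._+ U) (sym lb+U)))) (eq lb U u))))
    (ℕₚ.m+n∸n≡m (lb ℕ.+ u) (2 ℕ.* U))
    where
    eq : ∀ a b c → a ℕ.+ b ℕ.+ b ℕ.+ c ≡ a ℕ.+ c ℕ.+ 2 ℕ.* b
    eq = ℕR.solve-∀

  rightPos<n : ∀ u → u < U → rb ℕ.+ u < n
  rightPos<n u u<U = ℕₚ.<-≤-trans (ℕₚ.+-monoʳ-< rb u<U) (ℕₚ.≤-reflexive rb+U)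

  leftPos<lo : ∀ u → u < U → lb ℕ.+ u < lo
  leftPos<lo u u<U = ℕₚ.<-≤-trans (ℕₚ.+-monoʳ-< lb u<U) (ℕₚ.≤-reflexive lb+U)

  lo≤rb : lo ≤ rb
  lo≤rb = ℕₚ.≤-trans (ℕₚ.m≤m+n lo U) (ℕₚ.≤-reflexive lo+U)

  rb≤n : rb ≤ n
  rb≤n = ℕₚ.m∸n≤m n U

  module _ (c : ℕ → Bool) where
    embedℕ : Bits U → ℕ → ℕ → Bool
    embedℕ a base p = if does (base ℕ.≤? p) then c (p ∸ base) ∧ at a (p ∸ base) else false

    embedℕ-in : ∀ a base u → embedℕ a base (base ℕ.+ u) ≡ c u ∧ at a u
    embedℕ-in a base u rewrite dec-true (base ℕ.≤? base ℕ.+ u) (ℕₚ.m≤m+n base u) | ℕₚ.m+n∸m≡n base u = refl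

    embedℕ-below : ∀ a base p → p < base → embedℕ a base p ≡ false
    embedℕ-below a base p q rewrite dec-false (base ℕ.≤? p) (ℕₚ.<⇒≱ q) = refl

    embedℕ-above : ∀ a base p → base ℕ.+ U ≤ p → embedℕ a base p ≡ false
    embedℕ-above a base p q
      rewrite dec-true (base ℕ.≤? p) (ℕₚ.≤-trans (ℕₚ.m≤m+n base U) q)
            | at-≥ a (p ∸ base) (ℕₚ.m+n≤o⇒m≤o∸n U (subst (_≤ p) (ℕₚ.+-comm base U) q)) = Boolₚ.∧-zeroʳ _

    shift : Bits U → Bits U → Bits n
    shift a b = embed rb c a ⊕ embed lb c b

    at-shift : ∀ a b p → p < n → at (shift a b) p ≡ embedℕ a rb p xor embedℕ b lb p
    at-shift a b p p<n = trans (at-⊕ (embed {n} rb c a) (embed lb c b) p)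
      (cong₂ _xor_ (at-tabulate (embedℕ a rb) p p<n) (at-tabulate (embedℕ b lb) p p<n))

    at-shift-right : ∀ a b u → u < U → at (shift a b) (rightPos n U u) ≡ c u ∧ at a u
    at-shift-right a b u q = trans (cong (at (shift a b)) (rightPos≡ u q))
      (trans (at-shift a b (rb ℕ.+ u) (rightPos<n u q))
        (trans (cong₂ _xor_ (embedℕ-in a rb u) (embedℕ-above b lb (rb ℕ.+ u)
            (ℕₚ.≤-trans (ℕₚ.≤-reflexive lb+U) (ℕₚ.≤-trans lo≤rb (ℕₚ.m≤m+n rb u)))))
          (Boolₚ.xor-identityʳ _)))

    at-shift-left : ∀ a b u → u < U → at (shift a b) (leftPos n U u) ≡ c u ∧ at b u
    at-shift-left a b u q = trans (cong (at (shift a b)) (leftPos≡ u q))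
      (trans (at-shift a b (lb ℕ.+ u) (ℕₚ.<-≤-trans p (ℕₚ.≤-trans lo≤rb rb≤n)))
        (cong₂ _xor_ (embedℕ-below a rb (lb ℕ.+ u) (ℕₚ.<-≤-trans p lo≤rb)) (embedℕ-in b lb u)))
      where p = leftPos<lo u q

    -- The input as one party sees it, without the other party's shift. It can be wrong only in the
    -- other party's block, where the first party's potential is 0.
    part : Bits n → Bool → Bits U → Bits n
    part x true a = x ⊕ embed rb c a
    part x false b = x ⊕ embed lb c b

  -- The number of head moves needed to leave the region that party p can simulate.
  pot : Bool → Fin n → ℕ
  pot true i = suc (toℕ i) ∸ lo
  pot false i = rb ∸ toℕ i

  pot-lipschitz : ∀ p i i′ → ∣ toℕ i - toℕ i′ ∣ ≤ 1 → pot p i ≤ suc (pot p i′)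
  pot-lipschitz p i i′ d = go p
    where
    open ℕₚ.≤-Reasoning
    i≤ : toℕ i ≤ suc (toℕ i′)
    i≤ = ℕₚ.≤-trans (ℕₚ.m≤n+∣m-n∣ (toℕ i) (toℕ i′)) (ℕₚ.≤-trans (ℕₚ.+-monoʳ-≤ (toℕ i′) d) (ℕₚ.≤-reflexive (ℕₚ.+-comm _ 1)))
    i′≤ : toℕ i′ ≤ suc (toℕ i)
    i′≤ = ℕₚ.≤-trans (ℕₚ.m≤n+∣n-m∣ (toℕ i′) (toℕ i)) (ℕₚ.≤-trans (ℕₚ.+-monoʳ-≤ (toℕ i) d) (ℕₚ.≤-reflexive (ℕₚ.+-comm _ 1)))
    suc-∸ : ∀ a b → suc a ∸ b ≤ suc (a ∸ b)
    suc-∸ a zero = ℕₚ.≤-refl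
    suc-∸ zero (suc b) = ℕₚ.≤-trans (ℕₚ.m∸n≤m 0 b) z≤n
    suc-∸ (suc a) (suc b) = suc-∸ a b
    ∸-suc : ∀ a b → a ∸ b ≤ suc (a ∸ suc b)
    ∸-suc zero b = ℕₚ.≤-trans (ℕₚ.m∸n≤m 0 b) z≤n
    ∸-suc (suc a) zero = ℕₚ.≤-refl
    ∸-suc (suc a) (suc b) = ∸-suc a b
    go : ∀ p → pot p i ≤ suc (pot p i′)
    go true = ℕₚ.≤-trans (ℕₚ.∸-monoˡ-≤ lo (s≤s i≤)) (suc-∸ (suc (toℕ i′)) lo)
    go false = ℕₚ.≤-trans (∸-suc rb (toℕ i)) (s≤s (ℕₚ.∸-monoʳ-≤ rb i′≤))

  pot-cross : ∀ p i → pot p i ≡ 0 → U ≤ pot (not p) i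
  pot-cross true i e = ℕₚ.m+n≤o⇒m≤o∸n U (begin
    U ℕ.+ toℕ i ≤⟨ ℕₚ.+-monoʳ-≤ U (ℕₚ.≤-trans (ℕₚ.n≤1+n _) (ℕₚ.m∸n≡0⇒m≤n e)) ⟩
    U ℕ.+ lo ≡⟨ trans (ℕₚ.+-comm U lo) lo+U ⟩
    rb ∎)
    where open ℕₚ.≤-Reasoning
  pot-cross false i e = ℕₚ.m+n≤o⇒m≤o∸n U (begin
    U ℕ.+ lo ≡⟨ trans (ℕₚ.+-comm U lo) lo+U ⟩
    rb ≤⟨ ℕₚ.m∸n≡0⇒m≤n e ⟩
    toℕ i ≤⟨ ℕₚ.n≤1+n _ ⟩
    suc (toℕ i) ∎)
    where open ℕₚ.≤-Reasoning

  part-agree : ∀ c x p a b i → pot p i ≢ 0 → (x ⊕ shift c a b) i ≡ part c x p (if p then a else b) i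
  part-agree c x true a b i ne = cong (x i xor_) (trans
    (cong (embed {n} rb c a i xor_) (embedℕ-above c b lb (toℕ i) (ℕₚ.≤-trans (ℕₚ.≤-reflexive lb+U) lo≤i)))
    (Boolₚ.xor-identityʳ _))
    where
    lo≤i : lo ≤ toℕ i
    lo≤i with lo ℕ.≤? toℕ i
    ... | yes q = q
    ... | no q = ⊥-elim (ne (ℕₚ.m≤n⇒m∸n≡0 (ℕₚ.≰⇒> q)))
  part-agree c x false a b i ne = cong (x i xor_)
    (cong (_xor embed {n} lb c b i) (embedℕ-below c a rb (toℕ i) i<))
    where
    i< : toℕ i < rb
    i< with toℕ i ℕ.<? rb
    ... | yes q = q
    ... | no q = ⊥-elim (ne (ℕₚ.m≤n⇒m∸n≡0 (ℕₚ.≮⇒≥ q)))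

  -- The middle of the gap is half a gap away from either block, so wherever the program starts, one
  -- of the parties has potential at least `g`.
  initial : ∀ g → g ℕ.+ g ≡ U → ∀ i → Σ Bool λ p → g ≤ pot p i
  initial g 2g i with lo ℕ.+ g ℕ.≤? toℕ i
  ... | yes q = true , ℕₚ.m+n≤o⇒m≤o∸n g (ℕₚ.≤-trans (ℕₚ.≤-reflexive (ℕₚ.+-comm g lo)) (ℕₚ.m≤n⇒m≤1+n q))
  ... | no q = false , ℕₚ.m+n≤o⇒m≤o∸n g (begin
      g ℕ.+ toℕ i ≤⟨ ℕₚ.+-monoʳ-≤ g (ℕₚ.<⇒≤ (ℕₚ.≰⇒> q)) ⟩
      g ℕ.+ (lo ℕ.+ g) ≡⟨ trans (ℕₚ.+-comm g _) (trans (ℕₚ.+-assoc lo g g) (cong (lo ℕ.+_) 2g)) ⟩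
      lo ℕ.+ U ≡⟨ lo+U ⟩
      rb ∎)
    where open ℕₚ.≤-Reasoning

  -- The shift is masked by segment `j`, and distinct segments are disjoint.
  extract-shift-other : ∀ x j j′ → j ≢ j′ → ∀ a b →
    extract U m (x ⊕ shift (inSeg U m j) a b) j′ ≡ extract U m x j′
  extract-shift-other x j j′ ne a b = xorSum-cong U λ u q → go u q (inSeg U m j′ u) refl
    where
    c = inSeg U m j
    go : ∀ u → u < U → ∀ d → inSeg U m j′ u ≡ d →
      summand U m (x ⊕ shift c a b) j′ u ≡ summand U m x j′ u
    go u q false e rewrite e = refl
    go u q true e = cong (inSeg U m j′ u ∧_) (cong₂ _∧_
      (trans (at-⊕ x (shift c a b) (rightPos n U u)) (trans (cong (at x (rightPos n U u) xor_)
        (trans (at-shift-right c a b u q) (cong (_∧ at a u) off))) (Boolₚ.xor-identityʳ (at x (rightPos n U u)))))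
      (trans (at-⊕ x (shift c a b) (leftPos n U u)) (trans (cong (at x (leftPos n U u) xor_)
        (trans (at-shift-left c a b u q) (cong (_∧ at b u) off))) (Boolₚ.xor-identityʳ (at x (leftPos n U u))))))
      where
      off : inSeg U m j u ≡ false
      off = Boolₚ.¬-not λ t → ne (inSeg-unique U m j j′ u t e)

  extract-shift-self : ∀ x j a b →
    extract U m (x ⊕ shift (inSeg U m j) a b) j ≡
      maskedIP {U} (inSeg U m j ∘ toℕ) (λ i → at x (rightPos n U (toℕ i))) (λ i → at x (leftPos n U (toℕ i))) a b
  extract-shift-self x j a b = xorSum≡maskedIP U _ _ _ _ a b λ i →
    let u = toℕ i ; q = Finₚ.toℕ<n i in
    masked (c u) {x = at x (rightPos n U u)} {y = at x (leftPos n U u)} {a = a i} {b = b i}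
      (trans (at-⊕ x (shift c a b) (rightPos n U u)) (cong (at x (rightPos n U u) xor_)
        (trans (at-shift-right c a b u q) (cong (c u ∧_) (at-toℕ a i)))))
      (trans (at-⊕ x (shift c a b) (leftPos n U u)) (cong (at x (leftPos n U u) xor_)
        (trans (at-shift-left c a b u q) (cong (c u ∧_) (at-toℕ b i)))))
    where
    c = inSeg U m j
    masked : ∀ d {p q x y a b} → p ≡ x xor (d ∧ a) → q ≡ y xor (d ∧ b) →
      d ∧ (p ∧ q) ≡ d ∧ ((x xor a) ∧ (y xor b))
    masked false e e′ = refl
    masked true e e′ = cong₂ _∧_ e e′

-- Correlation of one seed bit with a product of two runs

module BitReplacement {n m N : ℕ} (P : RBP n m N) (sr : IsSR P) (v₀ : Fin N)
  (U : ℕ) (3U≤n : 3 ℕ.* U ≤ n) (g : ℕ) (2g : g ℕ.+ g ≡ U)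
  (T : ℕ) (queries : QueriesAtMost P T) (r : ℕ) (T≤ : T ≤ g ℕ.+ r ℕ.* g) where

  open Geometry n U m 3U≤n
  open Walk P

  seed : Bits n → Bits m
  seed x j = extract U m x (toℕ j)

  F : Bits n → Bits m → ℤ
  F x y = sg (run P v₀ x y)

  -- The product of the two runs records whether the outputs on `y` and on the hybrid string agree;
  -- its correlation with seed bit `j` is what one hybrid step costs.
  test : Fin m → Bits m → Bits m → Bits n → ℤ
  test j y z x = sg (seed x j) ℤ.* (F x y ℤ.* F x (splice j z (seed x)))

  test-ext : ∀ j y z → Ext (test j y z)
  test-ext j y z e = cong₂ ℤ._*_ (cong sg (extract-cong U m e (toℕ j)))
    (cong₂ ℤ._*_ (cong sg (run-cong e (λ _ → refl) v₀))
      (cong sg (run-cong e (splice-cong j z λ i _ → extract-cong U m e (toℕ i)) v₀)))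

  open Protocol pot g pot-lipschitz
    -- A handover even grants `U`, but only the half `g` is claimed: the opening party is sure of no
    -- more, and one unit then serves both purposes.
    (λ p i e → ℕₚ.≤-trans (ℕₚ.≤-trans (ℕₚ.m≤m+n g g) (ℕₚ.≤-reflexive 2g)) (pot-cross p i e)) sr

  budget₀ : Budget v₀ T
  budget₀ rest path = queries (v₀ ∷ rest) path

  opening : Σ Bool λ p → ∀ {i j s} → P v₀ ≡ query i j s → T ≤ pot p i ℕ.+ r ℕ.* g
  opening with P v₀
  ... | terminal _ = true , λ ()
  ... | query i _ _ = proj₁ (initial g 2g i) ,
    λ { refl → ℕₚ.≤-trans T≤ (ℕₚ.+-monoˡ-≤ (r ℕ.* g) (proj₂ (initial g 2g i))) }

  module _ (j : Fin m) (y z : Bits m) (h : ℕ) (hh : h ℕ.+ h ≤ popcount U (inSeg U m (toℕ j) ∘ toℕ)) where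

    c : ℕ → Bool
    c = inSeg U m (toℕ j)

    area : ℕ
    area = 2 ℕ.^ U ℕ.* 2 ℕ.^ U

    module _ (x : Bits n) where
      xa xb : Bits U
      xa i = at x (rightPos n U (toℕ i))
      xb i = at x (leftPos n U (toℕ i))

      K : Bits U → Bits U → ℤ
      K a b = sg (maskedIP (c ∘ toℕ) xa xb a b)

      rectangle : ∀ X Y → Bounded X → Bounded Y →
        ∣ sumB U (λ a → sumB U (λ b → K a b ℤ.* (X a ℤ.* Y b))) ∣ ℕ.* 2 ℕ.^ h ≤ area
      rectangle X Y bX bY = lindsey U (c ∘ toℕ) xa xb X Y bX bY h hh

      open Discrepancy K (2 ℕ.^ h) area rectangle

      z′ : Bits m
      z′ = splice j z (seed x)

      agree : ∀ p a b i → pot p i ≢ 0 → (x ⊕ shift c a b) i ≡ part c x p (own p a b) i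
      agree true a b i = part-agree c x true a b i
      agree false a b i = part-agree c x false a b i

      module A₁ = Approximation K (2 ℕ.^ h) area rectangle (λ a b → x ⊕ shift c a b) (part c x) agree y
      module A₂ = Approximation K (2 ℕ.^ h) area rectangle (λ a b → x ⊕ shift c a b) (part c x) agree z′

      Q : Bits U → Bits U → ℤ
      Q a b = A₁.approx (proj₁ opening) r N v₀ a b ℤ.* (A₂.approx (proj₁ opening) r N v₀ a b ℤ.* 1ℤ)

      -- The shift changes no seed bit but `j`, and the splice does not read bit `j`, so the second
      -- string stays `z′` on the whole fibre. Both runs then have fixed random strings and
      -- `approx-correct` applies to each.
      test-shift : ∀ a b → test j y z (x ⊕ shift c a b) ≡ (K a b ℤ.* (1ℤ ℤ.* 1ℤ)) ℤ.* Q a b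
      test-shift a b = cong₂ ℤ._*_
        (trans (cong sg (extract-shift-self x (toℕ j) a b)) (sym (ℤₚ.*-identityʳ _)))
        (cong₂ ℤ._*_
          (trans (cong sg (run≡output v₀ (x ⊕ shift c a b) y))
            (A₁.approx-correct r (proj₁ opening) N v₀ T budget₀ (proj₂ opening) a b))
          (trans (cong sg (trans (run-cong (λ _ → refl) (splice-cong j z λ i i≢j →
                extract-shift-other x (toℕ j) (toℕ i) (λ e → i≢j (sym (Finₚ.toℕ-injective e))) a b) v₀)
                (run≡output v₀ (x ⊕ shift c a b) z′)))
            (trans (A₂.approx-correct r (proj₁ opening) N v₀ T budget₀ (proj₂ opening) a b)
              (sym (ℤₚ.*-identityʳ _)))))

      fibre-bound : ∣ sumB U (λ a → sumB U (λ b → test j y z (x ⊕ shift c a b))) ∣ ℕ.* 2 ℕ.^ h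
        ≤ leaves N r ℕ.* leaves N r ℕ.* area
      fibre-bound = begin
        ∣ sumB U (λ a → sumB U (λ b → test j y z (x ⊕ shift c a b))) ∣ ℕ.* 2 ℕ.^ h
          ≡⟨ cong (λ v → ∣ v ∣ ℕ.* 2 ℕ.^ h) (sumB-cong U λ a → sumB-cong U λ b → test-shift a b) ⟩
        ∣ corr (λ _ → 1ℤ) (λ _ → 1ℤ) Q ∣ ℕ.* 2 ℕ.^ h
          ≤⟨ A₁.Disc-approx {leaves N r ℕ.* 1} (A₂.Disc-approx {1} Disc-1 (proj₁ opening) r N v₀ ℕₚ.≤-refl)
               (proj₁ opening) r N v₀ ℕₚ.≤-refl (λ _ → 1ℤ) (λ _ → 1ℤ) (λ _ → ℕₚ.≤-refl) (λ _ → ℕₚ.≤-refl) ⟩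
        leaves N r ℕ.* (leaves N r ℕ.* 1) ℕ.* area
          ≡⟨ cong (ℕ._* area) (cong (leaves N r ℕ.*_) (ℕₚ.*-identityʳ (leaves N r))) ⟩
        leaves N r ℕ.* leaves N r ℕ.* area ∎
        where open ℕₚ.≤-Reasoning

    -- Every shift permutes the cube, so the full sum is the average of the sums over fibres.
    -- Multiplying by `area`, the number of pairs (a, b), replaces the division.
    bit-bound : ∣ sumB n (test j y z) ∣ ℕ.* 2 ℕ.^ h ≤ 2 ℕ.^ n ℕ.* (leaves N r ℕ.* leaves N r)
    bit-bound = ℕₚ.*-cancelˡ-≤ area {{area≢0}} (begin
      area ℕ.* (∣ sumB n G ∣ ℕ.* 2 ℕ.^ h)
        ≡⟨ ℕₚ.*-assoc area _ _ ⟨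
      area ℕ.* ∣ sumB n G ∣ ℕ.* 2 ℕ.^ h
        ≡⟨ cong (ℕ._* 2 ℕ.^ h) (ℤₚ.abs-* (+ area) (sumB n G)) ⟨
      ∣ + area ℤ.* sumB n G ∣ ℕ.* 2 ℕ.^ h
        ≡⟨ cong (λ v → ∣ v ∣ ℕ.* 2 ℕ.^ h) averaged ⟩
      ∣ sumB n fib ∣ ℕ.* 2 ℕ.^ h
        ≡⟨ trans (ℕₚ.*-comm ∣ sumB n fib ∣ _) (sym (ℤₚ.abs-* (+ (2 ℕ.^ h)) (sumB n fib))) ⟩
      ∣ + (2 ℕ.^ h) ℤ.* sumB n fib ∣
        ≡⟨ cong ∣_∣ (sumB-*ˡ n (+ (2 ℕ.^ h)) fib) ⟨
      ∣ sumB n (λ x → + (2 ℕ.^ h) ℤ.* fib x) ∣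
        ≤⟨ ∣sumB∣≤ n (λ x → ℕₚ.≤-trans (ℕₚ.≤-reflexive (trans (ℤₚ.abs-* (+ (2 ℕ.^ h)) (fib x)) (ℕₚ.*-comm (2 ℕ.^ h) _))) (fibre-bound x)) ⟩
      2 ℕ.^ n ℕ.* (leaves N r ℕ.* leaves N r ℕ.* area)
        ≡⟨ eq (2 ℕ.^ n) (leaves N r ℕ.* leaves N r) area ⟩
      area ℕ.* (2 ℕ.^ n ℕ.* (leaves N r ℕ.* leaves N r)) ∎)
      where
      open ℕₚ.≤-Reasoning
      G = test j y z
      fib : Bits n → ℤ
      fib x = sumB U (λ a → sumB U (λ b → G (x ⊕ shift c a b)))
      area≢0 : ℕ.NonZero area
      area≢0 = ℕₚ.m*n≢0 _ _ {{ℕₚ.m^n≢0 2 U}} {{ℕₚ.m^n≢0 2 U}}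
      eq : ∀ a b c → a ℕ.* (b ℕ.* c) ≡ c ℕ.* (a ℕ.* b)
      eq = ℕR.solve-∀
      averaged : + area ℤ.* sumB n G ≡ sumB n fib
      averaged = trans (cong (ℤ._* sumB n G) (ℤₚ.pos-* (2 ℕ.^ U) (2 ℕ.^ U)))
        (trans (ℤₚ.*-assoc (+ (2 ℕ.^ U)) (+ (2 ℕ.^ U)) (sumB n G))
        (trans (cong (λ v → + (2 ℕ.^ U) ℤ.* v) (sym (sumB-const U (sumB n G))))
        (trans (sym (sumB-const U (sumB U (λ _ → sumB n G))))
        (trans (sumB-cong U λ a → trans
                  (sumB-cong U λ b → sym (sumB-shift n G (test-ext j y z) (shift c a b)))
                  (sym (sumB-swap n U (λ x b → G (x ⊕ shift c a b)))))
          (sym (sumB-swap n U (λ x a → sumB U (λ b → G (x ⊕ shift c a b)))))))))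

-- Hybrid argument

≤ᵇ-suc : ∀ a b → (suc a ℕ.≤ᵇ suc b) ≡ (a ℕ.≤ᵇ b)
≤ᵇ-suc zero b = refl
≤ᵇ-suc (suc a) b = refl

splice-zero : ∀ {m} c (z : Bits m) (r : Bits (suc m)) i → splice zero (c ◂ z) r i ≡ (c ◂ (r ∘ suc)) i
splice-zero c z r zero = refl
splice-zero c z r (suc i) = refl

splice-suc : ∀ {m} (j : Fin m) c z (r : Bits (suc m)) i →
  splice (suc j) (c ◂ z) r i ≡ (c ◂ splice j z (r ∘ suc)) i
splice-suc j c z r zero = refl
splice-suc j c z r (suc i) = cong (if_then z i else r (suc i)) (≤ᵇ-suc (toℕ i) (toℕ j))

-- For a bit s, 2 g(s) = g(0) + g(1) + sg(s) (g(0) - g(1)). Making the first seed bit uniform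
-- therefore costs two sign correlations of size at most `B`; the other bits follow by induction
-- with the first bit fixed.
hybrid : ∀ m {n} (ρ : Bits n → Bits m) (G : Bits n → Bits m → ℤ) → (∀ x → Ext (G x)) → ∀ B →
  (∀ j z → ∣ sumB n (λ x → sg (ρ x j) ℤ.* G x (splice j z (ρ x))) ∣ ≤ B) →
  ∣ + (2 ℕ.^ m) ℤ.* sumB n (λ x → G x (ρ x)) ℤ.- sumB m (λ z → sumB n (λ x → G x z)) ∣ ≤ 2 ℕ.^ m ℕ.* (m ℕ.* B)
hybrid zero {n} ρ G ext B hyp = ℕₚ.≤-reflexive (cong ∣_∣ (trans
  (cong (λ v → 1ℤ ℤ.* v ℤ.- Z) (sumB-cong n λ x → ext x λ ())) (eq Z)))
  where
  Z = sumB n (λ x → G x (λ ()))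
  eq : ∀ a → 1ℤ ℤ.* a ℤ.- a ≡ 0ℤ
  eq = solve-∀
hybrid (suc m) {n} ρ G ext B hyp = begin
  ∣ + (2 ℕ.^ suc m) ℤ.* A₀ ℤ.- (Z false ℤ.+ Z true) ∣
    ≡⟨ cong ∣_∣ decompose ⟩
  ∣ M ℤ.* (D false ℤ.- D true) ℤ.+ (I false ℤ.+ I true) ∣
    ≤⟨ ℤₚ.∣i+j∣≤∣i∣+∣j∣ (M ℤ.* (D false ℤ.- D true)) _ ⟩
  ∣ M ℤ.* (D false ℤ.- D true) ∣ ℕ.+ ∣ I false ℤ.+ I true ∣
    ≤⟨ ℕₚ.+-mono-≤
         (ℕₚ.≤-trans (ℕₚ.≤-reflexive (ℤₚ.abs-* M (D false ℤ.- D true)))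
           (ℕₚ.*-monoʳ-≤ (2 ℕ.^ m) (ℕₚ.≤-trans (ℤₚ.∣i-j∣≤∣i∣+∣j∣ (D false) (D true)) (ℕₚ.+-mono-≤ (D≤ false) (D≤ true)))))
         (ℕₚ.≤-trans (ℤₚ.∣i+j∣≤∣i∣+∣j∣ (I false) (I true)) (ℕₚ.+-mono-≤ (I≤ false) (I≤ true))) ⟩
  2 ℕ.^ m ℕ.* (B ℕ.+ B) ℕ.+ (2 ℕ.^ m ℕ.* (m ℕ.* B) ℕ.+ 2 ℕ.^ m ℕ.* (m ℕ.* B))
    ≡⟨ eqB (2 ℕ.^ m) m B ⟩
  2 ℕ.^ suc m ℕ.* (suc m ℕ.* B) ∎
  where
  open ℕₚ.≤-Reasoning
  M = + (2 ℕ.^ m)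
  A₀ = sumB n (λ x → G x (ρ x))
  ρ′ : Bits n → Bits m
  ρ′ x = ρ x ∘ suc
  A Z D I : Bool → ℤ
  A c = sumB n (λ x → G x (c ◂ ρ′ x))
  Z c = sumB m (λ z → sumB n (λ x → G x (c ◂ z)))
  D c = sumB n (λ x → sg (ρ x zero) ℤ.* G x (c ◂ ρ′ x))
  I c = M ℤ.* A c ℤ.- Z c
  eqB : ∀ t m b → t ℕ.* (b ℕ.+ b) ℕ.+ (t ℕ.* (m ℕ.* b) ℕ.+ t ℕ.* (m ℕ.* b)) ≡ 2 ℕ.* t ℕ.* ((1 ℕ.+ m) ℕ.* b)
  eqB = ℕR.solve-∀
  D≤ : ∀ c → ∣ D c ∣ ≤ B
  D≤ c = subst (λ v → ∣ v ∣ ≤ B)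
    (sumB-cong n λ x → cong (sg (ρ x zero) ℤ.*_) (ext x (splice-zero c (λ _ → false) (ρ x))))
    -- `splice zero` keeps only the first bit of this string; the others are arbitrary.
    (hyp zero (c ◂ λ _ → false))
  I≤ : ∀ c → ∣ I c ∣ ≤ 2 ℕ.^ m ℕ.* (m ℕ.* B)
  I≤ c = hybrid m ρ′ (λ x z → G x (c ◂ z)) (λ x e → ext x λ { zero → refl ; (suc i) → e i }) B λ j z →
    subst (λ v → ∣ v ∣ ≤ B)
      (sumB-cong n λ x → cong (sg (ρ x (suc j)) ℤ.*_) (ext x (splice-suc j c z (ρ x))))
      (hyp (suc j) (c ◂ z))
  pointwise : ∀ x → G x (ρ x) ℤ.+ G x (ρ x) ≡
    (G x (false ◂ ρ′ x) ℤ.+ G x (true ◂ ρ′ x)) ℤ.+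
    (sg (ρ x zero) ℤ.* G x (false ◂ ρ′ x) ℤ.+ -1ℤ ℤ.* (sg (ρ x zero) ℤ.* G x (true ◂ ρ′ x)))
  pointwise x = trans (cong (λ v → v ℤ.+ v) (ext x {y = ρ x zero ◂ ρ′ x} λ { zero → refl ; (suc i) → refl }))
    (go (ρ x zero))
    where
    g = λ c → G x (c ◂ ρ′ x)
    eq₀ : ∀ a b → a ℤ.+ a ≡ (a ℤ.+ b) ℤ.+ (1ℤ ℤ.* a ℤ.+ -1ℤ ℤ.* (1ℤ ℤ.* b))
    eq₀ = solve-∀
    eq₁ : ∀ a b → b ℤ.+ b ≡ (a ℤ.+ b) ℤ.+ (-1ℤ ℤ.* a ℤ.+ -1ℤ ℤ.* (-1ℤ ℤ.* b))
    eq₁ = solve-∀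
    go : ∀ s → g s ℤ.+ g s ≡ (g false ℤ.+ g true) ℤ.+ (sg s ℤ.* g false ℤ.+ -1ℤ ℤ.* (sg s ℤ.* g true))
    go false = eq₀ (g false) (g true)
    go true = eq₁ (g false) (g true)
  doubled : A₀ ℤ.+ A₀ ≡ (A false ℤ.+ A true) ℤ.+ (D false ℤ.+ -1ℤ ℤ.* D true)
  doubled = trans (sym (sumB-+ n _ _)) (trans (sumB-cong n pointwise)
    (trans (sumB-+ n (λ x → G x (false ◂ ρ′ x) ℤ.+ G x (true ◂ ρ′ x)) _)
      (cong₂ ℤ._+_ (sumB-+ n (λ x → G x (false ◂ ρ′ x)) _)
        (trans (sumB-+ n (λ x → sg (ρ x zero) ℤ.* G x (false ◂ ρ′ x)) _)
          (cong (λ v → D false ℤ.+ v) (sumB-*ˡ n -1ℤ (λ x → sg (ρ x zero) ℤ.* G x (true ◂ ρ′ x))))))))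
  decompose : + (2 ℕ.^ suc m) ℤ.* A₀ ℤ.- (Z false ℤ.+ Z true) ≡
    M ℤ.* (D false ℤ.- D true) ℤ.+ (I false ℤ.+ I true)
  decompose = trans (cong (λ v → v ℤ.* A₀ ℤ.- (Z false ℤ.+ Z true)) (sym (2^suc m)))
    (trans (eq₁ M A₀ (Z false) (Z true))
      (trans (cong (λ v → M ℤ.* v ℤ.- (Z false ℤ.+ Z true)) doubled)
        (eq₂ M (A false) (A true) (D false) (D true) (Z false) (Z true))))
    where
    eq₁ : ∀ m a y z → (m ℤ.+ m) ℤ.* a ℤ.- (y ℤ.+ z) ≡ m ℤ.* (a ℤ.+ a) ℤ.- (y ℤ.+ z)
    eq₁ = solve-∀
    eq₂ : ∀ m a b d e y z → m ℤ.* ((a ℤ.+ b) ℤ.+ (d ℤ.+ -1ℤ ℤ.* e)) ℤ.- (y ℤ.+ z) ≡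
      m ℤ.* (d ℤ.- e) ℤ.+ ((m ℤ.* a ℤ.- y) ℤ.+ (m ℤ.* b ℤ.- z))
    eq₂ = solve-∀

-- From sign correlations to error counts

sumL : ∀ {A : Set} → List A → (A → ℤ) → ℤ
sumL [] g = 0ℤ
sumL (x ∷ xs) g = g x ℤ.+ sumL xs g

sumL-mono : ∀ {A : Set} (xs : List A) {g h : A → ℤ} → (∀ x → g x ℤ.≤ h x) → sumL xs g ℤ.≤ sumL xs h
sumL-mono [] e = ℤₚ.≤-refl
sumL-mono (x ∷ xs) e = ℤₚ.+-mono-≤ (e x) (sumL-mono xs e)

sumL-cong : ∀ {A : Set} (xs : List A) {g h : A → ℤ} → (∀ x → g x ≡ h x) → sumL xs g ≡ sumL xs h
sumL-cong [] e = refl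
sumL-cong (x ∷ xs) e = cong₂ ℤ._+_ (e x) (sumL-cong xs e)

sumL-+ : ∀ {A : Set} (xs : List A) (g h : A → ℤ) → sumL xs (λ x → g x ℤ.+ h x) ≡ sumL xs g ℤ.+ sumL xs h
sumL-+ [] g h = refl
sumL-+ (x ∷ xs) g h = trans (cong (λ v → (g x ℤ.+ h x) ℤ.+ v) (sumL-+ xs g h)) (eq (g x) (h x) (sumL xs g) (sumL xs h))
  where
  eq : ∀ a b c d → (a ℤ.+ b) ℤ.+ (c ℤ.+ d) ≡ (a ℤ.+ c) ℤ.+ (b ℤ.+ d)
  eq = solve-∀

sumL-*ˡ : ∀ {A : Set} (xs : List A) c (g : A → ℤ) → sumL xs (λ x → c ℤ.* g x) ≡ c ℤ.* sumL xs g
sumL-*ˡ [] c g = sym (ℤₚ.*-zeroʳ c)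
sumL-*ˡ (x ∷ xs) c g = trans (cong (λ v → c ℤ.* g x ℤ.+ v) (sumL-*ˡ xs c g)) (sym (ℤₚ.*-distribˡ-+ c (g x) _))

sumL-++ : ∀ {A : Set} (xs ys : List A) (g : A → ℤ) → sumL (xs ++ ys) g ≡ sumL xs g ℤ.+ sumL ys g
sumL-++ [] ys g = sym (ℤₚ.+-identityˡ _)
sumL-++ (x ∷ xs) ys g = trans (cong (λ v → g x ℤ.+ v) (sumL-++ xs ys g)) (sym (ℤₚ.+-assoc (g x) _ _))

sumL-map : ∀ {A B : Set} (f : A → B) (xs : List A) (g : B → ℤ) → sumL (map f xs) g ≡ sumL xs (g ∘ f)
sumL-map f [] g = refl
sumL-map f (x ∷ xs) g = cong (λ v → g (f x) ℤ.+ v) (sumL-map f xs g)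

sumL-allBits : ∀ k (g : Bits k → ℤ) → Ext g → sumL (allBits k) g ≡ sumB k g
sumL-allBits zero g eg = trans (ℤₚ.+-identityʳ _) (eg λ ())
sumL-allBits (suc k) g eg = trans (sumL-++ (map _ (allBits k)) _ g) (cong₂ ℤ._+_ (half false _ λ b → λ { zero → refl ; (suc i) → refl })
    (half true _ λ b → λ { zero → refl ; (suc i) → refl }))
  where
  half : ∀ c (cons : Bits k → Bits (suc k)) → (∀ b i → cons b i ≡ (c ◂ b) i) →
    sumL (map cons (allBits k)) g ≡ sumB k (λ b → g (c ◂ b))
  half c cons e = trans (sumL-map cons (allBits k) g)
    (trans (sumL-cong (allBits k) λ b → eg (e b))
      (sumL-allBits k (λ b → g (c ◂ b)) λ p → eg λ { zero → refl ; (suc i) → p i }))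

⟦_⟧ : Bool → ℤ
⟦ true ⟧ = 1ℤ
⟦ false ⟧ = 0ℤ

length-filter : ∀ {A : Set} (xs : List A) (Q : A → Bool) →
  + length (filter (λ b → Data.Bool._≟_ (Q b) true) xs) ≡ sumL xs (⟦_⟧ ∘ Q)
length-filter [] Q = refl
length-filter (x ∷ xs) Q with Q x
... | true = cong (λ v → 1ℤ ℤ.+ v) (length-filter xs Q)
... | false = trans (length-filter xs Q) (sym (ℤₚ.+-identityˡ _))

count≡sumL : ∀ k Q → + count k Q ≡ sumL (allBits k) (⟦_⟧ ∘ Q)
count≡sumL k Q = length-filter (allBits k) Q

0≤⟦⟧ : ∀ b → 0ℤ ℤ.≤ ⟦ b ⟧
0≤⟦⟧ true = ℤ.+≤+ z≤n
0≤⟦⟧ false = ℤ.+≤+ z≤n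

⟦⟧≤1 : ∀ b → ⟦ b ⟧ ℤ.≤ 1ℤ
⟦⟧≤1 true = ℤ.+≤+ (s≤s z≤n)
⟦⟧≤1 false = ℤ.+≤+ z≤n

sg-bitEq : ∀ a b → sg a ℤ.* sg b ≡ 1ℤ ℤ.- (⟦ not (bitEq a b) ⟧ ℤ.+ ⟦ not (bitEq a b) ⟧)
sg-bitEq true true = refl
sg-bitEq true false = refl
sg-bitEq false true = refl
sg-bitEq false false = refl

⟦not⟧ : ∀ b → ⟦ b ⟧ ℤ.+ ⟦ not b ⟧ ≡ 1ℤ
⟦not⟧ true = refl
⟦not⟧ false = refl

sg² : ∀ b → sg b ℤ.* sg b ≡ 1ℤ
sg² true = refl
sg² false = refl

term≤sumB : ∀ k (g : Bits k → ℤ) → Ext g → (∀ b → 0ℤ ℤ.≤ g b) → ∀ b → g b ℤ.≤ sumB k g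
term≤sumB zero g eg g≥0 b = ℤₚ.≤-reflexive (eg λ ())
term≤sumB (suc k) g eg g≥0 b = go (b zero) refl
  where
  half : Bool → ℤ
  half c = sumB k (λ b → g (c ◂ b))
  half≥0 : ∀ c → 0ℤ ℤ.≤ half c
  half≥0 c = subst (ℤ._≤ half c) (sumB-0 k) (sumB-mono k λ b → g≥0 (c ◂ b))
  within : ∀ c → b zero ≡ c → g b ℤ.≤ half c
  within c e = subst (ℤ._≤ half c) (eg λ { zero → sym e ; (suc i) → refl })
    (term≤sumB k (λ b → g (c ◂ b)) (λ p → eg λ { zero → refl ; (suc i) → p i }) (λ b → g≥0 (c ◂ b)) (b ∘ suc))
  go : ∀ c → b zero ≡ c → g b ℤ.≤ half false ℤ.+ half true
  go false e = subst (ℤ._≤ half false ℤ.+ half true) (ℤₚ.+-identityʳ _) (ℤₚ.+-mono-≤ (within false e) (half≥0 true))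
  go true e = subst (ℤ._≤ half false ℤ.+ half true) (ℤₚ.+-identityˡ _) (ℤₚ.+-mono-≤ (half≥0 false) (within true e))

-- f need not respect pointwise equality of inputs, so sums involving f stay over the
-- list allBits n and only f-free sums are converted to sumB.
module Errors {n m : ℕ} (out : Bits n → Bits m → Bool) (f : Bits n → Bool)
  (out-ext : ∀ {x x′ y y′} → (∀ i → x i ≡ x′ i) → (∀ j → y j ≡ y′ j) → out x y ≡ out x′ y′) where

  M : ℤ
  M = + (2 ℕ.^ m)

  wrong : Bits n → Bits m → ℤ
  wrong x y = ⟦ not (bitEq (out x y) (f x)) ⟧

  bad : Bits n → ℤ
  bad x = sumB m (wrong x)

  wrong-ext : ∀ x → Ext (wrong x)
  wrong-ext x e = cong (λ o → ⟦ not (bitEq o (f x)) ⟧) (out-ext (λ _ → refl) e)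

  count+bad : ∀ x → + count m (λ y → bitEq (out x y) (f x)) ℤ.+ bad x ≡ M
  count+bad x = trans (cong (ℤ._+ bad x) (trans (count≡sumL m _)
      (sumL-allBits m _ λ e → cong (λ o → ⟦ bitEq o (f x) ⟧) (out-ext (λ _ → refl) e))))
    (trans (sym (sumB-+ m _ (wrong x))) (trans (sumB-cong m λ y → ⟦not⟧ (bitEq (out x y) (f x)))
      (trans (sumB-const m 1ℤ) (ℤₚ.*-identityʳ M))))

  wrong≤bad : ∀ x y → wrong x y ℤ.≤ bad x
  wrong≤bad x y = term≤sumB m (wrong x) (wrong-ext x) (λ _ → 0≤⟦⟧ _) y

  0≤bad : ∀ x → 0ℤ ℤ.≤ bad x
  0≤bad x = subst (ℤ._≤ bad x) (sumB-0 m) (sumB-mono m λ y → 0≤⟦⟧ _)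

  totalBad : ℤ
  totalBad = sumL (allBits n) bad

  module _ (ρ : Bits n → Bits m) where

    errors : ℤ
    errors = sumL (allBits n) (λ x → wrong x (ρ x))

    F : Bits n → Bits m → ℤ
    F x y = sg (out x y)

    σ : Bits n → ℤ
    σ x = sumB m (F x)

    sg-σ : ∀ x → sg (f x) ℤ.* σ x ≡ M ℤ.- (bad x ℤ.+ bad x)
    sg-σ x = trans (sym (sumB-*ˡ m (sg (f x)) (F x)))
      (trans (sumB-cong m λ y → trans (ℤₚ.*-comm (sg (f x)) (F x y)) (trans (sg-bitEq (out x y) (f x)) (flip (wrong x y))))
      (trans (sumB-+ m (λ _ → 1ℤ) (λ y → -1ℤ ℤ.* (wrong x y ℤ.+ wrong x y)))
        (trans (cong₂ ℤ._+_ (trans (sumB-const m 1ℤ) (ℤₚ.*-identityʳ M))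
            (trans (sumB-*ˡ m -1ℤ (λ y → wrong x y ℤ.+ wrong x y)) (cong (-1ℤ ℤ.*_) (sumB-+ m (wrong x) (wrong x)))))
          (unflip M (bad x)))))
      where
      flip : ∀ w → 1ℤ ℤ.- (w ℤ.+ w) ≡ 1ℤ ℤ.+ -1ℤ ℤ.* (w ℤ.+ w)
      flip = solve-∀
      unflip : ∀ m w → m ℤ.+ -1ℤ ℤ.* (w ℤ.+ w) ≡ m ℤ.- (w ℤ.+ w)
      unflip = solve-∀

    σ² : ∀ x → σ x ℤ.* σ x ≡ (M ℤ.- (bad x ℤ.+ bad x)) ℤ.* (M ℤ.- (bad x ℤ.+ bad x))
    σ² x = trans (trans (sym (ℤₚ.*-identityˡ _)) (trans (cong (ℤ._* (σ x ℤ.* σ x)) (sym (sg² (f x)))) (eq (sg (f x)) (σ x))))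
      (cong (λ v → v ℤ.* v) (sg-σ x))
      where
      eq : ∀ s t → (s ℤ.* s) ℤ.* (t ℤ.* t) ≡ (s ℤ.* t) ℤ.* (s ℤ.* t)
      eq = solve-∀

    Fσ : ∀ x → F x (ρ x) ℤ.* σ x ≡
      (1ℤ ℤ.- (wrong x (ρ x) ℤ.+ wrong x (ρ x))) ℤ.* (M ℤ.- (bad x ℤ.+ bad x))
    Fσ x = trans (trans (sym (ℤₚ.*-identityˡ _)) (trans (cong (ℤ._* (F x (ρ x) ℤ.* σ x)) (sym (sg² (f x)))) (eq (sg (f x)) (F x (ρ x)) (σ x))))
      (cong₂ ℤ._*_ (sg-bitEq (out x (ρ x)) (f x)) (sg-σ x))
      where
      eq : ∀ s u t → (s ℤ.* s) ℤ.* (u ℤ.* t) ≡ (u ℤ.* s) ℤ.* (s ℤ.* t)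
      eq = solve-∀

    -- If the seed errs, its run disagrees with the run on every `y` that does not err. Since `M`
    -- minus `F x (ρ x) ℤ.* σ x` is twice the number of disagreeing `y`, the estimate follows after
    -- doubling.
    wrong-bound : ∀ x → + 2 ℤ.* (M ℤ.* wrong x (ρ x)) ℤ.≤
      (M ℤ.+ + 2 ℤ.* bad x) ℤ.+ -1ℤ ℤ.* (F x (ρ x) ℤ.* σ x)
    wrong-bound x = subst (λ v → + 2 ℤ.* (M ℤ.* wrong x (ρ x)) ℤ.≤ (M ℤ.+ + 2 ℤ.* bad x) ℤ.+ -1ℤ ℤ.* v) (sym (Fσ x))
      (go (not (bitEq (out x (ρ x)) (f x))) M (bad x) (0≤bad x))
      where
      go : ∀ c M β → 0ℤ ℤ.≤ β → + 2 ℤ.* (M ℤ.* ⟦ c ⟧) ℤ.≤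
        (M ℤ.+ + 2 ℤ.* β) ℤ.+ -1ℤ ℤ.* ((1ℤ ℤ.- (⟦ c ⟧ ℤ.+ ⟦ c ⟧)) ℤ.* (M ℤ.- (β ℤ.+ β)))
      go true M β _ = ℤₚ.≤-reflexive (eq M β)
        where
        eq : ∀ M β → + 2 ℤ.* (M ℤ.* 1ℤ) ≡
          (M ℤ.+ + 2 ℤ.* β) ℤ.+ -1ℤ ℤ.* ((1ℤ ℤ.- (1ℤ ℤ.+ 1ℤ)) ℤ.* (M ℤ.- (β ℤ.+ β)))
        eq = solve-∀
      go false M β β≥0 = ℤₚ.0≤i-j⇒j≤i (subst (0ℤ ℤ.≤_) (eq M β) (ℤₚ.*-monoˡ-≤-nonNeg (+ 4) β≥0))
        where
        eq : ∀ M β → + 4 ℤ.* β ≡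
          ((M ℤ.+ + 2 ℤ.* β) ℤ.+ -1ℤ ℤ.* ((1ℤ ℤ.- (0ℤ ℤ.+ 0ℤ)) ℤ.* (M ℤ.- (β ℤ.+ β)))) ℤ.- + 2 ℤ.* (M ℤ.* 0ℤ)
        eq = solve-∀

    -- Two random strings can give different outputs only if one of them errs. `σ x` squared is the
    -- sum of the sign products over all pairs, and dropping the square of 2 `bad x` leaves the
    -- union bound.
    σ²-bound : ∀ x → M ℤ.* M ℤ.+ -1ℤ ℤ.* (+ 4 ℤ.* M ℤ.* bad x) ℤ.≤ σ x ℤ.* σ x
    σ²-bound x = subst (M ℤ.* M ℤ.+ -1ℤ ℤ.* (+ 4 ℤ.* M ℤ.* bad x) ℤ.≤_) (sym (σ² x))
      (ℤₚ.0≤i-j⇒j≤i (subst (0ℤ ℤ.≤_) (eq M (bad x)) (0≤i² (bad x ℤ.+ bad x))))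
      where
      eq : ∀ M β → (β ℤ.+ β) ℤ.* (β ℤ.+ β) ≡
        (M ℤ.- (β ℤ.+ β)) ℤ.* (M ℤ.- (β ℤ.+ β)) ℤ.- (M ℤ.* M ℤ.+ -1ℤ ℤ.* (+ 4 ℤ.* M ℤ.* β))
      eq = solve-∀

    module _ (ρ-ext : ∀ {x x′} → (∀ i → x i ≡ x′ i) → ∀ j → ρ x j ≡ ρ x′ j) (t B : ℕ)
      (bit : ∀ j y z → ∣ sumB n (λ x → sg (ρ x j) ℤ.* (F x y ℤ.* F x (splice j z (ρ x)))) ∣ ℕ.* t ≤ B) where

      Vol Cr Sq : ℤ
      Vol = + (2 ℕ.^ n)
      Cr = sumB n (λ x → F x (ρ x) ℤ.* σ x)
      Sq = sumB n (λ x → σ x ℤ.* σ x)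

      -- The hybrid bound for one fixed `y`. The function is scaled by `t` because only `t` times a
      -- correlation is known to be at most `B`.
      agreement : ∀ y → + t ℤ.* sumB m (λ z → sumB n (λ x → F x y ℤ.* F x z))
        ℤ.≤ + (2 ℕ.^ m ℕ.* (m ℕ.* B)) ℤ.+ + t ℤ.* (M ℤ.* sumB n (λ x → F x y ℤ.* F x (ρ x)))
      agreement y = lower (+ t ℤ.* (M ℤ.* sumB n (λ x → F x y ℤ.* F x (ρ x))))
          (+ t ℤ.* sumB m (λ z → sumB n (λ x → F x y ℤ.* F x z)))
          (subst (λ v → ∣ v ∣ ≤ 2 ℕ.^ m ℕ.* (m ℕ.* B)) scale
            (hybrid m ρ (λ x z → + t ℤ.* (F x y ℤ.* F x z))
              (λ x e → cong (λ o → + t ℤ.* (F x y ℤ.* sg o)) (out-ext (λ _ → refl) e)) B λ j z →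
              ℕₚ.≤-trans (ℕₚ.≤-reflexive (trans (cong ∣_∣ (pull j z)) (trans (ℤₚ.abs-* (+ t) _) (ℕₚ.*-comm t _)))) (bit j y z)))
        where
        lower : ∀ {c} i j → ∣ i ℤ.- j ∣ ≤ c → j ℤ.≤ + c ℤ.+ i
        lower {c} i j p = subst (ℤ._≤ + c ℤ.+ i) (eq i j)
          (ℤₚ.+-monoˡ-≤ i (ℤₚ.≤-trans (i≤∣i∣ (j ℤ.- i)) (ℤ.+≤+ (subst (_≤ c) (ℤₚ.∣i-j∣≡∣j-i∣ i j) p))))
          where
          i≤∣i∣ : ∀ i → i ℤ.≤ + ∣ i ∣
          i≤∣i∣ (+ n) = ℤₚ.≤-refl
          i≤∣i∣ -[1+ n ] = ℤ.-≤+
          eq : ∀ i j → (j ℤ.- i) ℤ.+ i ≡ j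
          eq = solve-∀
        rot : ∀ s t p → s ℤ.* (t ℤ.* p) ≡ t ℤ.* (s ℤ.* p)
        rot = solve-∀
        pull : ∀ j z → sumB n (λ x → sg (ρ x j) ℤ.* (+ t ℤ.* (F x y ℤ.* F x (splice j z (ρ x)))))
          ≡ + t ℤ.* sumB n (λ x → sg (ρ x j) ℤ.* (F x y ℤ.* F x (splice j z (ρ x))))
        pull j z = trans (sumB-cong n λ x → rot (sg (ρ x j)) (+ t) (F x y ℤ.* F x (splice j z (ρ x))))
          (sumB-*ˡ n (+ t) (λ x → sg (ρ x j) ℤ.* (F x y ℤ.* F x (splice j z (ρ x)))))
        scale : M ℤ.* sumB n (λ x → + t ℤ.* (F x y ℤ.* F x (ρ x))) ℤ.-
            sumB m (λ z → sumB n (λ x → + t ℤ.* (F x y ℤ.* F x z)))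
          ≡ + t ℤ.* (M ℤ.* sumB n (λ x → F x y ℤ.* F x (ρ x))) ℤ.-
            + t ℤ.* sumB m (λ z → sumB n (λ x → F x y ℤ.* F x z))
        scale = cong₂ ℤ._-_
          (trans (cong (M ℤ.*_) (sumB-*ˡ n (+ t) (λ x → F x y ℤ.* F x (ρ x)))) (rot M (+ t) _))
          (trans (sumB-cong m λ z → sumB-*ˡ n (+ t) (λ x → F x y ℤ.* F x z))
            (sumB-*ˡ m (+ t) (λ z → sumB n (λ x → F x y ℤ.* F x z))))

      Sq≡ : sumB m (λ y → sumB m (λ z → sumB n (λ x → F x y ℤ.* F x z))) ≡ Sq
      Sq≡ = trans (sumB-cong m λ y → sumB-swap m n (λ z x → F x y ℤ.* F x z))
        (trans (sumB-swap m n (λ y x → sumB m (λ z → F x y ℤ.* F x z)))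
          (sumB-cong n λ x → trans (sumB-cong m λ y → trans (sumB-*ˡ m (F x y) (F x)) (ℤₚ.*-comm (F x y) (σ x)))
            (sumB-*ˡ m (σ x) (F x))))

      Cr≡ : sumB m (λ y → sumB n (λ x → F x y ℤ.* F x (ρ x))) ≡ Cr
      Cr≡ = trans (sumB-swap m n (λ y x → F x y ℤ.* F x (ρ x)))
        (sumB-cong n λ x → trans (sumB-cong m λ y → ℤₚ.*-comm (F x y) (F x (ρ x))) (sumB-*ˡ m (F x (ρ x)) (F x)))

      total-agreement : + t ℤ.* Sq ℤ.≤ M ℤ.* (M ℤ.* (+ m ℤ.* + B)) ℤ.+ + t ℤ.* (M ℤ.* Cr)
      total-agreement = subst₂ ℤ._≤_
        (trans (sumB-*ˡ m (+ t) _) (cong (+ t ℤ.*_) Sq≡))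
        (trans (sumB-+ m (λ _ → + (2 ℕ.^ m ℕ.* (m ℕ.* B))) (λ y → + t ℤ.* (M ℤ.* sumB n (λ x → F x y ℤ.* F x (ρ x)))))
          (cong₂ ℤ._+_
            (trans (sumB-const m _) (cong (M ℤ.*_) (trans (ℤₚ.pos-* (2 ℕ.^ m) (m ℕ.* B)) (cong (M ℤ.*_) (ℤₚ.pos-* m B)))))
            (trans (sumB-*ˡ m (+ t) (λ y → M ℤ.* sumB n (λ x → F x y ℤ.* F x (ρ x))))
              (cong (+ t ℤ.*_) (trans (sumB-*ˡ m M (λ y → sumB n (λ x → F x y ℤ.* F x (ρ x)))) (cong (M ℤ.*_) Cr≡))))))
        (sumB-mono m agreement)

      F-ext : ∀ {x x′} → (∀ i → x i ≡ x′ i) → F x (ρ x) ≡ F x′ (ρ x′)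
      F-ext e = cong sg (out-ext e (ρ-ext e))

      σ-ext : ∀ {x x′} → (∀ i → x i ≡ x′ i) → σ x ≡ σ x′
      σ-ext e = sumB-cong m λ y → cong sg (out-ext e λ _ → refl)

      sumL-const : ∀ c → sumL (allBits n) (λ _ → c) ≡ Vol ℤ.* c
      sumL-const c = trans (sumL-allBits n (λ _ → c) (λ _ → refl)) (sumB-const n c)

      sum-wrong : + 2 ℤ.* (M ℤ.* errors) ℤ.≤ (Vol ℤ.* M ℤ.+ + 2 ℤ.* totalBad) ℤ.+ -1ℤ ℤ.* Cr
      sum-wrong = subst₂ ℤ._≤_
        (trans (sumL-*ˡ (allBits n) (+ 2) (λ x → M ℤ.* wrong x (ρ x))) (cong (+ 2 ℤ.*_) (sumL-*ˡ (allBits n) M (λ x → wrong x (ρ x)))))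
        (trans (sumL-+ (allBits n) (λ x → M ℤ.+ + 2 ℤ.* bad x) (λ x → -1ℤ ℤ.* (F x (ρ x) ℤ.* σ x)))
          (cong₂ ℤ._+_
            (trans (sumL-+ (allBits n) (λ _ → M) (λ x → + 2 ℤ.* bad x))
              (cong₂ ℤ._+_ (sumL-const M) (sumL-*ˡ (allBits n) (+ 2) bad)))
            (trans (sumL-*ˡ (allBits n) -1ℤ (λ x → F x (ρ x) ℤ.* σ x))
              (cong (-1ℤ ℤ.*_) (sumL-allBits n (λ x → F x (ρ x) ℤ.* σ x) λ e → cong₂ ℤ._*_ (F-ext e) (σ-ext e))))))
        (sumL-mono (allBits n) wrong-bound)

      sum-σ² : Vol ℤ.* (M ℤ.* M) ℤ.+ -1ℤ ℤ.* (+ 4 ℤ.* M ℤ.* totalBad) ℤ.≤ Sq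
      sum-σ² = subst₂ ℤ._≤_
        (trans (sumL-+ (allBits n) (λ _ → M ℤ.* M) (λ x → -1ℤ ℤ.* (+ 4 ℤ.* M ℤ.* bad x)))
          (cong₂ ℤ._+_ (sumL-const (M ℤ.* M))
            (trans (sumL-*ˡ (allBits n) -1ℤ (λ x → + 4 ℤ.* M ℤ.* bad x)) (cong (-1ℤ ℤ.*_) (sumL-*ˡ (allBits n) (+ 4 ℤ.* M) bad)))))
        (sumL-allBits n (λ x → σ x ℤ.* σ x) λ e → cong₂ ℤ._*_ (σ-ext e) (σ-ext e))
        (sumL-mono (allBits n) σ²-bound)

      -- `wrong-bound` contributes 2 `totalBad` and `σ²-bound` contributes 4; half of the resulting
      -- 6 is the origin of 3δ. Both sides are multiplied by `M` because the hybrid bound controls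
      -- `M ℤ.* Cr`.
      error-bound : + t ℤ.* (+ 2 ℤ.* (M ℤ.* errors)) ℤ.≤ + t ℤ.* (+ 6 ℤ.* totalBad) ℤ.+ M ℤ.* (+ m ℤ.* + B)
      error-bound = ℤₚ.*-cancelˡ-≤-pos _ _ M {{ℤ.positive (ℤ.+<+ (ℕₚ.m^n>0 2 m))}} (begin
        M ℤ.* (+ t ℤ.* (+ 2 ℤ.* (M ℤ.* errors)))
          ≡⟨ eq₀ M (+ t) (+ 2 ℤ.* (M ℤ.* errors)) ⟩
        + t ℤ.* (M ℤ.* (+ 2 ℤ.* (M ℤ.* errors)))
          ≤⟨ ℤₚ.*-monoˡ-≤-nonNeg (+ t) (ℤₚ.*-monoˡ-≤-nonNeg M sum-wrong) ⟩
        + t ℤ.* (M ℤ.* ((Vol ℤ.* M ℤ.+ + 2 ℤ.* totalBad) ℤ.+ -1ℤ ℤ.* Cr))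
          ≡⟨ eq₁ (+ t) M Vol totalBad Cr ⟩
        (+ t ℤ.* (Vol ℤ.* (M ℤ.* M) ℤ.+ -1ℤ ℤ.* (+ 4 ℤ.* M ℤ.* totalBad)) ℤ.+ M ℤ.* (+ t ℤ.* (+ 6 ℤ.* totalBad))) ℤ.+ -1ℤ ℤ.* (+ t ℤ.* (M ℤ.* Cr))
          ≤⟨ ℤₚ.+-monoˡ-≤ (-1ℤ ℤ.* (+ t ℤ.* (M ℤ.* Cr))) (ℤₚ.+-monoˡ-≤ (M ℤ.* (+ t ℤ.* (+ 6 ℤ.* totalBad)))
               (ℤₚ.≤-trans (ℤₚ.*-monoˡ-≤-nonNeg (+ t) sum-σ²) total-agreement)) ⟩
        ((M ℤ.* (M ℤ.* (+ m ℤ.* + B)) ℤ.+ + t ℤ.* (M ℤ.* Cr)) ℤ.+ M ℤ.* (+ t ℤ.* (+ 6 ℤ.* totalBad))) ℤ.+ -1ℤ ℤ.* (+ t ℤ.* (M ℤ.* Cr))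
          ≡⟨ eq₂ M (+ m ℤ.* + B) (+ t ℤ.* (M ℤ.* Cr)) (+ t ℤ.* (+ 6 ℤ.* totalBad)) ⟩
        M ℤ.* (+ t ℤ.* (+ 6 ℤ.* totalBad) ℤ.+ M ℤ.* (+ m ℤ.* + B)) ∎)
        where
        open ℤₚ.≤-Reasoning
        eq₀ : ∀ a b c → a ℤ.* (b ℤ.* c) ≡ b ℤ.* (a ℤ.* c)
        eq₀ = solve-∀
        eq₁ : ∀ t M V b C → t ℤ.* (M ℤ.* ((V ℤ.* M ℤ.+ + 2 ℤ.* b) ℤ.+ -1ℤ ℤ.* C)) ≡
          (t ℤ.* (V ℤ.* (M ℤ.* M) ℤ.+ -1ℤ ℤ.* (+ 4 ℤ.* M ℤ.* b)) ℤ.+ M ℤ.* (t ℤ.* (+ 6 ℤ.* b))) ℤ.+ -1ℤ ℤ.* (t ℤ.* (M ℤ.* C))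
        eq₁ = solve-∀
        eq₂ : ∀ M w c b → ((M ℤ.* (M ℤ.* w) ℤ.+ c) ℤ.+ M ℤ.* b) ℤ.+ -1ℤ ℤ.* c ≡ M ℤ.* (b ℤ.+ M ℤ.* w)
        eq₂ = solve-∀

-- Densities

ℚ-ring : AlmostCommutativeRing _ _
ℚ-ring = fromCommutativeRing ℚₚ.+-*-commutativeRing λ p → dec⇒maybe (0ℚ ℚ.≟ p)

ι : ℤ → ℚ
ι i = i ℚ./ 1

toℚᵘ-/ : ∀ i d → ℚ.toℚᵘ (i ℚ./ suc d) ℚᵘ.≃ mkℚᵘ i d
toℚᵘ-/ i d = ℚₚ.toℚᵘ-fromℚᵘ (mkℚᵘ i d)

ι-+ : ∀ i j → ι (i ℤ.+ j) ≡ ι i ℚ.+ ι j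
ι-+ i j = ℚₚ.toℚᵘ-injective (ℚᵘₚ.≃-trans (toℚᵘ-/ (i ℤ.+ j) 0) (ℚᵘₚ.≃-trans (*≡* (eq i j))
  (ℚᵘₚ.≃-sym (ℚᵘₚ.≃-trans (ℚₚ.toℚᵘ-homo-+ (ι i) (ι j)) (ℚᵘₚ.+-cong (toℚᵘ-/ i 0) (toℚᵘ-/ j 0))))))
  where
  eq : ∀ i j → (i ℤ.+ j) ℤ.* 1ℤ ≡ (i ℤ.* 1ℤ ℤ.+ j ℤ.* 1ℤ) ℤ.* 1ℤ
  eq = solve-∀

ι-* : ∀ i j → ι (i ℤ.* j) ≡ ι i ℚ.* ι j
ι-* i j = ℚₚ.toℚᵘ-injective (ℚᵘₚ.≃-trans (toℚᵘ-/ (i ℤ.* j) 0)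
  (ℚᵘₚ.≃-sym (ℚᵘₚ.≃-trans (ℚₚ.toℚᵘ-homo-* (ι i) (ι j)) (ℚᵘₚ.*-cong (toℚᵘ-/ i 0) (toℚᵘ-/ j 0)))))

ι-mono : ∀ {i j} → i ℤ.≤ j → ι i ℚ.≤ ι j
ι-mono {i} {j} p = ℚₚ.toℚᵘ-cancel-≤ (ℚᵘₚ.≤-trans (ℚᵘₚ.≤-reflexive (toℚᵘ-/ i 0))
  (ℚᵘₚ.≤-trans (*≤* (ℤₚ.*-monoʳ-≤-nonNeg 1ℤ p)) (ℚᵘₚ.≤-reflexive (ℚᵘₚ.≃-sym (toℚᵘ-/ j 0)))))

/-*-cancel : ∀ i d .{{_ : ℕ.NonZero d}} → (i ℚ./ d) ℚ.* ι (+ d) ≡ ι i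
/-*-cancel i (suc d) = ℚₚ.toℚᵘ-injective (ℚᵘₚ.≃-trans (ℚₚ.toℚᵘ-homo-* (i ℚ./ suc d) (ι (+ suc d)))
  (ℚᵘₚ.≃-trans (ℚᵘₚ.*-cong (toℚᵘ-/ i d) (toℚᵘ-/ (+ suc d) 0))
    (ℚᵘₚ.≃-trans (*≡* (trans (ℤₚ.*-identityʳ _) (cong (λ e → i ℤ.* + suc e) (sym (ℕₚ.*-identityʳ d)))))
      (ℚᵘₚ.≃-sym (toℚᵘ-/ i 0)))))

ι-positive : ∀ k .{{_ : ℕ.NonZero k}} → ℚ.Positive (ι (+ k))
ι-positive (suc k) = ℚₚ.normalize-pos (suc k) 1

ι-nonNegative : ∀ k → ℚ.NonNegative (ι (+ k))
ι-nonNegative k = ℚₚ.normalize-nonNeg k 1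

fraction-* : ∀ k Q → fraction k Q ℚ.* ι (+ (2 ℕ.^ k)) ≡ ι (+ count k Q)
fraction-* k Q = /-*-cancel (+ count k Q) (2 ℕ.^ k) {{ℕₚ.m^n≢0 2 k}}

0≤^ : ∀ e k → 0ℚ ℚ.≤ e → 0ℚ ℚ.≤ e ^ℚ k
0≤^ e zero _ = ℚ.*≤* (ℤ.+≤+ z≤n)
0≤^ e (suc k) p = subst (ℚ._≤ e ℚ.* (e ^ℚ k)) (ℚₚ.*-zeroʳ e) (ℚₚ.*-monoˡ-≤-nonNeg e {{ℚ.nonNegative p}} (0≤^ e k p))

pow-bound : ∀ e κ k → 0ℚ ℚ.≤ e → e ℚ.* ι (+ (2 ℕ.^ κ)) ℚ.≤ 1ℚ → (e ^ℚ k) ℚ.* ι (+ (2 ℕ.^ (k ℕ.* κ))) ℚ.≤ 1ℚ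
pow-bound e κ zero p q = ℚₚ.≤-reflexive refl
pow-bound e κ (suc k) p q = begin
  (e ℚ.* E) ℚ.* ι (+ (2 ℕ.^ (κ ℕ.+ k ℕ.* κ)))
    ≡⟨ cong ((e ℚ.* E) ℚ.*_) (trans (cong (ι ∘ +_) (ℕₚ.^-distribˡ-+-* 2 κ (k ℕ.* κ))) (trans (cong ι (ℤₚ.pos-* (2 ℕ.^ κ) (2 ℕ.^ (k ℕ.* κ)))) (ι-* (+ (2 ℕ.^ κ)) (+ (2 ℕ.^ (k ℕ.* κ)))))) ⟩
  (e ℚ.* E) ℚ.* (A ℚ.* B)
    ≡⟨ eq e E A B ⟩
  (e ℚ.* A) ℚ.* (E ℚ.* B)
    ≤⟨ ℚₚ.*-monoʳ-≤-nonNeg (E ℚ.* B) {{ℚ.nonNegative EB≥0}} q ⟩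
  1ℚ ℚ.* (E ℚ.* B)
    ≡⟨ ℚₚ.*-identityˡ _ ⟩
  E ℚ.* B
    ≤⟨ pow-bound e κ k p q ⟩
  1ℚ ∎
  where
  open ℚₚ.≤-Reasoning
  E = e ^ℚ k
  A = ι (+ (2 ℕ.^ κ))
  B = ι (+ (2 ℕ.^ (k ℕ.* κ)))
  EB≥0 : 0ℚ ℚ.≤ E ℚ.* B
  EB≥0 = subst (ℚ._≤ E ℚ.* B) (ℚₚ.*-zeroˡ B) (ℚₚ.*-monoʳ-≤-nonNeg B {{ι-nonNegative (2 ℕ.^ (k ℕ.* κ))}} (0≤^ e k p))
  eq : ∀ e E A B → (e ℚ.* E) ℚ.* (A ℚ.* B) ≡ (e ℚ.* A) ℚ.* (E ℚ.* B)
  eq = RS.solve-∀ ℚ-ring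

-- If the excess over 3δ is positive, dividing it by m gives e with e 2^κ ≤ 1. The power q m of this
-- has exponent q m κ ≥ p n, which is the root-free form of e ≤ 2^(-(p/q) n/m).
density-bound : ∀ d δ p q n k κ →
  ι (+ (2 ℕ.^ κ)) ℚ.* (d ℚ.- ℕtoℚ 3 ℚ.* δ) ℚ.≤ ι (+ suc k) →
  p ℕ.* n ≤ q ℕ.* suc k ℕ.* κ → DensityBound d δ p q n (suc k)
density-bound d δ p q n k κ bound expo with d ℚₚ.≤? ℕtoℚ 3 ℚ.* δ
... | yes small = inj₁ small
... | no large = inj₂ (begin
    (e ^ℚ (q ℕ.* suc k)) ℚ.* ι (+ (2 ℕ.^ (p ℕ.* n)))
      ≤⟨ ℚₚ.*-monoˡ-≤-nonNeg (e ^ℚ (q ℕ.* suc k)) {{ℚ.nonNegative (0≤^ e (q ℕ.* suc k) e≥0)}}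
           (ι-mono (ℤ.+≤+ (ℕₚ.^-monoʳ-≤ 2 expo))) ⟩
    (e ^ℚ (q ℕ.* suc k)) ℚ.* ι (+ (2 ℕ.^ (q ℕ.* suc k ℕ.* κ)))
      ≤⟨ pow-bound e κ (q ℕ.* suc k) e≥0 e≤ ⟩
    1ℚ ∎)
  where
  open ℚₚ.≤-Reasoning
  D = d ℚ.- ℕtoℚ 3 ℚ.* δ
  inv = (+ 1) ℚ./ suc k
  e = D ℚ.* inv
  inv≥0 : ℚ.NonNegative inv
  inv≥0 = ℚₚ.normalize-nonNeg 1 (suc k)
  D≥0 : 0ℚ ℚ.≤ D
  D≥0 = subst (ℚ._≤ D) (ℚₚ.+-inverseʳ (ℕtoℚ 3 ℚ.* δ)) (ℚₚ.+-monoˡ-≤ (ℚ.- (ℕtoℚ 3 ℚ.* δ)) (ℚₚ.<⇒≤ (ℚₚ.≰⇒> large)))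
  e≥0 : 0ℚ ℚ.≤ e
  e≥0 = subst (ℚ._≤ e) (ℚₚ.*-zeroˡ inv) (ℚₚ.*-monoʳ-≤-nonNeg inv {{inv≥0}} D≥0)
  eq : ∀ D i A → D ℚ.* i ℚ.* A ≡ A ℚ.* D ℚ.* i
  eq = RS.solve-∀ ℚ-ring
  e≤ : e ℚ.* ι (+ (2 ℕ.^ κ)) ℚ.≤ 1ℚ
  e≤ = begin
    e ℚ.* ι (+ (2 ℕ.^ κ)) ≡⟨ eq D inv (ι (+ (2 ℕ.^ κ))) ⟩
    ι (+ (2 ℕ.^ κ)) ℚ.* D ℚ.* inv ≤⟨ ℚₚ.*-monoʳ-≤-nonNeg inv {{inv≥0}} bound ⟩
    ι (+ suc k) ℚ.* inv ≡⟨ trans (ℚₚ.*-comm (ι (+ suc k)) inv) (/-*-cancel (+ 1) (suc k)) ⟩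
    1ℚ ∎

sumL-ι : ∀ {A : Set} (xs : List A) (g : A → ℤ) D → (∀ x → ι (g x) ℚ.≤ D) →
  ι (sumL xs g) ℚ.≤ ι (sumL xs (λ _ → 1ℤ)) ℚ.* D
sumL-ι [] g D e = ℚₚ.≤-reflexive (sym (ℚₚ.*-zeroˡ D))
sumL-ι (x ∷ xs) g D e = begin
  ι (g x ℤ.+ sumL xs g) ≡⟨ ι-+ (g x) (sumL xs g) ⟩
  ι (g x) ℚ.+ ι (sumL xs g) ≤⟨ ℚₚ.+-mono-≤ (e x) (sumL-ι xs g D e) ⟩
  D ℚ.+ ι (sumL xs (λ _ → 1ℤ)) ℚ.* D ≡⟨ cong (ℚ._+ ι (sumL xs (λ _ → 1ℤ)) ℚ.* D) (sym (ℚₚ.*-identityˡ D)) ⟩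
  1ℚ ℚ.* D ℚ.+ ι (sumL xs (λ _ → 1ℤ)) ℚ.* D ≡⟨ ℚₚ.*-distribʳ-+ D 1ℚ (ι (sumL xs (λ _ → 1ℤ))) ⟨
  (1ℚ ℚ.+ ι (sumL xs (λ _ → 1ℤ))) ℚ.* D ≡⟨ cong (ℚ._* D) (ι-+ 1ℤ (sumL xs (λ _ → 1ℤ))) ⟨
  ι (1ℤ ℤ.+ sumL xs (λ _ → 1ℤ)) ℚ.* D ∎
  where open ℚₚ.≤-Reasoning

n≤2^⌈log₂n⌉ : ∀ n → n ≤ 2 ℕ.^ ⌈log₂ n ⌉
n≤2^⌈log₂n⌉ = <-rec (λ n → n ≤ 2 ℕ.^ ⌈log₂ n ⌉) go
  where
  open ℕₚ.≤-Reasoning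
  go : ∀ n → (∀ {k} → k < n → k ≤ 2 ℕ.^ ⌈log₂ k ⌉) → n ≤ 2 ℕ.^ ⌈log₂ n ⌉
  go 0 _ = z≤n
  go 1 _ = s≤s z≤n
  go n@(suc (suc n′)) rec = begin
    n                              ≡⟨ ℕₚ.⌊n/2⌋+⌈n/2⌉≡n n ⟨
    ⌊ n /2⌋ ℕ.+ c                  ≤⟨ ℕₚ.+-monoˡ-≤ c (ℕₚ.⌊n/2⌋≤⌈n/2⌉ n) ⟩
    c ℕ.+ c                        ≡⟨ cong (c ℕ.+_) (ℕₚ.+-identityʳ c) ⟨
    2 ℕ.* c                        ≤⟨ ℕₚ.*-monoʳ-≤ 2 (rec (ℕₚ.⌈n/2⌉<n n′)) ⟩
    2 ℕ.* 2 ℕ.^ ⌈log₂ c ⌉          ≡⟨ cong (λ l → 2 ℕ.* 2 ℕ.^ l) (⌈log₂⌈n/2⌉⌉≡⌈log₂n⌉∸1 n) ⟩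
    2 ℕ.^ suc (⌈log₂ n ⌉ ∸ 1)      ≡⟨ cong (2 ℕ.^_) (ℕₚ.m+[n∸m]≡n 1≤log) ⟩
    2 ℕ.^ ⌈log₂ n ⌉ ∎
    where
    c = ⌈ n /2⌉
    1≤log : 1 ≤ ⌈log₂ n ⌉
    1≤log = ℕₚ.≤-trans (ℕₚ.≤-reflexive (sym (⌈log₂2^n⌉≡n 1))) (⌈log₂⌉-mono-≤ {2} {n} (s≤s (s≤s z≤n)))

extractor : (n m : ℕ) → Bits n → Bits m
extractor n m x j = extract (2 ℕ.^ width n) m x (toℕ j)

module Density {n m N : ℕ} (P : RBP n m N) (v₀ : Fin N) (f : Bits n → Bool) (δ : ℚ)
  (comp : ComputesWithFailure P v₀ f δ) where

  open Errors (run P v₀) f (λ ex ey → Walk.run-cong P ex ey v₀)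

  ρ : Bits n → Bits m
  ρ = extractor n m

  d : ℚ
  d = errorDensity P v₀ f ρ

  ι-bad : ∀ x → ι (bad x) ℚ.≤ ι M ℚ.* δ
  ι-bad x = begin
    ι (bad x) ≡⟨ eq₁ (ι a) (ι (bad x)) ⟩
    (ι a ℚ.+ ι (bad x)) ℚ.+ ℚ.- ι a ≡⟨ cong (ℚ._+ ℚ.- ι a) (trans (sym (ι-+ a (bad x))) (cong ι (count+bad x))) ⟩
    ι M ℚ.+ ℚ.- ι a ≡⟨ cong (λ v → ι M ℚ.+ ℚ.- v) (fraction-* m (λ y → bitEq (run P v₀ x y) (f x))) ⟨
    ι M ℚ.+ ℚ.- (φ ℚ.* ι M) ≤⟨ ℚₚ.+-monoʳ-≤ (ι M) (ℚₚ.neg-antimono-≤ (ℚₚ.*-monoʳ-≤-nonNeg (ι M) {{ι-nonNegative (2 ℕ.^ m)}} (comp x))) ⟩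
    ι M ℚ.+ ℚ.- ((1ℚ ℚ.- δ) ℚ.* ι M) ≡⟨ cong (λ v → ι M ℚ.+ ℚ.- v) (trans (ℚₚ.*-distribʳ-+ (ι M) 1ℚ (ℚ.- δ)) (cong (ℚ._+ (ℚ.- δ) ℚ.* ι M) (ℚₚ.*-identityˡ (ι M)))) ⟩
    ι M ℚ.+ ℚ.- (ι M ℚ.+ (ℚ.- δ) ℚ.* ι M) ≡⟨ eq₂ (ι M) δ ⟩
    ι M ℚ.* δ ∎
    where
    open ℚₚ.≤-Reasoning
    a = + count m (λ y → bitEq (run P v₀ x y) (f x))
    φ = fraction m (λ y → bitEq (run P v₀ x y) (f x))
    eq₁ : ∀ a b → b ≡ (a ℚ.+ b) ℚ.+ ℚ.- a
    eq₁ = RS.solve-∀ ℚ-ring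
    eq₂ : ∀ M δ → M ℚ.+ ℚ.- (M ℚ.+ (ℚ.- δ) ℚ.* M) ≡ M ℚ.* δ
    eq₂ = RS.solve-∀ ℚ-ring

  V : ℤ
  V = + (2 ℕ.^ n)

  sumL-1 : sumL (allBits n) (λ _ → 1ℤ) ≡ V
  sumL-1 = trans (sumL-allBits n (λ _ → 1ℤ) (λ _ → refl)) (trans (sumB-const n 1ℤ) (ℤₚ.*-identityʳ V))

  ι-totalBad : ι totalBad ℚ.≤ ι V ℚ.* (ι M ℚ.* δ)
  ι-totalBad = subst (λ v → ι totalBad ℚ.≤ ι v ℚ.* (ι M ℚ.* δ)) sumL-1 (sumL-ι (allBits n) bad (ι M ℚ.* δ) ι-bad)

  d*V : d ℚ.* ι V ≡ ι (errors ρ)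
  d*V = trans (fraction-* n _) (cong ι (count≡sumL n (λ x → not (bitEq (run P v₀ x (ρ x)) (f x)))))

  errors≤V : errors ρ ℤ.≤ V
  errors≤V = subst (errors ρ ℤ.≤_) sumL-1 (sumL-mono (allBits n) λ x → ⟦⟧≤1 _)

  0≤totalBad : 0ℤ ℤ.≤ totalBad
  0≤totalBad = subst (ℤ._≤ totalBad) (sumL-0 (allBits n)) (sumL-mono (allBits n) 0≤bad)
    where
    sumL-0 : ∀ {A : Set} (xs : List A) → sumL xs (λ _ → 0ℤ) ≡ 0ℤ
    sumL-0 [] = refl
    sumL-0 (x ∷ xs) = trans (ℤₚ.+-identityˡ _) (sumL-0 xs)

  -- The common exit of all integer estimates: `k` plays the role of 2^κ and `c` that of m, or of 0
  -- when there is no excess at all. The failure hypothesis, averaged over x, enters here.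
  to-density : ∀ k c → + k ℤ.* (M ℤ.* errors ρ) ℤ.≤ + k ℤ.* (+ 3 ℤ.* totalBad) ℤ.+ M ℤ.* (+ c ℤ.* V) →
    ι (+ k) ℚ.* (d ℚ.- ℕtoℚ 3 ℚ.* δ) ℚ.≤ ι (+ c)
  to-density k c hyp = ℚₚ.*-cancelˡ-≤-pos (ι M ℚ.* ι V) {{MV>0}} (begin
    ι M ℚ.* ι V ℚ.* (ι K ℚ.* (d ℚ.- τ ℚ.* δ))
      ≡⟨ eq₁ (ι M) (ι V) (ι K) d τ δ ⟩
    ι K ℚ.* (ι M ℚ.* (d ℚ.* ι V)) ℚ.+ ℚ.- (ι K ℚ.* (τ ℚ.* (ι V ℚ.* (ι M ℚ.* δ))))
      ≡⟨ cong (λ v → ι K ℚ.* (ι M ℚ.* v) ℚ.+ ℚ.- (ι K ℚ.* (τ ℚ.* (ι V ℚ.* (ι M ℚ.* δ))))) d*V ⟩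
    ι K ℚ.* (ι M ℚ.* ι (errors ρ)) ℚ.+ ℚ.- (ι K ℚ.* (τ ℚ.* (ι V ℚ.* (ι M ℚ.* δ))))
      ≤⟨ ℚₚ.+-monoˡ-≤ (ℚ.- (ι K ℚ.* (τ ℚ.* (ι V ℚ.* (ι M ℚ.* δ))))) (subst₂ ℚ._≤_ lhs rhs (ι-mono hyp)) ⟩
    (ι K ℚ.* (τ ℚ.* ι totalBad) ℚ.+ ι M ℚ.* (ι (+ c) ℚ.* ι V)) ℚ.+ ℚ.- (ι K ℚ.* (τ ℚ.* (ι V ℚ.* (ι M ℚ.* δ))))
      ≤⟨ ℚₚ.+-monoˡ-≤ (ℚ.- (ι K ℚ.* (τ ℚ.* (ι V ℚ.* (ι M ℚ.* δ))))) (ℚₚ.+-monoˡ-≤ (ι M ℚ.* (ι (+ c) ℚ.* ι V))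
           (ℚₚ.*-monoˡ-≤-nonNeg (ι K) {{ι-nonNegative k}} (ℚₚ.*-monoˡ-≤-nonNeg τ ι-totalBad))) ⟩
    (ι K ℚ.* (τ ℚ.* (ι V ℚ.* (ι M ℚ.* δ))) ℚ.+ ι M ℚ.* (ι (+ c) ℚ.* ι V)) ℚ.+ ℚ.- (ι K ℚ.* (τ ℚ.* (ι V ℚ.* (ι M ℚ.* δ))))
      ≡⟨ eq₂ (ι K ℚ.* (τ ℚ.* (ι V ℚ.* (ι M ℚ.* δ)))) (ι M) (ι (+ c)) (ι V) ⟩
    ι M ℚ.* ι V ℚ.* ι (+ c) ∎)
    where
    open ℚₚ.≤-Reasoning
    K = + k
    τ = ℕtoℚ 3
    MV>0 : ℚ.Positive (ι M ℚ.* ι V)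
    MV>0 = subst ℚ.Positive (trans (cong ι (ℤₚ.pos-* (2 ℕ.^ m) (2 ℕ.^ n))) (ι-* M V))
      (ι-positive (2 ℕ.^ m ℕ.* 2 ℕ.^ n) {{ℕₚ.m*n≢0 _ _ {{ℕₚ.m^n≢0 2 m}} {{ℕₚ.m^n≢0 2 n}}}})
    lhs : ι (K ℤ.* (M ℤ.* errors ρ)) ≡ ι K ℚ.* (ι M ℚ.* ι (errors ρ))
    lhs = trans (ι-* K (M ℤ.* errors ρ)) (cong (ι K ℚ.*_) (ι-* M (errors ρ)))
    rhs : ι (K ℤ.* (+ 3 ℤ.* totalBad) ℤ.+ M ℤ.* (+ c ℤ.* V)) ≡ ι K ℚ.* (τ ℚ.* ι totalBad) ℚ.+ ι M ℚ.* (ι (+ c) ℚ.* ι V)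
    rhs = trans (ι-+ (K ℤ.* (+ 3 ℤ.* totalBad)) (M ℤ.* (+ c ℤ.* V)))
      (cong₂ ℚ._+_ (trans (ι-* K (+ 3 ℤ.* totalBad)) (cong (ι K ℚ.*_) (ι-* (+ 3) totalBad)))
        (trans (ι-* M (+ c ℤ.* V)) (cong (ι M ℚ.*_) (ι-* (+ c) V))))
    eq₁ : ∀ M V K d t δ → M ℚ.* V ℚ.* (K ℚ.* (d ℚ.+ ℚ.- (t ℚ.* δ))) ≡
      K ℚ.* (M ℚ.* (d ℚ.* V)) ℚ.+ ℚ.- (K ℚ.* (t ℚ.* (V ℚ.* (M ℚ.* δ))))
    eq₁ = RS.solve-∀ ℚ-ring
    eq₂ : ∀ a M c V → (a ℚ.+ M ℚ.* (c ℚ.* V)) ℚ.+ ℚ.- a ≡ M ℚ.* V ℚ.* c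
    eq₂ = RS.solve-∀ ℚ-ring

  small-density : (∀ x → M ℤ.* wrong x (ρ x) ℤ.≤ + 3 ℤ.* bad x) → d ℚ.≤ ℕtoℚ 3 ℚ.* δ
  small-density hyp = begin
    d ≡⟨ eq d (ℕtoℚ 3 ℚ.* δ) ⟩
    (d ℚ.- ℕtoℚ 3 ℚ.* δ) ℚ.+ ℕtoℚ 3 ℚ.* δ ≡⟨ cong (ℚ._+ ℕtoℚ 3 ℚ.* δ) (ℚₚ.*-identityˡ (d ℚ.- ℕtoℚ 3 ℚ.* δ)) ⟨
    1ℚ ℚ.* (d ℚ.- ℕtoℚ 3 ℚ.* δ) ℚ.+ ℕtoℚ 3 ℚ.* δ ≤⟨ ℚₚ.+-monoˡ-≤ (ℕtoℚ 3 ℚ.* δ) (to-density 1 0 total) ⟩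
    0ℚ ℚ.+ ℕtoℚ 3 ℚ.* δ ≡⟨ ℚₚ.+-identityˡ (ℕtoℚ 3 ℚ.* δ) ⟩
    ℕtoℚ 3 ℚ.* δ ∎
    where
    open ℚₚ.≤-Reasoning
    eq : ∀ d t → d ≡ (d ℚ.+ ℚ.- t) ℚ.+ t
    eq = RS.solve-∀ ℚ-ring
    total : 1ℤ ℤ.* (M ℤ.* errors ρ) ℤ.≤ 1ℤ ℤ.* (+ 3 ℤ.* totalBad) ℤ.+ M ℤ.* (0ℤ ℤ.* V)
    total = subst₂ ℤ._≤_ (trans (sumL-*ˡ (allBits n) M (λ x → wrong x (ρ x))) (sym (ℤₚ.*-identityˡ _)))
      (trans (sumL-*ˡ (allBits n) (+ 3) bad) (eq′ totalBad M V)) (sumL-mono (allBits n) hyp)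
      where
      eq′ : ∀ b M V → + 3 ℤ.* b ≡ 1ℤ ℤ.* (+ 3 ℤ.* b) ℤ.+ M ℤ.* (0ℤ ℤ.* V)
      eq′ = solve-∀

  -- With at most two random strings, a seed that errs already accounts for failure probability at
  -- least 1/2.
  few-bits : m ≤ 1 → d ℚ.≤ ℕtoℚ 3 ℚ.* δ
  few-bits m≤1 = small-density λ x → begin
    M ℤ.* wrong x (ρ x) ≤⟨ ℤₚ.*-monoʳ-≤-nonNeg (wrong x (ρ x)) {{ℤ.nonNegative (0≤⟦⟧ _)}} (ℤ.+≤+ (ℕₚ.≤-trans (ℕₚ.^-monoʳ-≤ 2 m≤1) (ℕₚ.n≤1+n 2))) ⟩
    + 3 ℤ.* wrong x (ρ x) ≤⟨ ℤₚ.*-monoˡ-≤-nonNeg (+ 3) (wrong≤bad x (ρ x)) ⟩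
    + 3 ℤ.* bad x ∎
    where open ℤₚ.≤-Reasoning

  -- If one string errs, all do. This serves programs with one vertex, where the logarithm of the
  -- size is 0 although `leaves` still grows with the number of rounds.
  constant-output : (∀ x y y′ → run P v₀ x y ≡ run P v₀ x y′) → d ℚ.≤ ℕtoℚ 3 ℚ.* δ
  constant-output const = small-density λ x → begin
    M ℤ.* wrong x (ρ x) ≡⟨ sumB-const m (wrong x (ρ x)) ⟨
    sumB m (λ _ → wrong x (ρ x)) ≡⟨ sumB-cong m (λ y → cong (λ o → ⟦ not (bitEq o (f x)) ⟧) (const x (ρ x) y)) ⟩
    bad x ≤⟨ ℤₚ.i≤i+j (bad x) (+ 2 ℤ.* bad x) {{ℤ.nonNegative (ℤₚ.*-monoˡ-≤-nonNeg (+ 2) (0≤bad x))}} ⟩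
    bad x ℤ.+ + 2 ℤ.* bad x ≡⟨ eq (bad x) ⟩
    + 3 ℤ.* bad x ∎
    where
    open ℤₚ.≤-Reasoning
    eq : ∀ b → b ℤ.+ + 2 ℤ.* b ≡ + 3 ℤ.* b
    eq = solve-∀

  -- The density is at most 1 and 2 ≤ m. This is the main estimate with κ = 1, enough when n is at
  -- most a constant times m.
  trivial-bound : 2 ≤ m → ι (+ 2) ℚ.* (d ℚ.- ℕtoℚ 3 ℚ.* δ) ℚ.≤ ι (+ m)
  trivial-bound 2≤m = to-density 2 m (begin
    + 2 ℤ.* (M ℤ.* errors ρ) ≡⟨ eq M (errors ρ) ⟩
    M ℤ.* (+ 2 ℤ.* errors ρ) ≤⟨ ℤₚ.*-monoˡ-≤-nonNeg M (ℤₚ.≤-trans (ℤₚ.*-monoˡ-≤-nonNeg (+ 2) errors≤V) (ℤₚ.*-monoʳ-≤-nonNeg V (ℤ.+≤+ 2≤m))) ⟩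
    M ℤ.* (+ m ℤ.* V) ≤⟨ ℤₚ.i≤j+i _ (+ 2 ℤ.* (+ 3 ℤ.* totalBad)) {{ℤ.nonNegative (ℤₚ.*-monoˡ-≤-nonNeg (+ 2) (ℤₚ.*-monoˡ-≤-nonNeg (+ 3) 0≤totalBad))}} ⟩
    + 2 ℤ.* (+ 3 ℤ.* totalBad) ℤ.+ M ℤ.* (+ m ℤ.* V) ∎)
    where
    open ℤₚ.≤-Reasoning
    eq : ∀ M e → + 2 ℤ.* (M ℤ.* e) ≡ M ℤ.* (+ 2 ℤ.* e)
    eq = solve-∀

  module LargeInput (sr : IsSR P) (T : ℕ) (queries : QueriesAtMost P T)
    (w : ℕ) (width≡ : width n ≡ suc w) (3U≤n : 3 ℕ.* 2 ℕ.^ suc w ≤ n)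
    (r : ℕ) (T≤ : T ≤ 2 ℕ.^ w ℕ.+ r ℕ.* 2 ℕ.^ w) (2≤N : 2 ≤ N) .{{_ : ℕ.NonZero m}} where

    U Λ : ℕ
    U = 2 ℕ.^ suc w
    Λ = ⌈log₂ N ⌉

    2g : 2 ℕ.^ w ℕ.+ 2 ℕ.^ w ≡ U
    2g = cong (2 ℕ.^ w ℕ.+_) (sym (ℕₚ.+-identityʳ _))

    open BitReplacement P sr v₀ U 3U≤n (2 ℕ.^ w) 2g T queries r T≤ using (bit-bound)

    -- The extra unit on the left makes the induction close: together with the stopping leaf it is
    -- 2, which one more N * N absorbs.
    leaves≤ : ∀ r → suc (leaves N r) ≤ 2 ℕ.* 2 ℕ.^ (2 ℕ.* (r ℕ.* Λ))
    leaves≤ zero = ℕₚ.≤-refl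
    leaves≤ (suc r) = begin
      2 ℕ.+ N ℕ.* (N ℕ.* l)   ≤⟨ ℕₚ.+-monoˡ-≤ (N ℕ.* (N ℕ.* l)) (ℕₚ.≤-trans 2≤N (ℕₚ.m≤m*n N N {{ℕ.>-nonZero (ℕₚ.<⇒≤ 2≤N)}})) ⟩
      N ℕ.* N ℕ.+ N ℕ.* (N ℕ.* l)   ≡⟨ eq₁ N l ⟩
      N ℕ.* N ℕ.* suc l       ≤⟨ ℕₚ.*-mono-≤ (ℕₚ.*-mono-≤ (n≤2^⌈log₂n⌉ N) (n≤2^⌈log₂n⌉ N)) (leaves≤ r) ⟩
      2 ℕ.^ Λ ℕ.* 2 ℕ.^ Λ ℕ.* (2 ℕ.* 2 ℕ.^ (2 ℕ.* (r ℕ.* Λ)))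
        ≡⟨ trans (cong (ℕ._* (2 ℕ.* 2 ℕ.^ (2 ℕ.* (r ℕ.* Λ)))) (sym (ℕₚ.^-distribˡ-+-* 2 Λ Λ)))
             (sym (ℕₚ.^-distribˡ-+-* 2 (Λ ℕ.+ Λ) (suc (2 ℕ.* (r ℕ.* Λ))))) ⟩
      2 ℕ.^ (Λ ℕ.+ Λ ℕ.+ suc (2 ℕ.* (r ℕ.* Λ))) ≡⟨ cong (2 ℕ.^_) (eq₂ Λ (r ℕ.* Λ)) ⟩
      2 ℕ.^ suc (2 ℕ.* (Λ ℕ.+ r ℕ.* Λ)) ∎
      where
      open ℕₚ.≤-Reasoning
      l = leaves N r
      eq₁ : ∀ N l → N ℕ.* N ℕ.+ N ℕ.* (N ℕ.* l) ≡ N ℕ.* N ℕ.* (1 ℕ.+ l)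
      eq₁ = ℕR.solve-∀
      eq₂ : ∀ a b → a ℕ.+ a ℕ.+ (1 ℕ.+ 2 ℕ.* b) ≡ 1 ℕ.+ 2 ℕ.* (a ℕ.+ b)
      eq₂ = ℕR.solve-∀

    leaves²≤ : leaves N r ℕ.* leaves N r ≤ 2 ℕ.^ (2 ℕ.+ 4 ℕ.* (r ℕ.* Λ))
    leaves²≤ = begin
      leaves N r ℕ.* leaves N r ≤⟨ ℕₚ.*-mono-≤ half half ⟩
      2 ℕ.^ suc (2 ℕ.* (r ℕ.* Λ)) ℕ.* 2 ℕ.^ suc (2 ℕ.* (r ℕ.* Λ)) ≡⟨ ℕₚ.^-distribˡ-+-* 2 (suc (2 ℕ.* (r ℕ.* Λ))) (suc (2 ℕ.* (r ℕ.* Λ))) ⟨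
      2 ℕ.^ (suc (2 ℕ.* (r ℕ.* Λ)) ℕ.+ suc (2 ℕ.* (r ℕ.* Λ))) ≡⟨ cong (2 ℕ.^_) (eq (r ℕ.* Λ)) ⟩
      2 ℕ.^ (2 ℕ.+ 4 ℕ.* (r ℕ.* Λ)) ∎
      where
      open ℕₚ.≤-Reasoning
      half = ℕₚ.≤-trans (ℕₚ.n≤1+n _) (leaves≤ r)
      eq : ∀ a → (1 ℕ.+ 2 ℕ.* a) ℕ.+ (1 ℕ.+ 2 ℕ.* a) ≡ 2 ℕ.+ 4 ℕ.* a
      eq = ℕR.solve-∀

    module _ (h κ : ℕ) (h≤ : h ℕ.+ h ≤ U / m) (κ≤ : suc (4 ℕ.* (r ℕ.* Λ)) ℕ.+ κ ≤ h) where

      Q B : ℕ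
      Q = leaves N r ℕ.* leaves N r
      B = 2 ℕ.^ n ℕ.* Q

      ρ-bit : ∀ x j → ρ x j ≡ extract U m x (toℕ j)
      ρ-bit x j = cong (λ w → extract (2 ℕ.^ w) m x (toℕ j)) width≡

      bits-bound : ∀ j y z → ∣ sumB n (λ x → sg (ρ x j) ℤ.* (sg (run P v₀ x y) ℤ.* sg (run P v₀ x (splice j z (ρ x))))) ∣ ℕ.* 2 ℕ.^ h ≤ B
      bits-bound j y z = subst (λ v → ∣ v ∣ ℕ.* 2 ℕ.^ h ≤ B)
        (sumB-cong n λ x → cong₂ (λ a b → sg a ℤ.* (sg (run P v₀ x y) ℤ.* sg b)) (sym (ρ-bit x j))
          (Walk.run-cong P (λ _ → refl) (splice-cong j z λ i _ → sym (ρ-bit x i)) v₀))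
        (bit-bound j y z h (ℕₚ.≤-trans h≤ (segment-size U m (toℕ j) (Finₚ.toℕ<n j))))

      -- The pairs of leaves of the two protocols number at most 2^(2 + 4rΛ), and `κ` is what
      -- remains of `h`. The spare factor 2 is cancelled by the 2 on the left of `error-bound`.
      Q2^κ≤ : Q ℕ.* 2 ℕ.^ κ ≤ 2 ℕ.* 2 ℕ.^ h
      Q2^κ≤ = begin
        Q ℕ.* 2 ℕ.^ κ ≤⟨ ℕₚ.*-monoˡ-≤ (2 ℕ.^ κ) leaves²≤ ⟩
        2 ℕ.^ (2 ℕ.+ 4 ℕ.* (r ℕ.* Λ)) ℕ.* 2 ℕ.^ κ ≡⟨ ℕₚ.^-distribˡ-+-* 2 (2 ℕ.+ 4 ℕ.* (r ℕ.* Λ)) κ ⟨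
        2 ℕ.^ suc (suc (4 ℕ.* (r ℕ.* Λ)) ℕ.+ κ) ≤⟨ ℕₚ.^-monoʳ-≤ 2 (s≤s κ≤) ⟩
        2 ℕ.^ suc h ∎
        where open ℕₚ.≤-Reasoning

      main-bound : ι (+ (2 ℕ.^ κ)) ℚ.* (d ℚ.- ℕtoℚ 3 ℚ.* δ) ℚ.≤ ι (+ m)
      main-bound = to-density (2 ℕ.^ κ) m (ℤₚ.*-cancelˡ-≤-pos _ _ (+ 2 ℤ.* t) {{2t>0}} (begin
        + 2 ℤ.* t ℤ.* (k ℤ.* (M ℤ.* E)) ≡⟨ eq₁ t k (M ℤ.* E) ⟩
        k ℤ.* (t ℤ.* (+ 2 ℤ.* (M ℤ.* E)))
          ≤⟨ ℤₚ.*-monoˡ-≤-nonNeg k (error-bound ρ (λ e j → extract-cong (2 ℕ.^ width n) m e (toℕ j)) (2 ℕ.^ h) B bits-bound) ⟩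
        k ℤ.* (t ℤ.* (+ 6 ℤ.* totalBad) ℤ.+ M ℤ.* (+ m ℤ.* + B))
          ≡⟨ cong (λ v → k ℤ.* (t ℤ.* (+ 6 ℤ.* totalBad) ℤ.+ M ℤ.* (+ m ℤ.* v))) (ℤₚ.pos-* (2 ℕ.^ n) Q) ⟩
        k ℤ.* (t ℤ.* (+ 6 ℤ.* totalBad) ℤ.+ M ℤ.* (+ m ℤ.* (V ℤ.* + Q)))
          ≡⟨ eq₂ k t totalBad M (+ m) V (+ Q) ⟩
        + 2 ℤ.* t ℤ.* (k ℤ.* (+ 3 ℤ.* totalBad)) ℤ.+ M ℤ.* (+ m ℤ.* V) ℤ.* (+ Q ℤ.* k)
          ≤⟨ ℤₚ.+-monoʳ-≤ (+ 2 ℤ.* t ℤ.* (k ℤ.* (+ 3 ℤ.* totalBad))) (ℤₚ.*-monoˡ-≤-nonNeg (M ℤ.* (+ m ℤ.* V)) {{MmV≥0}} Qk≤) ⟩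
        + 2 ℤ.* t ℤ.* (k ℤ.* (+ 3 ℤ.* totalBad)) ℤ.+ M ℤ.* (+ m ℤ.* V) ℤ.* (+ 2 ℤ.* t)
          ≡⟨ eq₃ (+ 2 ℤ.* t) (k ℤ.* (+ 3 ℤ.* totalBad)) (M ℤ.* (+ m ℤ.* V)) ⟩
        + 2 ℤ.* t ℤ.* (k ℤ.* (+ 3 ℤ.* totalBad) ℤ.+ M ℤ.* (+ m ℤ.* V)) ∎))
        where
        open ℤₚ.≤-Reasoning
        t = + (2 ℕ.^ h)
        k = + (2 ℕ.^ κ)
        E = errors ρ
        2t>0 : ℤ.Positive (+ 2 ℤ.* t)
        2t>0 = subst ℤ.Positive (ℤₚ.pos-* 2 (2 ℕ.^ h)) (ℤ.positive (ℤ.+<+ (ℕₚ.m^n>0 2 (suc h))))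
        MmV≥0 : ℤ.NonNegative (M ℤ.* (+ m ℤ.* V))
        MmV≥0 = subst ℤ.NonNegative (trans (ℤₚ.pos-* (2 ℕ.^ m) (m ℕ.* 2 ℕ.^ n)) (cong (M ℤ.*_) (ℤₚ.pos-* m (2 ℕ.^ n)))) _
        Qk≤ : + Q ℤ.* k ℤ.≤ + 2 ℤ.* t
        Qk≤ = subst₂ ℤ._≤_ (ℤₚ.pos-* Q (2 ℕ.^ κ)) (ℤₚ.pos-* 2 (2 ℕ.^ h)) (ℤ.+≤+ Q2^κ≤)
        eq₁ : ∀ t k e → + 2 ℤ.* t ℤ.* (k ℤ.* e) ≡ k ℤ.* (t ℤ.* (+ 2 ℤ.* e))
        eq₁ = solve-∀
        eq₂ : ∀ k t b M m V Q → k ℤ.* (t ℤ.* (+ 6 ℤ.* b) ℤ.+ M ℤ.* (m ℤ.* (V ℤ.* Q))) ≡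
          + 2 ℤ.* t ℤ.* (k ℤ.* (+ 3 ℤ.* b)) ℤ.+ M ℤ.* (m ℤ.* V) ℤ.* (Q ℤ.* k)
        eq₂ = solve-∀
        eq₃ : ∀ t a b → t ℤ.* a ℤ.+ b ℤ.* t ≡ t ℤ.* (a ℤ.+ b)
        eq₃ = solve-∀

-- Choice of the parameters and constants

m<[m/n+1]*n : ∀ m n .{{_ : ℕ.NonZero n}} → m < suc (m / n) ℕ.* n
m<[m/n+1]*n m n = subst (_< suc (m / n) ℕ.* n) (sym (m≡m%n+[m/n]*n m n)) (ℕₚ.+-monoˡ-< (m / n ℕ.* n) (m%n<n m n))

width-lower : ∀ n → n < 8 ℕ.* 2 ℕ.^ width n
width-lower n = begin-strict
  n <⟨ m<[m/n+1]*n n 4 ⟩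
  suc s ℕ.* 4 ≡⟨ cong (ℕ._* 4) (proj₂ spec) ⟨
  (U ℕ.+ v) ℕ.* 4 ≤⟨ ℕₚ.*-monoˡ-≤ 4 (ℕₚ.+-monoʳ-≤ U (ℕₚ.<⇒≤ (proj₁ spec))) ⟩
  (U ℕ.+ U) ℕ.* 4 ≡⟨ eq U ⟩
  8 ℕ.* U ∎
  where
  open ℕₚ.≤-Reasoning
  s = n / 4
  U = 2 ℕ.^ width n
  v = proj₂ (grow s)
  spec = grow-spec s
  eq : ∀ u → (u ℕ.+ u) ℕ.* 4 ≡ 8 ℕ.* u
  eq = ℕR.solve-∀

width-upper : ∀ n → 2 ℕ.^ width n ≤ suc (n / 4)
width-upper n = ℕₚ.≤-trans (ℕₚ.m≤m+n _ _) (ℕₚ.≤-reflexive (proj₂ (grow-spec (n / 4))))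

-- `width-upper` gives only U ≤ ⌊n/4⌋ + 1; the extra 3 is absorbed once ⌊n/4⌋ ≥ 3, hence the 12.
3U≤n : ∀ n → 12 ≤ n → 3 ℕ.* 2 ℕ.^ width n ≤ n
3U≤n n 12≤n = begin
  3 ℕ.* 2 ℕ.^ width n ≤⟨ ℕₚ.*-monoʳ-≤ 3 (width-upper n) ⟩
  3 ℕ.* suc s ≡⟨ eq s ⟩
  3 ℕ.+ s ℕ.* 3 ≤⟨ ℕₚ.+-monoˡ-≤ (s ℕ.* 3) 3≤s ⟩
  s ℕ.+ s ℕ.* 3 ≡⟨ eq′ s ⟩
  s ℕ.* 4 ≤⟨ m/n*n≤m n 4 ⟩
  n ∎
  where
  open ℕₚ.≤-Reasoning
  s = n / 4
  3≤s : 3 ≤ s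
  3≤s = ℕₚ.≤-pred (ℕₚ.*-cancelʳ-< 4 3 (suc s) (ℕₚ.≤-<-trans 12≤n (m<[m/n+1]*n n 4)))
  eq : ∀ s → 3 ℕ.* (1 ℕ.+ s) ≡ 3 ℕ.+ s ℕ.* 3
  eq = ℕR.solve-∀
  eq′ : ∀ s → s ℕ.+ s ℕ.* 3 ≡ s ℕ.* 4
  eq′ = ℕR.solve-∀

positive-width : ∀ n → 8 ≤ n → Σ ℕ λ w → width n ≡ suc w
positive-width n 8≤n = go (width n) refl
  where
  go : ∀ w → width n ≡ w → Σ ℕ λ w′ → width n ≡ suc w′
  go zero e = ⊥-elim (ℕₚ.<⇒≱ (subst (λ w → n < 8 ℕ.* 2 ℕ.^ w) e (width-lower n)) 8≤n)
  go (suc w) e = w , e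

-- Since e n ≤ 8 e U ≤ 16 e m (1 + h) and h ≤ 1 + 4rΛ + κ, the two units cost 2n and the
-- communication costs 64n. With e ≥ 67 one n is left for the term in κ.
exponent-bound : ∀ e n m U h r Λ κ → 67 ≤ e → 16 ℕ.* e ℕ.* m ≤ n → e ℕ.* (r ℕ.* Λ ℕ.* m) ≤ n → n < 8 ℕ.* U →
  U < suc (suc (h ℕ.+ h)) ℕ.* m → h ≤ suc (4 ℕ.* (r ℕ.* Λ)) ℕ.+ κ → n ≤ 16 ℕ.* e ℕ.* m ℕ.* κ
exponent-bound e n m U h r Λ κ p₀ p₁ p₂ p₃ p₄ p₅ = ℕₚ.+-cancelˡ-≤ (66 ℕ.* n) _ _ (begin
  66 ℕ.* n ℕ.+ n ≡⟨ ℕₚ.+-comm (66 ℕ.* n) n ⟩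
  67 ℕ.* n ≤⟨ ℕₚ.*-monoˡ-≤ n p₀ ⟩
  e ℕ.* n ≤⟨ ℕₚ.*-monoʳ-≤ e (ℕₚ.<⇒≤ p₃) ⟩
  e ℕ.* (8 ℕ.* U) ≤⟨ ℕₚ.*-monoʳ-≤ e (ℕₚ.*-monoʳ-≤ 8 (ℕₚ.<⇒≤ p₄)) ⟩
  e ℕ.* (8 ℕ.* ((2 ℕ.+ (h ℕ.+ h)) ℕ.* m)) ≡⟨ eq₁ e h m ⟩
  16 ℕ.* e ℕ.* m ℕ.+ 16 ℕ.* e ℕ.* m ℕ.* h ≤⟨ ℕₚ.+-monoʳ-≤ (16 ℕ.* e ℕ.* m) (ℕₚ.*-monoʳ-≤ (16 ℕ.* e ℕ.* m) p₅) ⟩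
  16 ℕ.* e ℕ.* m ℕ.+ 16 ℕ.* e ℕ.* m ℕ.* (1 ℕ.+ 4 ℕ.* (r ℕ.* Λ) ℕ.+ κ) ≡⟨ eq₂ e m r Λ κ ⟩
  2 ℕ.* (16 ℕ.* e ℕ.* m) ℕ.+ 64 ℕ.* (e ℕ.* (r ℕ.* Λ ℕ.* m)) ℕ.+ 16 ℕ.* e ℕ.* m ℕ.* κ
    ≤⟨ ℕₚ.+-monoˡ-≤ (16 ℕ.* e ℕ.* m ℕ.* κ) (ℕₚ.+-mono-≤ (ℕₚ.*-monoʳ-≤ 2 p₁) (ℕₚ.*-monoʳ-≤ 64 p₂)) ⟩
  2 ℕ.* n ℕ.+ 64 ℕ.* n ℕ.+ 16 ℕ.* e ℕ.* m ℕ.* κ ≡⟨ cong (ℕ._+ 16 ℕ.* e ℕ.* m ℕ.* κ) (sym (ℕₚ.*-distribʳ-+ n 2 64)) ⟩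
  66 ℕ.* n ℕ.+ 16 ℕ.* e ℕ.* m ℕ.* κ ∎)
  where
  open ℕₚ.≤-Reasoning
  eq₁ : ∀ e h m → e ℕ.* (8 ℕ.* ((2 ℕ.+ (h ℕ.+ h)) ℕ.* m)) ≡ 16 ℕ.* e ℕ.* m ℕ.+ 16 ℕ.* e ℕ.* m ℕ.* h
  eq₁ = ℕR.solve-∀
  eq₂ : ∀ e m r Λ κ → 16 ℕ.* e ℕ.* m ℕ.+ 16 ℕ.* e ℕ.* m ℕ.* (1 ℕ.+ 4 ℕ.* (r ℕ.* Λ) ℕ.+ κ) ≡
    2 ℕ.* (16 ℕ.* e ℕ.* m) ℕ.+ 64 ℕ.* (e ℕ.* (r ℕ.* Λ ℕ.* m)) ℕ.+ 16 ℕ.* e ℕ.* m ℕ.* κ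
  eq₂ = ℕR.solve-∀

-- There are at most T / g handovers and g is at least n / 16; the 16 in the hypothesis pays for the
-- latter.
communication-bound : ∀ e n m T Λ r g .{{_ : ℕ.NonZero g}} → 16 ℕ.* e ℕ.* (T ℕ.* Λ ℕ.* m) ≤ n ℕ.* n →
  r ℕ.* g ≤ T → n ≤ 16 ℕ.* g → e ℕ.* (r ℕ.* Λ ℕ.* m) ≤ n
communication-bound e n m T Λ r g p₁ p₂ p₃ = ℕₚ.*-cancelˡ-≤ (16 ℕ.* g) {{ℕₚ.m*n≢0 16 g}} (begin
  16 ℕ.* g ℕ.* (e ℕ.* (r ℕ.* Λ ℕ.* m)) ≡⟨ eq e g r Λ m ⟩
  16 ℕ.* e ℕ.* (r ℕ.* g ℕ.* Λ ℕ.* m) ≤⟨ ℕₚ.*-monoʳ-≤ (16 ℕ.* e) (ℕₚ.*-monoˡ-≤ m (ℕₚ.*-monoˡ-≤ Λ p₂)) ⟩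
  16 ℕ.* e ℕ.* (T ℕ.* Λ ℕ.* m) ≤⟨ p₁ ⟩
  n ℕ.* n ≤⟨ ℕₚ.*-monoˡ-≤ n p₃ ⟩
  16 ℕ.* g ℕ.* n ∎)
  where
  open ℕₚ.≤-Reasoning
  eq : ∀ e g r Λ m → 16 ℕ.* g ℕ.* (e ℕ.* (r ℕ.* Λ ℕ.* m)) ≡ 16 ℕ.* e ℕ.* (r ℕ.* g ℕ.* Λ ℕ.* m)
  eq = ℕR.solve-∀

Fin1-unique : (v w : Fin 1) → v ≡ w
Fin1-unique zero zero = refl

one-vertex : ∀ {n m} (P : RBP n m 1) v x y y′ → run P v x y ≡ run P v x y′
one-vertex P v x y y′ = trans (run≡output v x y)
  (trans (cong (λ u → nodeOut (P u)) (Fin1-unique _ _)) (sym (run≡output v x y′)))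
  where open Walk P

module _ (e : ℕ) (67≤e : 67 ≤ e) (n k : ℕ) {N : ℕ} (P : RBP n (suc (suc k)) N) (2≤N : 2 ≤ N) (v₀ : Fin N)
  (f : Bits n → Bool) (δ : ℚ) (sr : IsSR P) (comp : ComputesWithFailure P v₀ f δ)
  (T : ℕ) (queries : QueriesAtMost P T)
  (cost : 16 ℕ.* e ℕ.* (T ℕ.* ⌈log₂ N ⌉ ℕ.* suc (suc k)) ≤ 1 ℕ.* (n ℕ.* n)) where

  private
    m : ℕ
    m = suc (suc k)
    d : ℚ
    d = errorDensity P v₀ f (extractor n m)

  density-small : n ≤ 16 ℕ.* e ℕ.* m → DensityBound d δ 1 (16 ℕ.* e) n m
  density-small n≤ = density-bound d δ 1 (16 ℕ.* e) n (suc k) 1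
    (Density.trivial-bound P v₀ f δ comp (s≤s (s≤s z≤n)))
    (ℕₚ.≤-trans (ℕₚ.≤-reflexive (ℕₚ.*-identityˡ n)) (ℕₚ.≤-trans n≤ (ℕₚ.≤-reflexive (sym (ℕₚ.*-identityʳ (16 ℕ.* e ℕ.* m))))))

  density-large : 16 ℕ.* e ℕ.* m ≤ n → DensityBound d δ 1 (16 ℕ.* e) n m
  density-large big = density-bound d δ 1 (16 ℕ.* e) n (suc k) κ
    (Density.LargeInput.main-bound P v₀ f δ comp sr T queries w w≡ (subst (λ w → 3 ℕ.* 2 ℕ.^ w ≤ n) w≡ (3U≤n n 12≤n)) r T≤ 2≤N h κ h+h≤ κ≤)
    (ℕₚ.≤-trans (ℕₚ.≤-reflexive (ℕₚ.*-identityˡ n)) expo)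
    where
    e≤n : e ≤ n
    e≤n = ℕₚ.≤-trans (ℕₚ.≤-trans (ℕₚ.m≤n*m e 16) (ℕₚ.m≤m*n (16 ℕ.* e) m)) big
    12≤n : 12 ≤ n
    12≤n = ℕₚ.≤-trans (ℕₚ.m≤m+n 12 55) (ℕₚ.≤-trans 67≤e e≤n)
    pw = positive-width n (ℕₚ.≤-trans (ℕₚ.m≤m+n 8 4) 12≤n)
    w = proj₁ pw
    w≡ = proj₂ pw
    g = 2 ℕ.^ w
    instance
      g≢0 : ℕ.NonZero g
      g≢0 = ℕₚ.m^n≢0 2 w
    U = 2 ℕ.^ suc w
    Λ = ⌈log₂ N ⌉
    r = T / g
    h = ⌊ U / m /2⌋
    -- The subtraction might truncate. `expo` holds even then, and with κ = 0 it would give n ≤ 0;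
    -- this is how `κ≤` excludes truncation.
    κ = h ∸ suc (4 ℕ.* (r ℕ.* Λ))
    T≤ : T ≤ g ℕ.+ r ℕ.* g
    T≤ = ℕₚ.<⇒≤ (m<[m/n+1]*n T g)
    h+h≤ : h ℕ.+ h ≤ U / m
    h+h≤ = ℕₚ.≤-trans (ℕₚ.+-monoʳ-≤ h (ℕₚ.⌊n/2⌋≤⌈n/2⌉ (U / m))) (ℕₚ.≤-reflexive (ℕₚ.⌊n/2⌋+⌈n/2⌉≡n (U / m)))
    n<8U : n < 8 ℕ.* U
    n<8U = subst (λ w → n < 8 ℕ.* 2 ℕ.^ w) w≡ (width-lower n)
    n≤16g : n ≤ 16 ℕ.* g
    n≤16g = ℕₚ.≤-trans (ℕₚ.<⇒≤ n<8U) (ℕₚ.≤-reflexive (sym (ℕₚ.*-assoc 8 2 g)))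
    ⌈⌉≤ : ∀ l → ⌈ l /2⌉ ≤ suc ⌊ l /2⌋
    ⌈⌉≤ zero = z≤n
    ⌈⌉≤ (suc zero) = ℕₚ.≤-refl
    ⌈⌉≤ (suc (suc l)) = s≤s (⌈⌉≤ l)
    U< : U < suc (suc (h ℕ.+ h)) ℕ.* m
    U< = ℕₚ.<-≤-trans (m<[m/n+1]*n U m) (ℕₚ.*-monoˡ-≤ m (s≤s (begin
      U / m ≡⟨ ℕₚ.⌊n/2⌋+⌈n/2⌉≡n (U / m) ⟨
      h ℕ.+ ⌈ U / m /2⌉ ≤⟨ ℕₚ.+-monoʳ-≤ h (⌈⌉≤ (U / m)) ⟩
      h ℕ.+ suc h ≡⟨ ℕₚ.+-suc h h ⟩
      suc (h ℕ.+ h) ∎)))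
      where open ℕₚ.≤-Reasoning
    expo : n ≤ 16 ℕ.* e ℕ.* m ℕ.* κ
    expo = exponent-bound e n m U h r Λ κ 67≤e big
      (communication-bound e n m T Λ r g (ℕₚ.≤-trans cost (ℕₚ.≤-reflexive (ℕₚ.*-identityˡ (n ℕ.* n))))
        (m/n*n≤m T g) n≤16g)
      n<8U U< (ℕₚ.m≤n+m∸n h (suc (4 ℕ.* (r ℕ.* Λ))))
    κ≤ : suc (4 ℕ.* (r ℕ.* Λ)) ℕ.+ κ ≤ h
    κ≤ with suc (4 ℕ.* (r ℕ.* Λ)) ℕ.≤? h
    ... | yes q = ℕₚ.≤-reflexive (ℕₚ.m+[n∸m]≡n q)
    ... | no q = ⊥-elim (ℕₚ.<⇒≱ (ℕₚ.<-≤-trans (s≤s z≤n) 12≤n) (ℕₚ.≤-trans expo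
      (ℕₚ.≤-reflexive (trans (cong (16 ℕ.* e ℕ.* m ℕ.*_) (ℕₚ.m≤n⇒m∸n≡0 (ℕₚ.<⇒≤ (ℕₚ.≰⇒> q)))) (ℕₚ.*-zeroʳ (16 ℕ.* e ℕ.* m))))))

extractor-density : ∀ e → 67 ≤ e → ∀ n m {N} (P : RBP n m N) (v₀ : Fin N) (f : Bits n → Bool) (δ : ℚ) →
  IsSR P → ComputesWithFailure P v₀ f δ → ∀ T → QueriesAtMost P T →
  16 ℕ.* e ℕ.* (T ℕ.* ⌈log₂ N ⌉ ℕ.* m) ≤ 1 ℕ.* (n ℕ.* n) →
  DensityBound (errorDensity P v₀ f (extractor n m)) δ 1 (16 ℕ.* e) n m
extractor-density e 67≤e n zero P v₀ f δ sr comp T queries cost = Density.few-bits P v₀ f δ comp z≤n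
extractor-density e 67≤e n (suc zero) P v₀ f δ sr comp T queries cost = inj₁ (Density.few-bits P v₀ f δ comp ℕₚ.≤-refl)
extractor-density e 67≤e n (suc (suc k)) {suc zero} P v₀ f δ sr comp T queries cost =
  inj₁ (Density.constant-output P v₀ f δ comp (one-vertex P v₀))
extractor-density e 67≤e n m@(suc (suc k)) {N@(suc (suc _))} P v₀ f δ sr comp T queries cost =
  [ density-small e 67≤e n k P 2≤N v₀ f δ sr comp T queries cost
  , density-large e 67≤e n k P 2≤N v₀ f δ sr comp T queries cost ]′ (ℕₚ.≤-total n (16 ℕ.* e ℕ.* m))
  where
  2≤N : 2 ≤ N
  2≤N = s≤s (s≤s z≤n)

-- The Turing machine

-- Machine states are numbers; a one-sided inverse is enough to program with structured states
-- instead.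
record Finite (A : Set) : Set where
  field
    size : ℕ
    enc : A → Fin size
    dec : Fin size → A
    dec-enc : ∀ a → dec (enc a) ≡ a
open Finite

finiteBool : Finite Bool
finiteBool .size = 2
finiteBool .enc false = zero
finiteBool .enc true = suc zero
finiteBool .dec zero = false
finiteBool .dec (suc _) = true
finiteBool .dec-enc false = refl
finiteBool .dec-enc true = refl

finite× : ∀ {A B} → Finite A → Finite B → Finite (A × B)
finite× fa fb .size = size fa ℕ.* size fb
finite× fa fb .enc (a , b) = combine (enc fa a) (enc fb b)
finite× fa fb .dec i = dec fa (proj₁ (remQuot (size fb) i)) , dec fb (proj₂ (remQuot {size fa} (size fb) i))
finite× fa fb .dec-enc (a , b) =
  trans (cong (λ p → dec fa (proj₁ p) , dec fb (proj₂ p)) (Finₚ.remQuot-combine (enc fa a) (enc fb b)))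
        (cong₂ _,_ (dec-enc fa a) (dec-enc fb b))

finite⊎ : ∀ {A B} → Finite A → Finite B → Finite (A ⊎ B)
finite⊎ fa fb .size = size fa ℕ.+ size fb
finite⊎ fa fb .enc (inj₁ a) = enc fa a Fin.↑ˡ size fb
finite⊎ fa fb .enc (inj₂ b) = size fa Fin.↑ʳ enc fb b
finite⊎ fa fb .dec i = [ inj₁ ∘ dec fa , inj₂ ∘ dec fb ]′ (splitAt (size fa) i)
finite⊎ fa fb .dec-enc (inj₁ a) rewrite Finₚ.splitAt-↑ˡ (size fa) (enc fa a) (size fb) = cong inj₁ (dec-enc fa a)
finite⊎ fa fb .dec-enc (inj₂ b) rewrite Finₚ.splitAt-↑ʳ (size fa) (size fb) (enc fb b) = cong inj₂ (dec-enc fb b)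

finiteVia : ∀ {A B : Set} (f : A → B) (g : B → A) → (∀ a → g (f a) ≡ a) → Finite B → Finite A
finiteVia f g gf fb .size = size fb
finiteVia f g gf fb .enc = enc fb ∘ f
finiteVia f g gf fb .dec = g ∘ dec fb
finiteVia f g gf fb .dec-enc a = trans (cong g (dec-enc fb (f a))) (gf a)

-- The work tape holds a mark followed by k cells with three binary counters u, v, w
-- modulo U = 2^k, least significant digit first. States inc c and ret c o increment the
-- counter track c and return to the mark with overflow bit o.
--   pS: scan x, growing the tape by one cell whenever v wraps; cClear: make v zero.
--   pA: from the separator go left until u wraps (U ∸ u steps), counting in v; then
--       (cA₃, cA₄) increment both until v wraps, which restores u.
--   pB: remember the bit read and go left 2 U positions; pC: multiply, return to the separator.
--   pD: add m to w in unary along the block of ones, emitting the accumulator at each wrap.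
--   pE: return to the separator, increment u, and halt when it wraps.
data Track : Set where
  tu tv tw : Track

data Cont : Set where
  cScan cClear cA₁ cA₂ cA₃ cA₄ cB cD cE : Cont

data Simple : Set where
  pInit pS₀ pS₁ pS₂ pS₃ pA pB₀ pB₁ pB₂ pC₀ pC₁ pD pE pHalt : Simple

data Pc : Set where
  pc : Simple → Pc
  inc : Cont → Pc
  ret : Cont → Bool → Pc

finiteCont : Finite Cont
finiteCont .size = 9
finiteCont .enc cScan = Fin.# 0
finiteCont .enc cClear = Fin.# 1
finiteCont .enc cA₁ = Fin.# 2
finiteCont .enc cA₂ = Fin.# 3
finiteCont .enc cA₃ = Fin.# 4
finiteCont .enc cA₄ = Fin.# 5
finiteCont .enc cB = Fin.# 6
finiteCont .enc cD = Fin.# 7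
finiteCont .enc cE = Fin.# 8
finiteCont .dec = Vec.lookup (cScan Vec.∷ cClear Vec.∷ cA₁ Vec.∷ cA₂ Vec.∷ cA₃ Vec.∷ cA₄ Vec.∷ cB Vec.∷ cD Vec.∷ cE Vec.∷ Vec.[])
finiteCont .dec-enc cScan = refl
finiteCont .dec-enc cClear = refl
finiteCont .dec-enc cA₁ = refl
finiteCont .dec-enc cA₂ = refl
finiteCont .dec-enc cA₃ = refl
finiteCont .dec-enc cA₄ = refl
finiteCont .dec-enc cB = refl
finiteCont .dec-enc cD = refl
finiteCont .dec-enc cE = refl

finiteSimple : Finite Simple
finiteSimple .size = 14
finiteSimple .enc pInit = Fin.# 0
finiteSimple .enc pS₀ = Fin.# 1
finiteSimple .enc pS₁ = Fin.# 2
finiteSimple .enc pS₂ = Fin.# 3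
finiteSimple .enc pS₃ = Fin.# 4
finiteSimple .enc pA = Fin.# 5
finiteSimple .enc pB₀ = Fin.# 6
finiteSimple .enc pB₁ = Fin.# 7
finiteSimple .enc pB₂ = Fin.# 8
finiteSimple .enc pC₀ = Fin.# 9
finiteSimple .enc pC₁ = Fin.# 10
finiteSimple .enc pD = Fin.# 11
finiteSimple .enc pE = Fin.# 12
finiteSimple .enc pHalt = Fin.# 13
finiteSimple .dec = Vec.lookup (pInit Vec.∷ pS₀ Vec.∷ pS₁ Vec.∷ pS₂ Vec.∷ pS₃ Vec.∷ pA Vec.∷ pB₀ Vec.∷ pB₁ Vec.∷ pB₂ Vec.∷ pC₀ Vec.∷ pC₁ Vec.∷ pD Vec.∷ pE Vec.∷ pHalt Vec.∷ Vec.[])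
finiteSimple .dec-enc pInit = refl
finiteSimple .dec-enc pS₀ = refl
finiteSimple .dec-enc pS₁ = refl
finiteSimple .dec-enc pS₂ = refl
finiteSimple .dec-enc pS₃ = refl
finiteSimple .dec-enc pA = refl
finiteSimple .dec-enc pB₀ = refl
finiteSimple .dec-enc pB₁ = refl
finiteSimple .dec-enc pB₂ = refl
finiteSimple .dec-enc pC₀ = refl
finiteSimple .dec-enc pC₁ = refl
finiteSimple .dec-enc pD = refl
finiteSimple .dec-enc pE = refl
finiteSimple .dec-enc pHalt = refl

finitePc : Finite Pc
finitePc = finiteVia f g gf (finite⊎ finiteSimple (finite⊎ finiteCont (finite× finiteCont finiteBool)))
  where
  f : Pc → Simple ⊎ (Cont ⊎ (Cont × Bool))
  f (pc s) = inj₁ s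
  f (inc c) = inj₂ (inj₁ c)
  f (ret c o) = inj₂ (inj₂ (c , o))
  g : Simple ⊎ (Cont ⊎ (Cont × Bool)) → Pc
  g (inj₁ s) = pc s
  g (inj₂ (inj₁ c)) = inc c
  g (inj₂ (inj₂ (c , o))) = ret c o
  gf : ∀ p → g (f p) ≡ p
  gf (pc s) = refl
  gf (inc c) = refl
  gf (ret c o) = refl

Cell : Set
Cell = Bool × Bool × Bool

get : Track → Cell → Bool
get tu (a , b , c) = a
get tv (a , b , c) = b
get tw (a , b , c) = c

put : Track → Bool → Cell → Cell
put tu d (a , b , c) = d , b , c
put tv d (a , b , c) = a , d , c
put tw d (a , b , c) = a , b , d

zeroCell : Cell
zeroCell = false , false , false

data Sym : Set where
  blank mark : Sym
  cell : Cell → Sym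

finiteCell : Finite Cell
finiteCell = finite× finiteBool (finite× finiteBool finiteBool)

encSym : Sym → Fin 10
encSym blank = zero
encSym mark = suc zero
encSym (cell c) = suc (suc (enc finiteCell c))

decSym : Fin 10 → Sym
decSym zero = blank
decSym (suc zero) = mark
decSym (suc (suc i)) = cell (dec finiteCell i)

decSym-encSym : ∀ s → decSym (encSym s) ≡ s
decSym-encSym blank = refl
decSym-encSym mark = refl
decSym-encSym (cell c) = cong cell (dec-enc finiteCell c)

State : Set
State = Pc × Bool × Bool

finState : Finite State
finState = finite× finitePc (finite× finiteBool finiteBool)

track : Cont → Track
track cScan = tv
track cClear = tv
track cA₁ = tu
track cA₂ = tv
track cA₃ = tv
track cA₄ = tu
track cB = tv
track cD = tw
track cE = tu

grows : Cont → Bool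
grows cScan = true
grows _ = false

isOne isSep : InSym → Bool
isOne i1 = true
isOne _ = false
isSep isep = true
isSep _ = false

data Act : Set where
  stay : Act
  writeR writeL : Sym → Act

Result : Set
Result = State × Act × Move × Maybe Bool

afterInc : Cont → Bool → Bool → Pc × Bool × Move × Maybe Bool
afterInc cScan _ acc = pc pS₀ , acc , S , nothing
afterInc cClear false acc = inc cClear , acc , S , nothing
afterInc cClear true acc = pc pA , acc , S , nothing
afterInc cA₁ false acc = inc cA₂ , acc , S , nothing
afterInc cA₁ true acc = inc cA₃ , acc , S , nothing
afterInc cA₂ _ acc = pc pA , acc , S , nothing
afterInc cA₃ false acc = inc cA₄ , acc , S , nothing
afterInc cA₃ true acc = pc pB₀ , acc , S , nothing
afterInc cA₄ _ acc = inc cA₃ , acc , S , nothing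
afterInc cB false acc = pc pB₁ , acc , S , nothing
afterInc cB true acc = pc pC₀ , acc , S , nothing
afterInc cD false acc = pc pD , acc , R , nothing
afterInc cD true acc = pc pD , false , R , just acc
afterInc cE false acc = pc pA , acc , S , nothing
afterInc cE true acc = pc pHalt , acc , S , nothing

incCell : Cont → Bool → Bool → Bool → Cell → Result
incCell c acc a true d = (inc c , acc , a) , writeR (cell (put (track c) false d)) , S , nothing
incCell c acc a false d = (ret c false , acc , a) , writeL (cell (put (track c) true d)) , S , nothing

scan : Pc → Bool → Bool → Bool → Result
scan nxt acc a true = (inc cClear , acc , a) , stay , S , nothing
scan nxt acc a false = (nxt , acc , a) , stay , R , nothing

seekEnd seekSep : Bool → Bool → Bool → Result
seekEnd acc a true = (inc cD , acc , a) , stay , S , nothing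
seekEnd acc a false = (pc pE , acc , a) , stay , L , nothing
seekSep acc a true = (inc cE , acc , a) , stay , S , nothing
seekSep acc a false = (pc pE , acc , a) , stay , L , nothing

transition : Pc → Bool → Bool → InSym → Sym → Result
transition (pc pInit) acc a i s = (pc pS₀ , acc , a) , writeR mark , S , nothing
transition (pc pS₀) acc a i s = scan (pc pS₁) acc a (isSep i)
transition (pc pS₁) acc a i s = scan (pc pS₂) acc a (isSep i)
transition (pc pS₂) acc a i s = scan (pc pS₃) acc a (isSep i)
transition (pc pS₃) acc a i s = scan (inc cScan) acc a (isSep i)
transition (pc pA) acc a i s = (inc cA₁ , acc , a) , stay , L , nothing
transition (pc pB₀) acc a i s = (pc pB₁ , acc , isOne i) , stay , S , nothing
transition (pc pB₁) acc a i s = (pc pB₂ , acc , a) , stay , L , nothing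
transition (pc pB₂) acc a i s = (inc cB , acc , a) , stay , L , nothing
transition (pc pC₀) acc a i s = (pc pC₁ , acc xor (a ∧ isOne i) , a) , stay , S , nothing
transition (pc pC₁) acc a i s = ((if isSep i then pc pD else pc pC₁) , acc , a) , stay , R , nothing
transition (pc pD) acc a i s = seekEnd acc a (isOne i)
transition (pc pE) acc a i s = seekSep acc a (isSep i)
transition (pc pHalt) acc a i s = (pc pHalt , acc , a) , stay , S , nothing
transition (inc c) acc a i blank =
  (ret c true , acc , a) , writeL (if grows c then cell zeroCell else blank) , S , nothing
transition (inc c) acc a i mark = (pc pHalt , acc , a) , stay , S , nothing
transition (inc c) acc a i (cell d) = incCell c acc a (get (track c) d) d
transition (ret c o) acc a i mark =
  let (p , acc′ , mi , ob) = afterInc c o acc in (p , acc′ , a) , writeR mark , mi , ob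
transition (ret c o) acc a i blank = (ret c o , acc , a) , writeL blank , S , nothing
transition (ret c o) acc a i (cell d) = (ret c o , acc , a) , writeL (cell d) , S , nothing

isHalt : Pc → Bool
isHalt (pc pHalt) = true
isHalt _ = false

-- Tapes as zippers, and the machine that they describe

written : Sym → Act → Sym
written s stay = s
written s (writeR t) = t
written s (writeL t) = t

workMove : Act → Move
workMove stay = S
workMove (writeR _) = R
workMove (writeL _) = L

hd : List Sym → Sym
hd [] = blank
hd (s ∷ _) = s

tl : List Sym → List Sym
tl [] = []
tl (_ ∷ r) = r

-- Writing a blank at the end keeps the list free of trailing blanks.
push : Sym → List Sym → List Sym
push blank [] = []
push s r = s ∷ r

actL actR : Act → List Sym → List Sym → List Sym
actL stay l r = l
actL (writeR s) l r = s ∷ l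
actL (writeL s) l r = tl l
actR stay l r = r
actR (writeR s) l r = tl r
actR (writeL s) [] r = push s (tl r)
actR (writeL s) (x ∷ l) r = x ∷ push s (tl r)

-- `aleft` holds the cells left of the head, nearest first, and its length is the head position.
-- `aright` begins with the scanned cell; the blanks beyond it are implicit.
record AConf : Set where
  constructor aconf
  field
    apc : Pc
    aacc areg : Bool
    aip : ℕ
    aleft aright : List Sym
    aout : List Bool
open AConf

applyResult : Result → ℕ → List Sym → List Sym → List Bool → AConf
applyResult ((p , acc , a) , act , mi , ob) ip l r o =
  aconf p acc a (move mi ip) (actL act l r) (actR act l r) (emit ob o)

astep : List InSym → AConf → AConf
astep w (aconf p acc a ip l r o) = applyResult (transition p acc a (readIn w ip) (hd r)) ip l r o

nth : List Sym → ℕ → Sym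
nth [] k = blank
nth (s ∷ r) zero = s
nth (s ∷ r) (suc k) = nth r k

unzip : List Sym → List Sym → List Sym
unzip [] r = r
unzip (x ∷ l) r = unzip l (x ∷ r)

nth-unzip : ∀ l r j → nth (unzip l r) (length l ℕ.+ j) ≡ nth r j
nth-unzip [] r j = refl
nth-unzip (x ∷ l) r j = trans (cong (nth (unzip l (x ∷ r))) (sym (ℕₚ.+-suc (length l) j))) (nth-unzip l (x ∷ r) (suc j))

nth-unzip-head : ∀ l r → nth (unzip l r) (length l) ≡ hd r
nth-unzip-head l r = trans (cong (nth (unzip l r)) (sym (ℕₚ.+-identityʳ _))) (trans (nth-unzip l r 0) (nth0 r))
  where
  nth0 : ∀ r → nth r 0 ≡ hd r
  nth0 [] = refl
  nth0 (x ∷ r) = refl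

nth-unzip-off : ∀ l r r′ i → (∀ j → j ≢ i → nth r j ≡ nth r′ j) →
  ∀ k → k ≢ length l ℕ.+ i → nth (unzip l r) k ≡ nth (unzip l r′) k
nth-unzip-off [] r r′ i e k ne = e k ne
nth-unzip-off (x ∷ l) r r′ i e k ne = nth-unzip-off l (x ∷ r) (x ∷ r′) (suc i) e′ k
    (λ q → ne (trans q (ℕₚ.+-suc (length l) i)))
  where
  e′ : ∀ j → j ≢ suc i → nth (x ∷ r) j ≡ nth (x ∷ r′) j
  e′ zero _ = refl
  e′ (suc j) q = e j (q ∘ cong suc)

nth-push : ∀ s r j → nth (push s r) j ≡ nth (s ∷ r) j
nth-push blank [] zero = refl
nth-push blank [] (suc j) = refl
nth-push blank (x ∷ r) j = refl
nth-push mark r j = refl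
nth-push (cell c) r j = refl

hd-push : ∀ s r → hd (push s r) ≡ s
hd-push blank [] = refl
hd-push blank (x ∷ r) = refl
hd-push mark r = refl
hd-push (cell c) r = refl

module _ (l r : List Sym) where
  rewritten : List Sym → Sym → Set
  rewritten t s = (nth t (length l) ≡ s) × (∀ k → k ≢ length l → nth t k ≡ nth (unzip l r) k)

  tail-off : ∀ s j → j ≢ 0 → nth (s ∷ tl r) j ≡ nth r j
  tail-off s zero ne = ⊥-elim (ne refl)
  tail-off s (suc j) ne = go r
    where
    go : ∀ r → nth (tl r) j ≡ nth r (suc j)
    go [] = refl
    go (_ ∷ _) = refl

  overwrite : ∀ s r′ → hd r′ ≡ s → (∀ j → nth r′ j ≡ nth (s ∷ tl r) j) → rewritten (unzip l r′) s
  overwrite s r′ h e = trans (nth-unzip-head l r′) h ,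
    λ k ne → nth-unzip-off l r′ r 0 (λ j q → trans (e j) (tail-off s j q)) k
      (λ q → ne (trans q (ℕₚ.+-identityʳ _)))

act-rewrites : ∀ act l r → rewritten l r (unzip (actL act l r) (actR act l r)) (written (hd r) act)
act-rewrites stay l r = nth-unzip-head l r , λ k _ → refl
act-rewrites (writeR s) l r = overwrite l r s (s ∷ tl r) refl (λ _ → refl)
act-rewrites (writeL s) [] r = overwrite [] r s (push s (tl r)) (hd-push s (tl r)) (nth-push s (tl r))
act-rewrites (writeL s) (x ∷ l) r = overwrite (x ∷ l) r s (push s (tl r)) (hd-push s (tl r)) (nth-push s (tl r))

length-act : ∀ act l r → length (actL act l r) ≡ move (workMove act) (length l)
length-act stay l r = refl
length-act (writeR s) l r = refl
length-act (writeL s) [] r = refl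
length-act (writeL s) (x ∷ l) r = refl

stepTM-run : ∀ M w q ip wk wp o {q′ s mi mw ob} → TM.halting M q ≡ false →
  TM.δ M q (readIn w ip) (wk wp) ≡ (q′ , s , mi , mw , ob) →
  stepTM M w (config q ip wk wp o) ≡
    config q′ (move mi ip) (λ k → if ⌊ k ℕ.≟ wp ⌋ then s else wk k) (move mw wp) (emit ob o)
stepTM-run M w q ip wk wp o h e rewrite h | e = refl

stepTM-halt : ∀ M w c → TM.halting M (Config.state c) ≡ true → stepTM M w c ≡ c
stepTM-halt M w (config q ip wk wp o) h rewrite h = refl

module Traces (w : List InSym) (B : ℕ) where

  infixr 4 _⟶*_
  -- Each step carries its own space bound, so no running time has to be computed, and the bound at
  -- all times can be read off a halting trace.
  data _⟶*_ : AConf → AConf → Set where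
    done : ∀ {c} → c ⟶* c
    next : ∀ {c c₁ c′} → length (aleft c) ≤ B → isHalt (apc c) ≡ false → astep w c ≡ c₁ → c₁ ⟶* c′ → c ⟶* c′

  infixr 5 _◅◅_
  _◅◅_ : ∀ {a b c} → a ⟶* b → b ⟶* c → a ⟶* c
  done ◅◅ q = q
  next x y z p ◅◅ q = next x y z (p ◅◅ q)

module Simulation (finiteState : Finite State) where

  encode : Sym → Result → Fin (size finiteState) × Fin 10 × Move × Move × Maybe Bool
  encode s (st , act , mi , ob) = enc finiteState st , encSym (written s act) , mi , workMove act , ob

  step′ : State → InSym → Sym → Fin (size finiteState) × Fin 10 × Move × Move × Maybe Bool
  step′ (p , acc , a) i s = encode s (transition p acc a i s)

  machine : TM
  machine = record
    { K = size finiteState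
    ; W = 9
    ; start = enc finiteState (pc pInit , false , false)
    ; halting = λ q → isHalt (proj₁ (dec finiteState q))
    ; δ = λ q i s → step′ (dec finiteState q) i (decSym s)
    }

  record Rep (c : Config machine) (ac : AConf) : Set where
    field
      r-state : Config.state c ≡ enc finiteState (apc ac , aacc ac , areg ac)
      r-ipos : Config.ipos c ≡ aip ac
      r-work : ∀ k → Config.work c k ≡ encSym (nth (unzip (aleft ac) (aright ac)) k)
      r-wpos : Config.wpos c ≡ length (aleft ac)
      r-out : Config.out c ≡ aout ac
  open Rep

  initial-Rep : Rep (initConfig machine) (aconf (pc pInit) false false 0 [] [] [])
  initial-Rep = record { r-state = refl ; r-ipos = refl ; r-work = λ k → refl ; r-wpos = refl ; r-out = refl }

  step-Rep : ∀ w c ac → Rep c ac → isHalt (apc ac) ≡ false → Rep (stepTM machine w c) (astep w ac)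
  step-Rep w (config q ip wk wp o) (aconf p acc a .ip l r .o) rep@record { r-state = refl ; r-ipos = refl ; r-wpos = refl ; r-out = refl } nh =
    subst (λ c → Rep c (astep w (aconf p acc a ip l r o))) (sym (stepTM-run machine w q ip wk wp o halting≡ δ≡)) record
      { r-state = refl
      ; r-ipos = refl
      ; r-work = work≡
      ; r-wpos = sym (length-act act l r)
      ; r-out = refl
      }
    where
    st : State
    st = p , acc , a
    res : Result
    res = transition p acc a (readIn w ip) (hd r)
    act : Act
    act = proj₁ (proj₂ res)
    halting≡ : isHalt (proj₁ (dec finiteState (enc finiteState st))) ≡ false
    halting≡ = trans (cong (isHalt ∘ proj₁) (dec-enc finiteState st)) nh
    sym≡ : decSym (wk wp) ≡ hd r
    sym≡ = trans (cong decSym (trans (r-work rep (length l)) (cong encSym (nth-unzip-head l r)))) (decSym-encSym (hd r))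
    δ≡ : step′ (dec finiteState (enc finiteState st)) (readIn w ip) (decSym (wk wp)) ≡ encode (hd r) res
    δ≡ = cong₂ (λ s t → step′ s (readIn w ip) t) (dec-enc finiteState st) sym≡
    work≡ : ∀ k → (if ⌊ k ℕ.≟ length l ⌋ then encSym (written (hd r) act) else wk k) ≡
      encSym (nth (unzip (actL act l r) (actR act l r)) k)
    work≡ k with k ℕ.≟ length l
    ... | yes refl = cong encSym (sym (proj₁ (act-rewrites act l r)))
    ... | no ne = trans (r-work rep k) (cong encSym (sym (proj₂ (act-rewrites act l r) k ne)))

  module _ (w : List InSym) (B : ℕ) where
    open Traces w B

    -- Steps are peeled off at the front, as in a trace, whereas `runTM` adds them at the end.
    run^ : ℕ → Config machine → Config machine
    run^ zero c = c
    run^ (suc t) c = run^ t (stepTM machine w c)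

    HaltsFrom : Config machine → List Bool → Set
    HaltsFrom c o = Σ ℕ λ t → (TM.halting machine (Config.state (run^ t c)) ≡ true)
        × (Config.out (run^ t c) ≡ o) × (∀ t → Config.wpos (run^ t c) ≤ B)

    trace-halts : ∀ {c ac ac′} → Rep c ac → ac ⟶* ac′ → isHalt (apc ac′) ≡ true → length (aleft ac′) ≤ B →
      HaltsFrom c (aout ac′)
    trace-halts {c} {ac} rep done h b = 0 , halted , r-out rep , λ t → subst (_≤ B) (sym (stays t)) (ℕₚ.≤-trans (ℕₚ.≤-reflexive (r-wpos rep)) b)
      where
      halted : TM.halting machine (Config.state c) ≡ true
      halted = trans (cong (TM.halting machine) (r-state rep))
        (trans (cong (isHalt ∘ proj₁) (dec-enc finiteState (apc ac , aacc ac , areg ac))) h)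
      stays : ∀ t → Config.wpos (run^ t c) ≡ Config.wpos c
      stays zero = refl
      stays (suc t) = trans (cong (λ c → Config.wpos (run^ t c)) (stepTM-halt machine w c halted)) (stays t)
    trace-halts {c} {ac} rep (next b₀ nh refl p) h b =
      let (t , h′ , o′ , b′) = trace-halts (step-Rep w c ac rep nh) p h b
      in suc t , h′ , o′ , λ { zero → ℕₚ.≤-trans (ℕₚ.≤-reflexive (r-wpos rep)) b₀ ; (suc t) → b′ t }

-- Binary counters on three tracks

bit : Bool → ℕ
bit true = 1
bit false = 0

val : Track → List Cell → ℕ
val t [] = 0
val t (d ∷ cs) = bit (get t d) ℕ.+ 2 ℕ.* val t cs

incAt : Track → Bool → Cell → List Cell → List Cell × Bool → List Cell × Bool
incAt t true d cs (cs′ , o) = put t false d ∷ cs′ , o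
incAt t false d cs _ = put t true d ∷ cs , false

incList : Bool → Track → List Cell → List Cell × Bool
incList g t [] = (if g then zeroCell ∷ [] else []) , true
incList g t (d ∷ cs) = incAt t (get t d) d cs (incList g t cs)

get-put : ∀ t b d → get t (put t b d) ≡ b
get-put tu b d = refl
get-put tv b d = refl
get-put tw b d = refl

get-put-other : ∀ t t′ b d → t′ ≢ t → get t′ (put t b d) ≡ get t′ d
get-put-other tu tu b d ne = ⊥-elim (ne refl)
get-put-other tu tv b d ne = refl
get-put-other tu tw b d ne = refl
get-put-other tv tu b d ne = refl
get-put-other tv tv b d ne = ⊥-elim (ne refl)
get-put-other tv tw b d ne = refl
get-put-other tw tu b d ne = refl
get-put-other tw tv b d ne = refl
get-put-other tw tw b d ne = ⊥-elim (ne refl)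

record IncSpec (g : Bool) (t : Track) (cs : List Cell) (r : List Cell × Bool) : Set where
  field
    len : length (proj₁ r) ≡ bit (g ∧ proj₂ r) ℕ.+ length cs
    others : ∀ t′ → t′ ≢ t → val t′ (proj₁ r) ≡ val t′ cs
    carryless : proj₂ r ≡ false → val t (proj₁ r) ≡ suc (val t cs)
    overflow : proj₂ r ≡ true → (val t (proj₁ r) ≡ 0) × (suc (val t cs) ≡ 2 ℕ.^ length cs)

incList-spec : ∀ g t cs → IncSpec g t cs (incList g t cs)
incList-spec true t [] = record { len = refl ; others = λ { tu _ → refl ; tv _ → refl ; tw _ → refl } ; carryless = λ () ; overflow = λ _ → zeros t , refl }
  where
  zeros : ∀ t → val t (zeroCell ∷ []) ≡ 0
  zeros tu = refl
  zeros tv = refl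
  zeros tw = refl
incList-spec false t [] = record { len = refl ; others = λ _ _ → refl ; carryless = λ () ; overflow = λ _ → refl , refl }
incList-spec g t (d ∷ cs) = digit (get t d) refl
  where
  ih = incList-spec g t cs
  r = incList g t cs
  digit : ∀ b → get t d ≡ b → IncSpec g t (d ∷ cs) (incAt t b d cs r)
  digit false e = record
    { len = cong (λ b → bit b ℕ.+ suc (length cs)) (sym (Boolₚ.∧-zeroʳ g))
    ; others = λ t′ ne → cong (λ b → bit b ℕ.+ 2 ℕ.* val t′ cs) (get-put-other t t′ true d ne)
    ; carryless = λ _ → trans (cong (λ b → bit b ℕ.+ 2 ℕ.* val t cs) (get-put t true d))
                              (cong (λ b → suc (bit b ℕ.+ 2 ℕ.* val t cs)) (sym e))
    ; overflow = λ ()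
    }
  digit true e = record
    { len = trans (cong suc (IncSpec.len ih)) (sym (ℕₚ.+-suc (bit (g ∧ proj₂ r)) (length cs)))
    ; others = λ t′ ne → cong₂ (λ b v → bit b ℕ.+ 2 ℕ.* v) (get-put-other t t′ false d ne) (IncSpec.others ih t′ ne)
    ; carryless = λ o → trans (cong₂ (λ b v → bit b ℕ.+ 2 ℕ.* v) (get-put t false d) (IncSpec.carryless ih o))
        (trans (carry (val t cs)) (cong (λ b → suc (bit b ℕ.+ 2 ℕ.* val t cs)) (sym e)))
    ; overflow = λ o → let (z , f) = IncSpec.overflow ih o in
        cong₂ (λ b v → bit b ℕ.+ 2 ℕ.* v) (get-put t false d) z ,
        trans (cong (λ b → suc (bit b ℕ.+ 2 ℕ.* val t cs)) e) (trans (sym (carry (val t cs))) (cong (2 ℕ.*_) f))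
    }
    where
    carry : ∀ v → 2 ℕ.* (1 ℕ.+ v) ≡ 2 ℕ.+ 2 ℕ.* v
    carry = ℕR.solve-∀

val<2^length : ∀ t cs → val t cs < 2 ℕ.^ length cs
val<2^length t [] = s≤s z≤n
val<2^length t (d ∷ cs) = begin-strict
  bit (get t d) ℕ.+ 2 ℕ.* val t cs <⟨ ℕₚ.+-monoˡ-< (2 ℕ.* val t cs) (bit<2 (get t d)) ⟩
  2 ℕ.+ 2 ℕ.* val t cs ≡⟨ ℕₚ.*-suc 2 (val t cs) ⟨
  2 ℕ.* suc (val t cs) ≤⟨ ℕₚ.*-monoʳ-≤ 2 (val<2^length t cs) ⟩
  2 ℕ.* 2 ℕ.^ length cs ∎
  where
  open ℕₚ.≤-Reasoning
  bit<2 : ∀ b → bit b < 2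
  bit<2 true = s≤s (s≤s z≤n)
  bit<2 false = s≤s z≤n

no-carry : ∀ g t cs → suc (val t cs) < 2 ℕ.^ length cs → proj₂ (incList g t cs) ≡ false
no-carry g t cs lt = Boolₚ.¬-not λ o → ℕₚ.<-irrefl (proj₂ (IncSpec.overflow (incList-spec g t cs) o)) lt

-- Without overflow, `length cs` binary digits would have to hold the value 2 to the power
-- `length cs`.
full-carry : ∀ g t cs → suc (val t cs) ≡ 2 ℕ.^ length cs → proj₂ (incList g t cs) ≡ true
full-carry g t cs e = Boolₚ.¬-not λ o → ℕₚ.<-irrefl
    (trans (IncSpec.carryless sp o) (trans e (cong (2 ℕ.^_) (sym (len≡ o)))))
    (val<2^length t (proj₁ (incList g t cs)))
  where
  sp = incList-spec g t cs
  len≡ : proj₂ (incList g t cs) ≡ false → length (proj₁ (incList g t cs)) ≡ length cs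
  len≡ o = trans (IncSpec.len sp) (cong (λ b → bit b ℕ.+ length cs) (trans (cong (g ∧_) o) (Boolₚ.∧-zeroʳ g)))

V : Set
V = ℕ × ℕ × ℕ

sel : Track → V → ℕ
sel tu (u , v , w) = u
sel tv (u , v , w) = v
sel tw (u , v , w) = w

upd : Track → ℕ → V → V
upd tu z (u , v , w) = z , v , w
upd tv z (u , v , w) = u , z , w
upd tw z (u , v , w) = u , v , z

sel-upd : ∀ t z ν t′ → (t′ ≡ t × sel t′ (upd t z ν) ≡ z) ⊎ (t′ ≢ t × sel t′ (upd t z ν) ≡ sel t′ ν)
sel-upd tu z ν tu = inj₁ (refl , refl)
sel-upd tu z ν tv = inj₂ ((λ ()) , refl)
sel-upd tu z ν tw = inj₂ ((λ ()) , refl)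
sel-upd tv z ν tu = inj₂ ((λ ()) , refl)
sel-upd tv z ν tv = inj₁ (refl , refl)
sel-upd tv z ν tw = inj₂ ((λ ()) , refl)
sel-upd tw z ν tu = inj₂ ((λ ()) , refl)
sel-upd tw z ν tv = inj₂ ((λ ()) , refl)
sel-upd tw z ν tw = inj₁ (refl , refl)

Tape : ℕ → V → List Cell → Set
Tape k ν cs = (length cs ≡ k) × (∀ t → val t cs ≡ sel t ν)

syms : List Cell → List Sym
syms = map cell

stack : List Cell → List Sym
stack [] = mark ∷ []
stack (c ∷ pre) = cell c ∷ stack pre

length-stack : ∀ pre → length (stack pre) ≡ suc (length pre)
length-stack [] = refl
length-stack (c ∷ pre) = cong suc (length-stack pre)

actR-stack : ∀ s pre r → actR (writeL s) (stack pre) r ≡ hd (stack pre) ∷ push s (tl r)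
actR-stack s [] r = refl
actR-stack s (c ∷ pre) r = refl

push-grow : ∀ g → push (if g then cell zeroCell else blank) [] ≡ syms (if g then zeroCell ∷ [] else [])
push-grow true = refl
push-grow false = refl

-- Runs between visits to the mark

record HState : Set where
  constructor ⟪_,_,_,_,_,_,_⟫
  field
    hpc : Pc
    hacc hreg : Bool
    hip : ℕ
    hout : List Bool
    hk : ℕ
    hν : V

conf : HState → List Cell → AConf
conf ⟪ p , acc , a , ip , out , k , ν ⟫ cs = aconf p acc a ip (mark ∷ []) (syms cs) out

afterH : Cont → Bool → Bool → Bool → ℕ → List Bool → ℕ → V → HState
afterH c o acc a ip out k ν =
  let (p , acc′ , mi , ob) = afterInc c o acc in ⟪ p , acc′ , a , move mi ip , emit ob out , k , ν ⟫

module Macro (W : List InSym) (B : ℕ) (1≤B : 1 ≤ B) where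
  open Traces W B

  ret-run : ∀ c o acc a ip out pre cs → length pre ≤ B →
    aconf (ret c o) acc a ip (tl (stack pre)) (hd (stack pre) ∷ syms cs) out ⟶*
    aconf (ret c o) acc a ip [] (mark ∷ syms (pre ʳ++ cs)) out
  ret-run c o acc a ip out [] cs b = done
  ret-run c o acc a ip out (p ∷ pre) cs b =
    next (ℕₚ.≤-trans (ℕₚ.≤-reflexive (length-stack pre)) b) refl
      (cong (λ r → aconf (ret c o) acc a ip (tl (stack pre)) r out) (actR-stack (cell p) pre (cell p ∷ syms cs)))
      (ret-run c o acc a ip out pre (p ∷ cs) (ℕₚ.≤-trans (ℕₚ.n≤1+n _) b))

  -- `pre` holds the cells already passed by the carry, nearest first; `ret-run` puts them back on
  -- the way to the mark.
  inc-run : ∀ c acc a ip out pre cs → suc (length pre ℕ.+ length cs) ≤ B →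
    let (cs′ , o) = incList (grows c) (track c) cs in
    aconf (inc c) acc a ip (stack pre) (syms cs) out ⟶*
    aconf (ret c o) acc a ip [] (mark ∷ syms (pre ʳ++ cs′)) out
  inc-run c acc a ip out pre [] b =
    next (ℕₚ.≤-trans (ℕₚ.≤-reflexive (length-stack pre)) b′) refl
      (cong (λ r → aconf (ret c true) acc a ip (tl (stack pre)) r out)
        (trans (actR-stack (if grows c then cell zeroCell else blank) pre []) (cong (hd (stack pre) ∷_) (push-grow (grows c)))))
      (ret-run c true acc a ip out pre _ (ℕₚ.≤-trans (ℕₚ.n≤1+n _) b′))
    where
    b′ : suc (length pre) ≤ B
    b′ = ℕₚ.≤-trans (s≤s (ℕₚ.m≤m+n (length pre) 0)) b
  inc-run c acc a ip out pre (d ∷ cs) b = digit (get (track c) d) refl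
    where
    pre≤ : suc (length pre) ≤ B
    pre≤ = ℕₚ.≤-trans (s≤s (ℕₚ.m≤m+n (length pre) _)) b
    r = incList (grows c) (track c) cs
    digit : ∀ b → get (track c) d ≡ b →
      let (cs′ , o) = incAt (track c) b d cs r in
      aconf (inc c) acc a ip (stack pre) (cell d ∷ syms cs) out ⟶* aconf (ret c o) acc a ip [] (mark ∷ syms (pre ʳ++ cs′)) out
    digit true e = next (ℕₚ.≤-trans (ℕₚ.≤-reflexive (length-stack pre)) pre≤) refl
      (cong (λ b → applyResult (incCell c acc a b d) ip (stack pre) (cell d ∷ syms cs) out) e)
      (inc-run c acc a ip out (put (track c) false d ∷ pre) cs
        (ℕₚ.≤-trans (s≤s (ℕₚ.≤-reflexive (sym (ℕₚ.+-suc (length pre) (length cs))))) b))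
    digit false e = next (ℕₚ.≤-trans (ℕₚ.≤-reflexive (length-stack pre)) pre≤) refl
      (trans (cong (λ b → applyResult (incCell c acc a b d) ip (stack pre) (cell d ∷ syms cs) out) e)
        (cong (λ r → aconf (ret c false) acc a ip (tl (stack pre)) r out)
          (actR-stack (cell (put (track c) true d)) pre (cell d ∷ syms cs))))
      (ret-run c false acc a ip out pre (put (track c) true d ∷ cs) (ℕₚ.≤-trans (ℕₚ.n≤1+n _) pre≤))

  inc-full : ∀ c acc a ip out k ν cs → suc (length cs) ≤ B →
    let (cs′ , o) = incList (grows c) (track c) cs in
    conf ⟪ inc c , acc , a , ip , out , k , ν ⟫ cs ⟶* conf (afterH c o acc a ip out k ν) cs′
  inc-full c acc a ip out k ν cs b =
    inc-run c acc a ip out [] cs b ◅◅ next z≤n refl refl done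

  infix 3 _⇒_
  -- The head stands just right of the mark at both ends. The cells are quantified away: from any
  -- tape with the given width and values some tape with the new ones is reached, so phases compose
  -- on numbers alone.
  _⇒_ : HState → HState → Set
  s ⇒ s′ = ∀ cs → Tape (HState.hk s) (HState.hν s) cs →
    Σ (List Cell) λ cs′ → Tape (HState.hk s′) (HState.hν s′) cs′ × (conf s cs ⟶* conf s′ cs′)

  ⇒-refl : ∀ {s} → s ⇒ s
  ⇒-refl cs τ = cs , τ , done

  infixr 5 _⨾_
  _⨾_ : ∀ {a b c} → a ⇒ b → b ⇒ c → a ⇒ c
  (p ⨾ q) cs τ with p cs τ
  ... | cs₁ , τ₁ , p₁ with q cs₁ τ₁
  ...   | cs₂ , τ₂ , p₂ = cs₂ , τ₂ , (p₁ ◅◅ p₂)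

  simple : ∀ {p acc a ip out p′ acc′ a′ ip′ out′ k ν} → isHalt p ≡ false →
    (∀ cs → astep W (conf ⟪ p , acc , a , ip , out , k , ν ⟫ cs) ≡ conf ⟪ p′ , acc′ , a′ , ip′ , out′ , k , ν ⟫ cs) →
    ⟪ p , acc , a , ip , out , k , ν ⟫ ⇒ ⟪ p′ , acc′ , a′ , ip′ , out′ , k , ν ⟫
  simple nh e cs τ = cs , τ , next 1≤B nh (e cs) done

  updated : ∀ g t k ν cs z k′ → Tape k ν cs → val t (proj₁ (incList g t cs)) ≡ z →
    length (proj₁ (incList g t cs)) ≡ k′ → Tape k′ (upd t z ν) (proj₁ (incList g t cs))
  updated g t k ν cs z k′ (l , τ) vz l′ = l′ , go
    where
    go : ∀ t′ → val t′ (proj₁ (incList g t cs)) ≡ sel t′ (upd t z ν)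
    go t′ with sel-upd t z ν t′
    ... | inj₁ (refl , e) = trans vz (sym e)
    ... | inj₂ (ne , e) = trans (IncSpec.others (incList-spec g t cs) t′ ne) (trans (τ t′) (sym e))

  inc-no : ∀ c {acc a ip out k ν} → suc (sel (track c) ν) < 2 ℕ.^ k → suc k ≤ B →
    ⟪ inc c , acc , a , ip , out , k , ν ⟫ ⇒ afterH c false acc a ip out k (upd (track c) (suc (sel (track c) ν)) ν)
  inc-no c {acc} {a} {ip} {out} {k} {ν} lt b cs (refl , τ) =
    proj₁ r , updated (grows c) t k ν cs _ k (refl , τ) (trans (IncSpec.carryless sp o≡) (cong suc (τ t)))
        (trans (IncSpec.len sp) (cong (λ b → bit b ℕ.+ k) (trans (cong (grows c ∧_) o≡) (Boolₚ.∧-zeroʳ (grows c))))) ,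
      subst (λ o → conf ⟪ inc c , acc , a , ip , out , k , ν ⟫ cs ⟶* conf (afterH c o acc a ip out k ν) (proj₁ r)) o≡
        (inc-full c acc a ip out k ν cs b)
    where
    t = track c
    r = incList (grows c) t cs
    sp = incList-spec (grows c) t cs
    o≡ : proj₂ r ≡ false
    o≡ = no-carry (grows c) t cs (subst (λ v → suc v < 2 ℕ.^ k) (sym (τ t)) lt)

  inc-ov : ∀ c {acc a ip out k ν} → suc (sel (track c) ν) ≡ 2 ℕ.^ k → suc k ≤ B →
    ⟪ inc c , acc , a , ip , out , k , ν ⟫ ⇒ afterH c true acc a ip out (bit (grows c) ℕ.+ k) (upd (track c) 0 ν)
  inc-ov c {acc} {a} {ip} {out} {k} {ν} e b cs (refl , τ) =
    proj₁ r , updated (grows c) t k ν cs 0 _ (refl , τ) (proj₁ (IncSpec.overflow sp o≡))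
        (trans (IncSpec.len sp) (cong (λ b → bit b ℕ.+ k) (trans (cong (grows c ∧_) o≡) (Boolₚ.∧-identityʳ (grows c))))) ,
      subst (λ o → conf ⟪ inc c , acc , a , ip , out , k , ν ⟫ cs ⟶* conf (afterH c o acc a ip out k ν) (proj₁ r)) o≡
        (inc-full c acc a ip out k ν cs b)
    where
    t = track c
    r = incList (grows c) t cs
    sp = incList-spec (grows c) t cs
    o≡ : proj₂ r ≡ true
    o≡ = full-carry (grows c) t cs (trans (cong suc (τ t)) e)

-- Input positions and the main loop

readIn-bits : ∀ n (x : Bits n) r p → p < n → readIn (map bitSym (bitsToList n x) ++ r) p ≡ bitSym (at x p)
readIn-bits (suc n) x r zero _ = refl
readIn-bits (suc n) x r (suc p) (s≤s q) = readIn-bits n (x ∘ suc) r p q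

readIn-after : ∀ n (x : Bits n) r i → readIn (map bitSym (bitsToList n x) ++ r) (n ℕ.+ i) ≡ readIn r i
readIn-after zero x r i = refl
readIn-after (suc n) x r i = readIn-after n (x ∘ suc) r i

readIn-ones : ∀ m i → i < m → readIn (replicate m i1) i ≡ i1
readIn-ones (suc m) zero _ = refl
readIn-ones (suc m) (suc i) (s≤s q) = readIn-ones m i q

readIn-end : ∀ m → readIn (replicate m i1) m ≡ iblank
readIn-end zero = refl
readIn-end (suc m) = readIn-end m

move-L : ∀ p → move L p ≡ p ∸ 1
move-L zero = refl
move-L (suc p) = refl

xorSum-stable : ∀ F a d → (∀ u → a ≤ u → F u ≡ false) → xorSum F (d ℕ.+ a) ≡ xorSum F a
xorSum-stable F a zero e = refl
xorSum-stable F a (suc d) e = trans (cong₂ _xor_ (xorSum-stable F a d e) (e (d ℕ.+ a) (ℕₚ.m≤n+m a d))) (Boolₚ.xor-identityʳ _)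

xorSum-false : ∀ F a → (∀ u → u < a → F u ≡ false) → xorSum F a ≡ false
xorSum-false F zero e = refl
xorSum-false F (suc a) e = cong₂ _xor_ (xorSum-false F a λ u q → e u (ℕₚ.m≤n⇒m≤1+n q)) (e a ℕₚ.≤-refl)

module Loops (n m : ℕ) (x : Bits n) (k B : ℕ) (k<B : suc k ≤ B) where

  W : List InSym
  W = encodeInput n m x

  1≤B : 1 ≤ B
  1≤B = ℕₚ.≤-trans (s≤s z≤n) k<B

  open Traces W B
  open Macro W B 1≤B

  U : ℕ
  U = 2 ℕ.^ k

  inside : ∀ p → p < n → readIn W p ≡ bitSym (at x p)
  inside p q = readIn-bits n x (isep ∷ replicate m i1) p q

  separator : readIn W n ≡ isep
  separator = trans (cong (readIn W) (sym (ℕₚ.+-identityʳ n))) (readIn-after n x (isep ∷ replicate m i1) 0)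

  after : ∀ i → readIn W (suc n ℕ.+ i) ≡ readIn (replicate m i1) i
  after i = trans (cong (readIn W) (sym (ℕₚ.+-suc n i))) (readIn-after n x (isep ∷ replicate m i1) (suc i))

  isSep-bitSym : ∀ b → isSep (bitSym b) ≡ false
  isSep-bitSym true = refl
  isSep-bitSym false = refl

  isOne-bitSym : ∀ b → isOne (bitSym b) ≡ b
  isOne-bitSym true = refl
  isOne-bitSym false = refl

  isSep-inside : ∀ p → p < n → isSep (readIn W p) ≡ false
  isSep-inside p q = trans (cong isSep (inside p q)) (isSep-bitSym (at x p))

  isOne-upto : ∀ p → p ≤ n → isOne (readIn W p) ≡ at x p
  isOne-upto p q with p ℕ.<? n
  ... | yes lt = trans (cong isOne (inside p lt)) (isOne-bitSym (at x p))
  ... | no nlt with ℕₚ.≤-antisym q (ℕₚ.≮⇒≥ nlt)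
  ...   | refl = trans (cong isOne separator) (sym (at-≥ x n ℕₚ.≤-refl))

  suc≤ : ∀ {a b c} → a ℕ.+ suc b ≡ c → suc a ≤ c
  suc≤ {a} {b} e = ℕₚ.≤-trans (ℕₚ.≤-trans (ℕₚ.m≤m+n (suc a) b) (ℕₚ.≤-reflexive (sym (ℕₚ.+-suc a b)))) (ℕₚ.≤-reflexive e)

  shift-suc : ∀ {a b c} → a ℕ.+ suc b ≡ c → suc a ℕ.+ b ≡ c
  shift-suc {a} {b} e = trans (sym (ℕₚ.+-suc a b)) e

  last : ∀ {a c} → a ℕ.+ 1 ≡ c → suc a ≡ c
  last {a} e = trans (ℕₚ.+-comm 1 a) e

  clear : ∀ j {acc a ip out u v w} → v ℕ.+ suc j ≡ U →
    ⟪ inc cClear , acc , a , ip , out , k , (u , v , w) ⟫ ⇒ ⟪ pc pA , acc , a , ip , out , k , (u , 0 , w) ⟫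
  clear zero e = inc-ov cClear (last e) k<B
  clear (suc j) e = inc-no cClear (suc≤ (shift-suc e)) k<B ⨾ clear j (shift-suc e)

  -- The round in which `u` wraps exits before `v` is incremented: starting from v = 0, the head
  -- moves U - u cells while `v` ends at U - 1 - u.
  phaseA : ∀ j {acc a ip out u v w} → u ℕ.+ suc j ≡ U → v ℕ.+ j < U →
    ⟪ pc pA , acc , a , ip , out , k , (u , v , w) ⟫ ⇒ ⟪ inc cA₃ , acc , a , ip ∸ suc j , out , k , (0 , v ℕ.+ j , w) ⟫
  phaseA zero {acc} {a} {ip} {out} {u} {v} {w} e lt =
    subst₂ (λ p v′ → ⟪ pc pA , acc , a , ip , out , k , (u , v , w) ⟫ ⇒ ⟪ inc cA₃ , acc , a , p , out , k , (0 , v′ , w) ⟫)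
      (move-L ip) (sym (ℕₚ.+-identityʳ v))
      (simple refl (λ cs → refl) ⨾ inc-ov cA₁ (last e) k<B)
  phaseA (suc j) {acc} {a} {ip} {out} {u} {v} {w} e lt =
    subst₂ (λ p v′ → ⟪ pc pA , acc , a , ip , out , k , (u , v , w) ⟫ ⇒ ⟪ inc cA₃ , acc , a , p , out , k , (0 , v′ , w) ⟫)
      (trans (cong (_∸ suc j) (move-L ip)) (ℕₚ.∸-+-assoc ip 1 (suc j))) (sym (ℕₚ.+-suc v j))
      (simple refl (λ cs → refl) ⨾ inc-no cA₁ (suc≤ (shift-suc e)) k<B
        ⨾ inc-no cA₂ (ℕₚ.≤-<-trans (ℕₚ.≤-trans (ℕₚ.m≤m+n (suc v) j) (ℕₚ.≤-reflexive (sym (ℕₚ.+-suc v j)))) lt) k<B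
        ⨾ phaseA j (shift-suc e) (subst (_< U) (ℕₚ.+-suc v j) lt))

  -- Here the round in which `v` wraps does not increment `u`. The two omissions compensate, and `u`
  -- returns to its old value exactly.
  phaseA′ : ∀ j {acc a ip out u v w} → v ℕ.+ suc j ≡ U → u ℕ.+ j < U →
    ⟪ inc cA₃ , acc , a , ip , out , k , (u , v , w) ⟫ ⇒ ⟪ pc pB₀ , acc , a , ip , out , k , (u ℕ.+ j , 0 , w) ⟫
  phaseA′ zero {acc} {a} {ip} {out} {u} {v} {w} e lt =
    subst (λ u′ → ⟪ inc cA₃ , acc , a , ip , out , k , (u , v , w) ⟫ ⇒ ⟪ pc pB₀ , acc , a , ip , out , k , (u′ , 0 , w) ⟫)
      (sym (ℕₚ.+-identityʳ u)) (inc-ov cA₃ (last e) k<B)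
  phaseA′ (suc j) {acc} {a} {ip} {out} {u} {v} {w} e lt =
    subst (λ u′ → ⟪ inc cA₃ , acc , a , ip , out , k , (u , v , w) ⟫ ⇒ ⟪ pc pB₀ , acc , a , ip , out , k , (u′ , 0 , w) ⟫)
      (sym (ℕₚ.+-suc u j))
      (inc-no cA₃ (suc≤ (shift-suc e)) k<B
        ⨾ inc-no cA₄ (ℕₚ.≤-<-trans (ℕₚ.≤-trans (ℕₚ.m≤m+n (suc u) j) (ℕₚ.≤-reflexive (sym (ℕₚ.+-suc u j)))) lt) k<B
        ⨾ phaseA′ j (shift-suc e) (subst (_< U) (ℕₚ.+-suc u j) lt))

  phaseB : ∀ j {acc a ip out u v w} → v ℕ.+ suc j ≡ U →
    ⟪ pc pB₁ , acc , a , ip , out , k , (u , v , w) ⟫ ⇒ ⟪ pc pC₀ , acc , a , ip ∸ 2 ℕ.* suc j , out , k , (u , 0 , w) ⟫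
  phaseB j {acc} {a} {ip} {out} {u} {v} {w} e = go j e
    where
    two : move L (move L ip) ≡ ip ∸ 2
    two = trans (move-L (move L ip)) (trans (cong (_∸ 1) (move-L ip)) (ℕₚ.∸-+-assoc ip 1 1))
    Goal : ℕ → Set
    Goal p = ⟪ pc pB₁ , acc , a , ip , out , k , (u , v , w) ⟫ ⇒ ⟪ pc pC₀ , acc , a , p , out , k , (u , 0 , w) ⟫
    go : ∀ j → v ℕ.+ suc j ≡ U → Goal (ip ∸ 2 ℕ.* suc j)
    go zero e = subst Goal two (simple refl (λ cs → refl) ⨾ simple refl (λ cs → refl) ⨾ inc-ov cB (last e) k<B)
    go (suc j) e = subst Goal
      (trans (cong (_∸ 2 ℕ.* suc j) two) (trans (ℕₚ.∸-+-assoc ip 2 (2 ℕ.* suc j)) (cong (ip ∸_) (sym (ℕₚ.*-suc 2 (suc j))))))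
      (simple refl (λ cs → refl) ⨾ simple refl (λ cs → refl) ⨾ inc-no cB (suc≤ (shift-suc e)) k<B ⨾ phaseB j (shift-suc e))

  phaseC : ∀ j {acc a ip out ν} → ip ℕ.+ j ≡ n →
    ⟪ pc pC₁ , acc , a , ip , out , k , ν ⟫ ⇒ ⟪ pc pD , acc , a , suc n , out , k , ν ⟫
  phaseC zero {acc} {a} {ip} {out} {ν} e =
    subst (λ p → ⟪ pc pC₁ , acc , a , p , out , k , ν ⟫ ⇒ ⟪ pc pD , acc , a , suc n , out , k , ν ⟫)
      (trans (sym e) (ℕₚ.+-identityʳ ip))
      (simple refl λ cs → cong (λ b → aconf (if b then pc pD else pc pC₁) acc a (suc n) (mark ∷ []) (syms cs) out) (cong isSep separator))
  phaseC (suc j) {acc} {a} {ip} {out} e =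
    simple refl (λ cs → cong (λ b → aconf (if b then pc pD else pc pC₁) acc a (suc ip) (mark ∷ []) (syms cs) out) (isSep-inside ip (suc≤ e)))
      ⨾ phaseC j (shift-suc e)

  phaseE : ∀ i {acc a out ν} → i ≤ m →
    ⟪ pc pE , acc , a , n ℕ.+ i , out , k , ν ⟫ ⇒ ⟪ inc cE , acc , a , n , out , k , ν ⟫
  phaseE zero {acc} {a} {out} {ν} _ =
    subst (λ p → ⟪ pc pE , acc , a , p , out , k , ν ⟫ ⇒ ⟪ inc cE , acc , a , n , out , k , ν ⟫) (sym (ℕₚ.+-identityʳ n))
      (simple refl λ cs → cong (λ s → applyResult (seekSep acc a s) n (mark ∷ []) (syms cs) out)
        (cong isSep separator))
  phaseE (suc i) {acc} {a} {out} {ν} q =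
    subst (λ p → ⟪ pc pE , acc , a , p , out , k , ν ⟫ ⇒ ⟪ inc cE , acc , a , n , out , k , ν ⟫) (sym (ℕₚ.+-suc n i))
      (simple refl (λ cs → cong (λ s → applyResult (seekSep acc a s) (suc n ℕ.+ i) (mark ∷ []) (syms cs) out)
          (cong isSep (trans (after i) (readIn-ones m i q))))
        ⨾ phaseE i (ℕₚ.≤-trans (ℕₚ.n≤1+n i) q))

  partialBit : ℕ → ℕ → Bool
  partialBit e u = xorSum (summand U m x e) u

  outs : ℕ → List Bool
  outs zero = []
  outs (suc e) = outs e ++ extract U m x e ∷ []

  summand-off : ∀ e u → ¬ (inSeg U m e u ≡ true) → summand U m x e u ≡ false
  summand-off e u ne = cong (_∧ (at x (rightPos n U u) ∧ at x (leftPos n U u))) (Boolₚ.¬-not ne)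

  -- All positions beyond `u` belong to later segments, so bit `e` receives no further summand.
  bit-complete : ∀ e u → u < U → suc e ℕ.* U ≤ suc u ℕ.* m → partialBit e (suc u) ≡ extract U m x e
  bit-complete e u u<U q = trans (sym (xorSum-stable (summand U m x e) (suc u) (U ∸ suc u) off)) (cong (partialBit e) (ℕₚ.m∸n+n≡m u<U))
    where
    off : ∀ u′ → suc u ≤ u′ → summand U m x e u′ ≡ false
    off u′ p = summand-off e u′ λ t → ℕₚ.<⇒≱ (proj₂ (inSeg-sound U m e u′ t)) (ℕₚ.≤-trans q (ℕₚ.*-monoˡ-≤ m p))

  bit-fresh : ∀ e u → u ℕ.* m < e ℕ.* U → partialBit e (suc u) ≡ false
  bit-fresh e u q = xorSum-false (summand U m x e) (suc u) λ u′ p → summand-off e u′ λ t →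
    ℕₚ.<⇒≱ (ℕₚ.≤-<-trans (ℕₚ.*-monoˡ-≤ m (ℕₚ.≤-pred p)) q) (proj₁ (inSeg-sound U m e u′ t))

  -- The invariant is u m + i = e U + w after `i` ones, with `e` bits emitted so far. If m exceeds
  -- U, one position may complete several bits; those with an empty segment come out as false.
  phaseD : ∀ r i e {a u v w} → u < U → i ℕ.+ r ≡ m → u ℕ.* m ℕ.+ i ≡ e ℕ.* U ℕ.+ w → w < U →
    Σ ℕ λ e′ → Σ ℕ λ w′ → (u ℕ.* m ℕ.+ m ≡ e′ ℕ.* U ℕ.+ w′) × (w′ < U) ×
    (⟪ pc pD , partialBit e (suc u) , a , suc n ℕ.+ i , outs e , k , (u , v , w) ⟫
      ⇒ ⟪ pc pD , partialBit e′ (suc u) , a , suc n ℕ.+ m , outs e′ , k , (u , v , w′) ⟫)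
  phaseD zero i e {a} {u} {v} {w} u<U i≡ inv w<U with trans (sym (ℕₚ.+-identityʳ i)) i≡
  ... | refl = e , w , inv , w<U , ⇒-refl
  phaseD (suc r) i e {a} {u} {v} {w} u<U i≡ inv w<U = tick (suc w ℕ.≟ U)
    where
    i<m : i < m
    i<m = suc≤ i≡
    enter : ⟪ pc pD , partialBit e (suc u) , a , suc n ℕ.+ i , outs e , k , (u , v , w) ⟫
      ⇒ ⟪ inc cD , partialBit e (suc u) , a , suc n ℕ.+ i , outs e , k , (u , v , w) ⟫
    enter = simple refl λ cs → cong (λ s → applyResult (seekEnd (partialBit e (suc u)) a s) (suc n ℕ.+ i) (mark ∷ []) (syms cs) (outs e))
      (cong isOne (trans (after i) (readIn-ones m i i<m)))
    ip≡ : suc (suc n ℕ.+ i) ≡ suc n ℕ.+ suc i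
    ip≡ = sym (ℕₚ.+-suc (suc n) i)
    tick : Dec (suc w ≡ U) → _
    tick (no ne) =
      let (e′ , w′ , inv′ , w′<U , run′) = phaseD r (suc i) e {a} {u} {v} {suc w} u<U (shift-suc i≡)
            (trans (ℕₚ.+-suc (u ℕ.* m) i) (trans (cong suc inv) (sym (ℕₚ.+-suc (e ℕ.* U) w)))) w+1<U
      in e′ , w′ , inv′ , w′<U , (enter ⨾ inc-no cD w+1<U k<B ⨾
        subst (λ p → ⟪ pc pD , partialBit e (suc u) , a , p , outs e , k , (u , v , suc w) ⟫ ⇒ ⟪ pc pD , partialBit e′ (suc u) , a , suc n ℕ.+ m , outs e′ , k , (u , v , w′) ⟫) (sym ip≡) run′)
      where
      w+1<U : suc w < U
      w+1<U = ℕₚ.≤∧≢⇒< w<U ne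
    tick (yes w+1≡U) =
      let (e′ , w′ , inv′ , w′<U , run′) = phaseD r (suc i) (suc e) {a} {u} {v} {0} u<U (shift-suc i≡) inv₁ (ℕₚ.≤-<-trans z≤n w<U)
      in e′ , w′ , inv′ , w′<U , (enter ⨾ inc-ov cD w+1≡U k<B ⨾
        subst (λ s → s ⇒ ⟪ pc pD , partialBit e′ (suc u) , a , suc n ℕ.+ m , outs e′ , k , (u , v , w′) ⟫)
          (sym state≡) run′)
      where
      total : u ℕ.* m ℕ.+ suc i ≡ suc e ℕ.* U
      total = trans (ℕₚ.+-suc (u ℕ.* m) i) (trans (cong suc inv) (trans (sym (ℕₚ.+-suc (e ℕ.* U) w)) (trans (cong (e ℕ.* U ℕ.+_) w+1≡U) (ℕₚ.+-comm (e ℕ.* U) U))))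
      inv₁ : u ℕ.* m ℕ.+ suc i ≡ suc e ℕ.* U ℕ.+ 0
      inv₁ = trans total (sym (ℕₚ.+-identityʳ _))
      complete : partialBit e (suc u) ≡ extract U m x e
      complete = bit-complete e u u<U (ℕₚ.≤-trans (ℕₚ.≤-reflexive (sym total))
        (ℕₚ.≤-trans (ℕₚ.+-monoʳ-≤ (u ℕ.* m) i<m) (ℕₚ.≤-reflexive (ℕₚ.+-comm (u ℕ.* m) m))))
      fresh : partialBit (suc e) (suc u) ≡ false
      fresh = bit-fresh (suc e) u (ℕₚ.<-≤-trans (ℕₚ.m<m+n (u ℕ.* m) (s≤s z≤n)) (ℕₚ.≤-reflexive total))
      state≡ : ⟪ pc pD , false , a , suc (suc n ℕ.+ i) , outs e ++ partialBit e (suc u) ∷ [] , k , (u , v , 0) ⟫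
        ≡ ⟪ pc pD , partialBit (suc e) (suc u) , a , suc n ℕ.+ suc i , outs (suc e) , k , (u , v , 0) ⟫
      state≡ = trans (cong (λ p → ⟪ pc pD , false , a , p , outs e ++ partialBit e (suc u) ∷ [] , k , (u , v , 0) ⟫) ip≡)
        (cong₂ (λ b c → ⟪ pc pD , b , a , suc n ℕ.+ suc i , outs e ++ c ∷ [] , k , (u , v , 0) ⟫) (sym fresh) complete)

  process : ∀ e {a u w} j → u ℕ.+ suc j ≡ U → u ℕ.* m ≡ e ℕ.* U ℕ.+ w → w < U →
    Σ ℕ λ e′ → Σ ℕ λ w′ → (suc u ℕ.* m ≡ e′ ℕ.* U ℕ.+ w′) × (w′ < U) ×
    Σ Bool λ a′ →
    (⟪ pc pA , partialBit e u , a , n , outs e , k , (u , 0 , w) ⟫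
      ⇒ ⟪ inc cE , partialBit e′ (suc u) , a′ , n , outs e′ , k , (u , 0 , w′) ⟫)
  process e {a} {u} {w} j u≡ inv w<U =
    let (e′ , w′ , inv′ , w′<U , runD) = phaseD m 0 e {rb} {u} {0} {w} u<U refl (trans (ℕₚ.+-identityʳ _) inv) w<U
    in e′ , w′ , trans (ℕₚ.+-comm m (u ℕ.* m)) inv′ , w′<U , rb ,
      (phaseA j u≡ (ℕₚ.≤-trans (ℕₚ.≤-trans (s≤s (ℕₚ.m≤n+m j u)) (ℕₚ.≤-reflexive (sym (ℕₚ.+-suc u j)))) (ℕₚ.≤-reflexive u≡))
      ⨾ phaseA′ u (trans (ℕₚ.+-suc j u) (trans (cong suc (ℕₚ.+-comm j u)) (trans (sym (ℕₚ.+-suc u j)) u≡))) u<U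
      ⨾ simple refl (λ cs → cong₂ (λ b p → aconf (pc pB₁) (partialBit e u) b p (mark ∷ []) (syms cs) (outs e))
          (trans (cong (isOne ∘ readIn W) ip≡) (isOne-upto (rightPos n U u) (ℕₚ.m∸n≤m n (U ∸ u)))) ip≡)
      ⨾ toC
      ⨾ simple refl (λ cs → cong (λ b → aconf (pc pC₁) b rb (leftPos n U u) (mark ∷ []) (syms cs) (outs e))
          (trans (cong (λ b → partialBit e u xor (rb ∧ b)) (isOne-upto (leftPos n U u) left≤n)) acc≡))
      ⨾ phaseC (n ∸ leftPos n U u) (ℕₚ.m+[n∸m]≡n left≤n)
      ⨾ subst (λ p → ⟪ pc pD , partialBit e (suc u) , rb , p , outs e , k , (u , 0 , w) ⟫ ⇒
            ⟪ pc pD , partialBit e′ (suc u) , rb , suc n ℕ.+ m , outs e′ , k , (u , 0 , w′) ⟫) (ℕₚ.+-identityʳ (suc n)) runD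
      ⨾ simple refl (λ cs → cong (λ s → applyResult (seekEnd (partialBit e′ (suc u)) rb s) (suc n ℕ.+ m) (mark ∷ []) (syms cs) (outs e′))
          (cong isOne (trans (after m) (readIn-end m))))
      ⨾ phaseE m ℕₚ.≤-refl)
    where
    u<U : u < U
    u<U = suc≤ u≡
    rb lb : Bool
    rb = at x (rightPos n U u)
    lb = at x (leftPos n U u)
    left≤n : leftPos n U u ≤ n
    left≤n = ℕₚ.≤-trans (ℕₚ.m∸n≤m (rightPos n U u) (2 ℕ.* U)) (ℕₚ.m∸n≤m n (U ∸ u))
    ip≡ : n ∸ suc j ≡ rightPos n U u
    ip≡ = cong (n ∸_) (sym (trans (cong (_∸ u) (sym u≡)) (ℕₚ.m+n∸m≡n u (suc j))))
    toC : ⟪ pc pB₁ , partialBit e u , rb , rightPos n U u , outs e , k , (u , 0 , w) ⟫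
      ⇒ ⟪ pc pC₀ , partialBit e u , rb , leftPos n U u , outs e , k , (u , 0 , w) ⟫
    toC = subst (λ t → ⟪ pc pB₁ , partialBit e u , rb , rightPos n U u , outs e , k , (u , 0 , w) ⟫
      ⇒ ⟪ pc pC₀ , partialBit e u , rb , rightPos n U u ∸ 2 ℕ.* t , outs e , k , (u , 0 , w) ⟫)
      U≡ (phaseB (U ∸ 1) U≡)
      where
      U≡ : suc (U ∸ 1) ≡ U
      U≡ = ℕₚ.m+[n∸m]≡n (ℕₚ.m^n>0 2 k)
    -- The machine adds the product without testing membership: u m = e U + w with w < U says
    -- precisely that `u` lies in segment `e`, the one being accumulated.
    acc≡ : partialBit e u xor (rb ∧ lb) ≡ partialBit e (suc u)
    acc≡ = cong (λ b → partialBit e u xor (b ∧ (rb ∧ lb))) (sym (inSeg-true U m e u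
      (ℕₚ.≤-trans (ℕₚ.m≤m+n (e ℕ.* U) w) (ℕₚ.≤-reflexive (sym inv)))
      (ℕₚ.≤-trans (ℕₚ.≤-reflexive (cong suc inv)) (ℕₚ.≤-trans (ℕₚ.≤-reflexive (sym (ℕₚ.+-suc (e ℕ.* U) w)))
        (ℕₚ.≤-trans (ℕₚ.+-monoʳ-≤ (e ℕ.* U) w<U) (ℕₚ.≤-reflexive (ℕₚ.+-comm (e ℕ.* U) U)))))))

  mainLoop : ∀ j e {a u w} → u ℕ.+ suc j ≡ U → u ℕ.* m ≡ e ℕ.* U ℕ.+ w → w < U →
    Σ Bool λ acc′ → Σ Bool λ a′ → Σ V λ ν →
    (⟪ pc pA , partialBit e u , a , n , outs e , k , (u , 0 , w) ⟫ ⇒ ⟪ pc pHalt , acc′ , a′ , n , outs m , k , ν ⟫)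
  mainLoop zero e {a} {u} {w} u≡ inv w<U =
    let (e′ , w′ , inv′ , w′<U , a′ , run′) = process e {a} {u} {w} zero u≡ inv w<U
        e′≡ = quotient e′ w′ (trans (cong (ℕ._* m) (sym (last u≡))) inv′) w′<U
    in partialBit e′ (suc u) , a′ , (0 , 0 , w′) ,
       subst (λ i → ⟪ pc pA , partialBit e u , a , n , outs e , k , (u , 0 , w) ⟫ ⇒ ⟪ pc pHalt , partialBit e′ (suc u) , a′ , n , outs i , k , (0 , 0 , w′) ⟫)
         e′≡ (run′ ⨾ inc-ov cE (last u≡) k<B)
    where
    -- After the last position the unary total is U m, so exactly m wraps have occurred and all m
    -- bits are out.
    quotient : ∀ e w → U ℕ.* m ≡ e ℕ.* U ℕ.+ w → w < U → e ≡ m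
    quotient e w q w<U = ℕₚ.≤-antisym
      (ℕₚ.*-cancelʳ-≤ e m U {{ℕₚ.m^n≢0 2 k}} (ℕₚ.≤-trans (ℕₚ.m≤m+n _ w) (ℕₚ.≤-reflexive (trans (sym q) (ℕₚ.*-comm U m)))))
      (ℕₚ.≤-pred (ℕₚ.*-cancelʳ-< U m (suc e) (ℕₚ.≤-<-trans (ℕₚ.≤-reflexive (trans (ℕₚ.*-comm m U) q))
        (ℕₚ.<-≤-trans (ℕₚ.+-monoʳ-< (e ℕ.* U) w<U) (ℕₚ.≤-reflexive (ℕₚ.+-comm (e ℕ.* U) U))))))
  mainLoop (suc j) e {a} {u} {w} u≡ inv w<U =
    let (e′ , w′ , inv′ , w′<U , a′ , run′) = process e {a} {u} {w} (suc j) u≡ inv w<U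
        (acc″ , a″ , ν , run″) = mainLoop j e′ {a′} {suc u} {w′} (shift-suc u≡) inv′ w′<U
    in acc″ , a″ , ν , (run′ ⨾ inc-no cE (suc≤ (shift-suc u≡)) k<B ⨾ run″)

  outs-extract : ∀ l → outs l ≡ bitsToList l (λ j → extract U m x (toℕ j))
  outs-extract zero = refl
  outs-extract (suc l) = trans (cong (_++ extract U m x l ∷ []) (outs-extract l)) (sym (snoc (extract U m x) l))
    where
    snoc : ∀ (g : ℕ → Bool) l → bitsToList (suc l) (g ∘ toℕ) ≡ bitsToList l (g ∘ toℕ) ++ g l ∷ []
    snoc g zero = refl
    snoc g (suc l) = cong (g 0 ∷_) (snoc (g ∘ suc) l)

-- Scanning the input and growing the tape

module Setup (n m : ℕ) (x : Bits n) (B : ℕ) (1≤B : 1 ≤ B)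
  (narrow : ∀ s → s ≤ n / 4 → suc (proj₁ (grow s)) ≤ B) where

  open Loops n m x (width n) B (narrow (n / 4) ℕₚ.≤-refl) hiding (1≤B)
  open Traces W B
  open Macro W B 1≤B

  advance : ∀ p q {ip k ν} → ip < n → (∀ i s → transition p false false i s ≡ scan q false false (isSep i)) → isHalt p ≡ false →
    ⟪ p , false , false , ip , [] , k , ν ⟫ ⇒ ⟪ q , false , false , suc ip , [] , k , ν ⟫
  advance p q {ip} lt e nh = simple nh λ cs →
    trans (cong (λ r → applyResult r ip (mark ∷ []) (syms cs) []) (e (readIn W ip) (hd (syms cs))))
      (cong (λ b → applyResult (scan q false false b) ip (mark ∷ []) (syms cs) []) (isSep-inside ip lt))

  finish : ∀ p q {k ν} → (∀ i s → transition p false false i s ≡ scan q false false (isSep i)) → isHalt p ≡ false →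
    ⟪ p , false , false , n , [] , k , ν ⟫ ⇒ ⟪ inc cClear , false , false , n , [] , k , ν ⟫
  finish p q e nh = simple nh λ cs →
    trans (cong (λ r → applyResult r n (mark ∷ []) (syms cs) []) (e (readIn W n) (hd (syms cs))))
      (cong (λ b → applyResult (scan q false false b) n (mark ∷ []) (syms cs) []) (cong isSep separator))

  scanned : ℕ → HState
  scanned s = ⟪ pc pS₀ , false , false , s ℕ.* 4 , [] , proj₁ (grow s) , (0 , proj₂ (grow s) , 0) ⟫

  count-group : ∀ s → suc (proj₁ (grow s)) ≤ B →
    ⟪ inc cScan , false , false , suc s ℕ.* 4 , [] , proj₁ (grow s) , (0 , proj₂ (grow s) , 0) ⟫ ⇒ scanned (suc s)
  count-group s b with grow s | grow-spec s
  ... | k , v | v< , _ with suc v ℕ.≟ 2 ℕ.^ k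
  ...   | yes e = inc-ov cScan e b
  ...   | no ne = inc-no cScan (ℕₚ.≤∧≢⇒< v< ne) b

  scan-group : ∀ s → suc s ℕ.* 4 ≤ n → suc (proj₁ (grow s)) ≤ B → scanned s ⇒ scanned (suc s)
  scan-group s q b =
      advance (pc pS₀) (pc pS₁) (ℕₚ.≤-trans (ℕₚ.m≤n+m (1 ℕ.+ s ℕ.* 4) 3) q) (λ _ _ → refl) refl
    ⨾ advance (pc pS₁) (pc pS₂) (ℕₚ.≤-trans (ℕₚ.m≤n+m (2 ℕ.+ s ℕ.* 4) 2) q) (λ _ _ → refl) refl
    ⨾ advance (pc pS₂) (pc pS₃) (ℕₚ.≤-trans (ℕₚ.m≤n+m (3 ℕ.+ s ℕ.* 4) 1) q) (λ _ _ → refl) refl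
    ⨾ advance (pc pS₃) (inc cScan) q (λ _ _ → refl) refl
    ⨾ count-group s b

  scan-loop : ∀ r s → s ℕ.+ r ≡ n / 4 → scanned s ⇒ scanned (n / 4)
  scan-loop zero s e = subst (λ t → scanned s ⇒ scanned t) (trans (sym (ℕₚ.+-identityʳ s)) e) ⇒-refl
  scan-loop (suc r) s e =
    scan-group s (ℕₚ.≤-trans (ℕₚ.*-monoˡ-≤ 4 (suc≤ e)) (m/n*n≤m n 4)) (narrow s (ℕₚ.≤-trans (ℕₚ.n≤1+n s) (suc≤ e)))
      ⨾ scan-loop r (suc s) (shift-suc e)

  -- The n mod 4 bits of the incomplete last group are passed without counting; the separator may be
  -- met in any of the four scanning states.
  scan-rest : ∀ r {ip k ν} → r < 4 → ip ℕ.+ r ≡ n →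
    ⟪ pc pS₀ , false , false , ip , [] , k , ν ⟫ ⇒ ⟪ inc cClear , false , false , n , [] , k , ν ⟫
  scan-rest 0 {ip} _ e with trans (sym (ℕₚ.+-identityʳ ip)) e
  ... | refl = finish (pc pS₀) (pc pS₁) (λ _ _ → refl) refl
  scan-rest 1 {ip} _ e with trans (ℕₚ.+-comm 1 ip) e
  ... | refl = advance (pc pS₀) (pc pS₁) ℕₚ.≤-refl (λ _ _ → refl) refl ⨾ finish (pc pS₁) (pc pS₂) (λ _ _ → refl) refl
  scan-rest 2 {ip} _ e with trans (ℕₚ.+-comm 2 ip) e
  ... | refl = advance (pc pS₀) (pc pS₁) (ℕₚ.n≤1+n _) (λ _ _ → refl) refl
    ⨾ advance (pc pS₁) (pc pS₂) ℕₚ.≤-refl (λ _ _ → refl) refl ⨾ finish (pc pS₂) (pc pS₃) (λ _ _ → refl) refl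
  scan-rest 3 {ip} _ e with trans (ℕₚ.+-comm 3 ip) e
  ... | refl = advance (pc pS₀) (pc pS₁) (ℕₚ.m≤n+m (1 ℕ.+ ip) 2) (λ _ _ → refl) refl
    ⨾ advance (pc pS₁) (pc pS₂) (ℕₚ.n≤1+n _) (λ _ _ → refl) refl
    ⨾ advance (pc pS₂) (pc pS₃) ℕₚ.≤-refl (λ _ _ → refl) refl ⨾ finish (pc pS₃) (inc cScan) (λ _ _ → refl) refl
  scan-rest (suc (suc (suc (suc r)))) (s≤s (s≤s (s≤s (s≤s ())))) e

  whole : Σ Bool λ acc → Σ Bool λ a → Σ V λ ν →
    scanned 0 ⇒ ⟪ pc pHalt , acc , a , n , outs m , width n , ν ⟫
  whole =
    let (acc , a , ν , run′) = mainLoop (U ∸ 1) 0 {false} {0} {0} (ℕₚ.m+[n∸m]≡n (ℕₚ.m^n>0 2 (width n))) refl (ℕₚ.m^n>0 2 (width n))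
    in acc , a , ν ,
      (scan-loop (n / 4) 0 refl
      ⨾ scan-rest (n % 4) (m%n<n n 4) (trans (ℕₚ.+-comm (n / 4 ℕ.* 4) (n % 4)) (sym (m≡m%n+[m/n]*n n 4)))
      ⨾ clear (U ∸ suc v) (trans (ℕₚ.+-suc v _) (ℕₚ.m+[n∸m]≡n (proj₁ (grow-spec (n / 4)))))
      ⨾ run′)
    where v = proj₂ (grow (n / 4))

  trace : Σ AConf λ c → (aconf (pc pInit) false false 0 [] [] [] ⟶* c) × (isHalt (AConf.apc c) ≡ true)
    × (length (AConf.aleft c) ≤ B) × (AConf.aout c ≡ bitsToList m (extractor n m x))
  trace =
    let (acc , a , ν , reach) = whole
        (cs , τ , tr) = reach [] (refl , λ { tu → refl ; tv → refl ; tw → refl })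
    in _ , next z≤n refl refl tr , refl , 1≤B , outs-extract m

-- For positive n, 2^k ≤ s + 1 ≤ n/4 + 1 ≤ n. All s up to n/4 are covered because the space bound
-- must hold during the scan as well.
grow-narrow : ∀ n s → s ≤ n / 4 → proj₁ (grow s) ≤ ⌈log₂ n ⌉
grow-narrow zero s q with ℕₚ.n≤0⇒n≡0 q
... | refl = z≤n
grow-narrow n@(suc _) s q = ℕₚ.≤-trans (ℕₚ.≤-reflexive (sym (⌈log₂2^n⌉≡n k))) (⌈log₂⌉-mono-≤ (ℕₚ.≤-trans (ℕₚ.m≤m+n (2 ℕ.^ k) _)
    (ℕₚ.≤-trans (ℕₚ.≤-reflexive (proj₂ (grow-spec s))) (ℕₚ.≤-<-trans q (m/n<m n 4 (s≤s (s≤s z≤n)))))))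
  where k = proj₁ (grow s)

module _ (finiteState : Finite State) where
  open Simulation finiteState

  run^≡runTM : ∀ w B t → run^ w B t (initConfig machine) ≡ runTM machine w t
  run^≡runTM w B t = trans (shifted t 0) (cong (runTM machine w) (ℕₚ.+-identityʳ t))
    where
    shifted : ∀ t s → run^ w B t (runTM machine w s) ≡ runTM machine w (t ℕ.+ s)
    shifted zero s = refl
    shifted (suc t) s = trans (shifted t (suc s)) (cong (runTM machine w) (ℕₚ.+-suc t s))

  extractor-logspace-with : LogSpaceComputable extractor
  -- The mark, at most ⌈log₂ n⌉ cells and the blank behind them occupy positions 0 to ⌈log₂ n⌉ + 1,
  -- so the constant is 1.
  extractor-logspace-with = machine , 1 , λ n m _ x →
    let B = 1 ℕ.* (⌈log₂ n ⌉ ℕ.+ 1)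
        W = encodeInput n m x
        B≡ : suc ⌈log₂ n ⌉ ≡ B
        B≡ = trans (ℕₚ.+-comm 1 ⌈log₂ n ⌉) (sym (ℕₚ.*-identityˡ _))
        (c , tr , h , b , o) = Setup.trace n m x B (ℕₚ.≤-trans (s≤s z≤n) (ℕₚ.≤-reflexive B≡))
          (λ s q → ℕₚ.≤-trans (s≤s (grow-narrow n s q)) (ℕₚ.≤-reflexive B≡))
        (t , h′ , o′ , b′) = trace-halts W B initial-Rep tr h b
        to = run^≡runTM W B
    in (t , subst (λ c → TM.halting machine (Config.state c) ≡ true) (to t) h′ ,
            trans (cong Config.out (sym (to t))) (trans o′ o)) ,
       λ t → subst (λ c → Config.wpos c ≤ B) (to t) (b′ t)

extractor-logspace : LogSpaceComputable extractor
extractor-logspace = extractor-logspace-with finState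

theorem4p9 : Σ ℕ λ p → Σ ℕ λ q → 1 ≤ p × 1 ≤ q ×
    Σ ((n m : ℕ) → Bits n → Bits m) λ R →
    (∀ n m → 3 * m ≤ n →
    ∀ {N} (P : RBP n m N) (v₀ : Fin N) (f : Bits n → Bool) (δ : ℚ) →
    Acyclic P → IsSR P → ComputesWithFailure P v₀ f δ →
    ∀ T → QueriesAtMost P T →
    q * (T * ⌈log₂ N ⌉ * m) ≤ p * (n * n) →
    DensityBound (errorDensity P v₀ f (R n m)) δ p q n m)
    × LogSpaceComputable R
-- Here α = 1 / (16 · 67): the 16 comes from g ≥ n / 16 in `communication-bound`, the 67 from
-- `exponent-bound`.
theorem4p9 = 1 , 16 * 67 , s≤s z≤n , s≤s z≤n , extractor ,
  (λ n m _ P v₀ f δ _ sr comp T queries cost →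
    extractor-density 67 ℕₚ.≤-refl n m P v₀ f δ sr comp T queries cost) ,
  extractor-logspace
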